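{- For $n\ge 1$ let $P_{n}^{(\mathrm{udr},\mathrm{iudr})}(s,t)=\sum_{\pi\in\mathfrak{S}_{n}}s^{\mathrm{udr}(\pi)}t^{\mathrm{iudr}(\pi)}$. Then, as formal power series, \begin{multline*} \frac{1}{(1-s)(1-t)}+\frac{1}{4(1-s)^{2}(1-t)^{2}}\sum_{n=1}^{\infty}\frac{(1+s^{2})^{n}(1+t^{2})^{n}}{(1-s^{2})^{n-1}(1-t^{2})^{n-1}}P_{n}^{(\mathrm{udr},\mathrm{iudr})}\left(\frac{2s}{1+s^{2}},\frac{2t}{1+t^{2}}\right)x^{n}\\ =\sum_{i,j=0}^{\infty}\left(\frac{1+x}{1-x}\right)^{2ij}\left(1+s\left(\frac{1+x}{1-x}\right)^{j}+t\left(\frac{1+x}{1-x}\right)^{i}+st\frac{(1+x)^{i+j}}{(1-x)^{i+j+1}}\right)s^{2i}t^{2j}. \end{multline*}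
   Context: $\mathfrak{S}_n$ is the symmetric group on $[n]$, and permutations are written in one-line notation $\pi(1)\pi(2)\cdots\pi(n)$. A birun of $\pi$ is a maximal monotone (increasing or decreasing) consecutive subsequence. An up-down run of $\pi$ is either a birun of $\pi$, or the one-element subsequence $\pi(1)$ in the case $\pi(1)>\pi(2)$. $\mathrm{udr}(\pi)$ is the number of up-down runs of $\pi$ (so $\mathrm{udr}=1$ for the unique permutation in $\mathfrak{S}_1$), and $\mathrm{iudr}(\pi)=\mathrm{udr}(\pi^{ -1})$. -}

module Defs where

open import Data.Nat as ℕ using (ℕ; zero; suc; _∸_)
open import Data.Bool using (Bool; true; false; _∧_; _∨_; not; if_then_else_)
open import Data.List using (List; []; _∷_; length; map; concatMap; filter; foldr; upTo)
open import Data.Integer using (+_; -[1+_])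
open import Data.Rational using (ℚ; 0ℚ; 1ℚ; _+_; _*_; -_; _/_)

-- Permutations of [n] in one-line notation, as lists of naturals.

words : ℕ → ℕ → List (List ℕ)
words zero    n = [] ∷ []
words (suc k) n = concatMap (λ w → map (λ a → suc a ∷ w) (upTo n)) (words k n)

infix 4 _==_ _<ᵇ_
_==_ : ℕ → ℕ → Bool
m == n = m ℕ.≡ᵇ n

_<ᵇ_ : ℕ → ℕ → Bool
m <ᵇ n = m ℕ.<ᵇ n

elem : ℕ → List ℕ → Bool
elem a []       = false
elem a (b ∷ bs) = (a == b) ∨ elem a bs

distinct : List ℕ → Bool
distinct []       = true
distinct (a ∷ as) = not (elem a as) ∧ distinct as

-- 𝔖ₙ : the words of length n over [n] with pairwise distinct letters
-- (each permutation of [n] occurs exactly once)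
perms : ℕ → List (List ℕ)
perms n = filter (λ w → Data.Bool._≟_ (distinct w) true) (words n n)
  where import Data.Bool

-- 1-based position of the letter a in w (0 if absent)
position : ℕ → List ℕ → ℕ
position a []       = 0
position a (b ∷ bs) = if a == b then 1 else (if elem a bs then suc (position a bs) else 0)

inverse : List ℕ → List ℕ
inverse w = map (λ k → position (suc k) w) (upTo (length w))

-- entry at 0-based index i (0 if out of range)
at : List ℕ → ℕ → ℕ
at []       i       = 0
at (a ∷ as) zero    = a
at (a ∷ as) (suc i) = at as i

incr : List ℕ → ℕ → ℕ → Bool
incr w i zero    = true
incr w i (suc l) = (at w (i ℕ.+ l) <ᵇ at w (i ℕ.+ suc l)) ∧ incr w i l

decr : List ℕ → ℕ → ℕ → Bool
decr w i zero    = true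
decr w i (suc l) = (at w (i ℕ.+ suc l) <ᵇ at w (i ℕ.+ l)) ∧ decr w i l

-- segment starting at i with l+1 entries is monotone
mono : List ℕ → ℕ → ℕ → Bool
mono w i l = incr w i l ∨ decr w i l

-- the segment w[i .. i+l] (within range) is a birun: monotone and maximal,
-- i.e. neither extension by one entry to the left or right is monotone
isBirun : List ℕ → ℕ → ℕ → Bool
isBirun w i l =
  ((suc (i ℕ.+ l)) ℕ.≤ᵇ (length w)) ∧ mono w i l
  ∧ (if i == 0 then true else not (mono w (i ∸ 1) (suc l)))
  ∧ (if (suc (i ℕ.+ l)) == (length w) then true else not (mono w i (suc l)))

count : ℕ → (ℕ → Bool) → ℕ
count zero    p = 0
count (suc k) p = (if p k then 1 else 0) ℕ.+ count k p

biruns : List ℕ → ℕ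
biruns w = sumℕ (length w) (λ i → count (length w) (λ l → isBirun w i l))
  where
  sumℕ : ℕ → (ℕ → ℕ) → ℕ
  sumℕ zero    f = 0
  sumℕ (suc k) f = f k ℕ.+ sumℕ k f

udr : List ℕ → ℕ
udr w = biruns w ℕ.+ (if (2 ℕ.≤ᵇ length w) ∧ (at w 1 <ᵇ at w 0) then 1 else 0)

iudr : List ℕ → ℕ
iudr w = udr (inverse w)

-- Formal power series in s, t, x over ℚ:
-- a series is its coefficient function, F a b c = [s^a t^b x^c] F.

Series : Set
Series = ℕ → ℕ → ℕ → ℚ

sumTo : ℕ → (ℕ → ℚ) → ℚ
sumTo zero    f = f 0
sumTo (suc n) f = sumTo n f + f (suc n)

const : ℚ → Series
const q zero zero zero = q
const q _    _    _    = 0ℚ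

fromℕ : ℕ → ℚ
fromℕ n = + n / 1

sV tV xV : Series
sV a b c = if (a == 1) ∧ (b == 0) ∧ (c == 0) then 1ℚ else 0ℚ
tV a b c = if (a == 0) ∧ (b == 1) ∧ (c == 0) then 1ℚ else 0ℚ
xV a b c = if (a == 0) ∧ (b == 0) ∧ (c == 1) then 1ℚ else 0ℚ

_⊕_ : Series → Series → Series
(f ⊕ g) a b c = f a b c + g a b c

⊖_ : Series → Series
(⊖ f) a b c = - f a b c

_⊗_ : Series → Series → Series
(f ⊗ g) a b c =
  sumTo a λ a₁ → sumTo b λ b₁ → sumTo c λ c₁ →
    f a₁ b₁ c₁ * g (a ∸ a₁) (b ∸ b₁) (c ∸ c₁)

infixl 6 _⊕_
infixl 7 _⊗_

_^^_ : Series → ℕ → Series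
f ^^ zero  = const 1ℚ
f ^^ suc n = f ⊗ (f ^^ n)

-- For u with zero constant term, geom u = Σ_{k≥0} u^k = 1/(1-u), the inverse
-- of 1 - u in ℚ[[s,t,x]].  Only k ≤ a+b+c contribute to [s^a t^b x^c].
geom : Series → Series
geom u a b c = sumTo (a ℕ.+ b ℕ.+ c) (λ k → (u ^^ k) a b c)

-- Σ_{n≥1} F n, valid when x^n divides F n (only n ≤ c contribute to x^c)
sumX₁ : (ℕ → Series) → Series
sumX₁ F a b c = sumTo c (λ n → if n == 0 then 0ℚ else F n a b c)

-- Σ_{i,j≥0} G i j, valid when s^(2i) t^(2j) divides G i j
sumST : (ℕ → ℕ → Series) → Series
sumST G a b c = sumTo a λ i → sumTo b λ j → G i j a b c

P : ℕ → Series → Series → Series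
P n u v = foldr (λ π acc → (u ^^ udr π) ⊗ (v ^^ iudr π) ⊕ acc) (const 0ℚ) (perms n)

one : Series
one = const 1ℚ

two : Series
two = const (fromℕ 2)

inv1-s inv1-t inv1-s² inv1-t² inv1-x inv1+s² inv1+t² : Series
inv1-s  = geom sV
inv1-t  = geom tV
inv1-s² = geom (sV ^^ 2)
inv1-t² = geom (tV ^^ 2)
inv1-x  = geom xV
inv1+s² = geom (⊖ (sV ^^ 2))
inv1+t² = geom (⊖ (tV ^^ 2))

LHS : Series
LHS = inv1-s ⊗ inv1-t
    ⊕ const (+ 1 / 4) ⊗ (inv1-s ^^ 2) ⊗ (inv1-t ^^ 2)
      ⊗ sumX₁ (λ n →
          ((one ⊕ sV ^^ 2) ^^ n) ⊗ ((one ⊕ tV ^^ 2) ^^ n)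
          ⊗ (inv1-s² ^^ (n ∸ 1)) ⊗ (inv1-t² ^^ (n ∸ 1))
          ⊗ P n (two ⊗ sV ⊗ inv1+s²) (two ⊗ tV ⊗ inv1+t²)
          ⊗ (xV ^^ n))

q : Series
q = (one ⊕ xV) ⊗ inv1-x

RHS : Series
RHS = sumST (λ i j →
        (q ^^ (2 ℕ.* i ℕ.* j))
        ⊗ (one ⊕ sV ⊗ (q ^^ j) ⊕ tV ⊗ (q ^^ i)
           ⊕ sV ⊗ tV ⊗ ((one ⊕ xV) ^^ (i ℕ.+ j)) ⊗ (inv1-x ^^ (i ℕ.+ j ℕ.+ 1)))
        ⊗ (sV ^^ (2 ℕ.* i)) ⊗ (tV ^^ (2 ℕ.* j)))

{-# OPTIONS --safe #-}

-- Call a cutting of a word into k consecutive, possibly empty pieces that are alternately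
-- increasing and decreasing (starting with increasing) a k-cutting, and let N_k(w) be their number.
-- To the series Σ_k N_k(w) s^k each adjacent pair of letters contributes a factor (1+s²)/(1-s²) if it
-- keeps the direction and 2s/(1-s²) if it turns, so that for w of length n ≥ 1
--   Σ_k N_k(w) s^k = (1+s²)ⁿ / (2(1-s)²(1-s²)ⁿ⁻¹) · (2s/(1+s²))^udr(w),
-- and the coefficient of s^k t^l xⁿ on the left-hand side is Σ_π N_k(π) N_l(π⁻¹).
-- An l-cutting of π⁻¹ labels the values of π by 1, …, l.  Replacing each value by its label gives a
-- word over [l], and π is recovered from it by the standardization that numbers equal odd letters
-- from left to right and equal even letters from right to left.  Hence the sum counts the k-cuttings
-- of all words of length n over [l], where odd letters may repeat in increasing pieces and even
-- letters in decreasing ones.  The pieces are independent: an increasing piece contributes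
-- Π_{b odd} 1/(1-x) · Π_{b even} (1+x), a decreasing one the same with the parities exchanged,
-- and the product over the k pieces is the right-hand side.

module Submission where

open import Defs
open import Level using (0ℓ)
open import Algebra.Bundles using (CommutativeRing; CommutativeSemiring)
open import Data.Bool as Bool using (Bool; true; false; if_then_else_; _∧_; _∨_; not; T)
open import Data.Bool.Properties using (∧-zeroʳ; ∨-zeroʳ)
open import Data.Empty using (⊥-elim)
open import Data.Fin as Fin using (Fin)
import Data.Fin.Properties as Fin
open import Data.Integer using (+_)
open import Data.List using (List; []; _∷_; _++_; length; map; concatMap; foldr; filter; upTo; applyUpTo)
open import Data.List.Properties using (map-upTo; length-applyUpTo)
open import Data.List.Relation.Unary.All as All using (All; []; _∷_)
import Data.List.Relation.Unary.All.Properties as All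
open import Data.Nat as ℕ using (ℕ; zero; suc; _<_; _≤_; z≤n; s≤s; _∸_; _≤ᵇ_; pred; ⌊_/2⌋)
import Data.Nat.Properties as ℕ
open import Data.Nat.Solver using (module +-*-Solver)
open import Data.Product using (∃; _×_; _,_; proj₁; proj₂)
open import Data.Rational as ℚ using (ℚ; 0ℚ; 1ℚ)
import Data.Rational.Properties as ℚ
open import Data.Sum using (inj₁; inj₂)
open import Function using (_∘_)
open import Relation.Binary using (tri<; tri≈; tri>)
open import Relation.Binary.PropositionalEquality as ≡ using (_≡_; _≢_)
open import Relation.Nullary using (¬_; does; yes; no)
open import Relation.Nullary.Negation using (contradiction)
open import Relation.Unary using (Pred; Decidable)

-- Why each step contributes a scalar: between two neighbouring letters the number of cuts is even
-- if their pieces have the same direction and odd otherwise, and it can be zero only if the step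
-- follows that direction. With the direction of the step listed first, the four weights form the
-- matrix 1/(1-s²) · ((1, s), (s, s²)), which has rank one. Hence successive steps interact only
-- through inner products of (1, s) and (s, 1): 1 + s² for equal and 2s for opposite directions.
-- What precedes the first letter acts like an ascent, which matches the extra run π(1) when π(1) >
-- π(2). A one-letter word has k cuttings into k pieces, and s/(1-s)² = 1/2 · (1+s²)/(1-s)² ·
-- 2s/(1+s²); the halves from s and from t make the 1/4. The empty word has one k-cutting for every
-- k, and this is the separate summand 1/((1-s)(1-t)). The four summands in the parenthesis on the
-- right belong to the four parities of (k, l), with i and j the integer halves of k and l.

module FiniteSums {c ℓ} (R : CommutativeSemiring c ℓ) where
  open CommutativeSemiring R
  open import Relation.Binary.Reasoning.Setoid setoid
  open import Algebra.Solver.Ring.NaturalCoefficients.Default R using (solve; _:+_; _:*_; _:=_)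

  private variable
    A B : Set

  ⟦_⟧ : Bool → Carrier
  ⟦ true  ⟧ = 1#
  ⟦ false ⟧ = 0#

  ∑ : List A → (A → Carrier) → Carrier
  ∑ []       f = 0#
  ∑ (x ∷ xs) f = f x + ∑ xs f

  ∑-cong-All : ∀ {p} {P : Pred A p} {xs : List A} {f g} → All P xs →
               (∀ x → P x → f x ≈ g x) → ∑ xs f ≈ ∑ xs g
  ∑-cong-All []         f≈g = refl
  ∑-cong-All (px ∷ pxs) f≈g = +-cong (f≈g _ px) (∑-cong-All pxs f≈g)

  ∑-cong : ∀ (xs : List A) {f g} → (∀ x → f x ≈ g x) → ∑ xs f ≈ ∑ xs g
  ∑-cong []       f≈g = refl
  ∑-cong (x ∷ xs) f≈g = +-cong (f≈g x) (∑-cong xs f≈g)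

  ∑-zero : ∀ (xs : List A) → ∑ xs (λ _ → 0#) ≈ 0#
  ∑-zero []       = refl
  ∑-zero (x ∷ xs) = trans (+-identityˡ _) (∑-zero xs)

  ∑-+ : ∀ (xs : List A) f g → ∑ xs (λ x → f x + g x) ≈ ∑ xs f + ∑ xs g
  ∑-+ []       f g = sym (+-identityˡ 0#)
  ∑-+ (x ∷ xs) f g = begin
    f x + g x + ∑ xs (λ y → f y + g y)  ≈⟨ +-congˡ (∑-+ xs f g) ⟩
    f x + g x + (∑ xs f + ∑ xs g)       ≈⟨ solve 4 (λ a b c d → a :+ b :+ (c :+ d) := a :+ c :+ (b :+ d)) refl (f x) (g x) (∑ xs f) (∑ xs g) ⟩
    f x + ∑ xs f + (g x + ∑ xs g)       ∎

  *-∑ : ∀ (xs : List A) r f → r * ∑ xs f ≈ ∑ xs (λ x → r * f x)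
  *-∑ []       r f = zeroʳ r
  *-∑ (x ∷ xs) r f = trans (distribˡ r (f x) (∑ xs f)) (+-congˡ (*-∑ xs r f))

  ∑-* : ∀ (xs : List A) r f → ∑ xs f * r ≈ ∑ xs (λ x → f x * r)
  ∑-* []       r f = zeroˡ r
  ∑-* (x ∷ xs) r f = trans (distribʳ r (f x) (∑ xs f)) (+-congˡ (∑-* xs r f))

  ∑-swap : ∀ (xs : List A) (ys : List B) (f : A → B → Carrier) →
           ∑ xs (λ x → ∑ ys (f x)) ≈ ∑ ys (λ y → ∑ xs (λ x → f x y))
  ∑-swap []       ys f = sym (∑-zero ys)
  ∑-swap (x ∷ xs) ys f = trans (+-congˡ (∑-swap xs ys f)) (sym (∑-+ ys (f x) _))

  ∑-++ : ∀ (xs ys : List A) f → ∑ (xs ++ ys) f ≈ ∑ xs f + ∑ ys f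
  ∑-++ []       ys f = sym (+-identityˡ _)
  ∑-++ (x ∷ xs) ys f = trans (+-congˡ (∑-++ xs ys f)) (sym (+-assoc _ _ _))

  ∑-map : ∀ (h : A → B) (xs : List A) f → ∑ (map h xs) f ≈ ∑ xs (λ x → f (h x))
  ∑-map h []       f = refl
  ∑-map h (x ∷ xs) f = +-congˡ (∑-map h xs f)

  ∑-concatMap : ∀ (h : A → List B) (xs : List A) f →
                ∑ (concatMap h xs) f ≈ ∑ xs (λ x → ∑ (h x) f)
  ∑-concatMap h []       f = refl
  ∑-concatMap h (x ∷ xs) f = trans (∑-++ (h x) _ f) (+-congˡ (∑-concatMap h xs f))

  ∑-filter : ∀ {p} {P : Pred A p} (P? : Decidable P) (xs : List A) f →
             ∑ (filter P? xs) f ≈ ∑ xs (λ x → ⟦ does (P? x) ⟧ * f x)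
  ∑-filter P? []       f = refl
  ∑-filter P? (x ∷ xs) f with does (P? x)
  ... | true  = +-cong (sym (*-identityˡ _)) (∑-filter P? xs f)
  ... | false = trans (∑-filter P? xs f) (sym (trans (+-congʳ (zeroˡ _)) (+-identityˡ _)))

  ∑-applyUpTo : ∀ (h : ℕ → A) n f → ∑ (applyUpTo h n) f ≈ ∑ (upTo n) (λ i → f (h i))
  ∑-applyUpTo h zero    f = refl
  ∑-applyUpTo h (suc n) f = +-congˡ (begin
    ∑ (applyUpTo (λ i → h (suc i)) n) f  ≈⟨ ∑-applyUpTo _ n f ⟩
    ∑ (upTo n) (λ i → f (h (suc i)))     ≈⟨ ∑-applyUpTo suc n (λ i → f (h i)) ⟨
    ∑ (applyUpTo suc n) (λ i → f (h i))  ∎)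

  ∑-upTo-suc : ∀ n f → ∑ (upTo (suc n)) f ≈ f 0 + ∑ (upTo n) (λ i → f (suc i))
  ∑-upTo-suc n f = +-congˡ (∑-applyUpTo suc n f)

  ∑-upTo-last : ∀ n f → ∑ (upTo (suc n)) f ≈ ∑ (upTo n) f + f n
  ∑-upTo-last zero    f = +-comm _ _
  ∑-upTo-last (suc n) f = begin
    ∑ (upTo (suc (suc n))) f                         ≈⟨ ∑-upTo-suc (suc n) f ⟩
    f 0 + ∑ (upTo (suc n)) (λ i → f (suc i))         ≈⟨ +-congˡ (∑-upTo-last n _) ⟩
    f 0 + (∑ (upTo n) (λ i → f (suc i)) + f (suc n)) ≈⟨ +-assoc _ _ _ ⟨
    f 0 + ∑ (upTo n) (λ i → f (suc i)) + f (suc n)   ≈⟨ +-congʳ (∑-upTo-suc n f) ⟨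
    ∑ (upTo (suc n)) f + f (suc n)                   ∎

  ∑-upTo-cong : ∀ n {f g} → (∀ i → i < n → f i ≈ g i) → ∑ (upTo n) f ≈ ∑ (upTo n) g
  ∑-upTo-cong zero    f≈g = refl
  ∑-upTo-cong (suc n) {f} {g} f≈g = begin
    ∑ (upTo (suc n)) f                   ≈⟨ ∑-upTo-suc n f ⟩
    f 0 + ∑ (upTo n) (λ i → f (suc i))   ≈⟨ +-cong (f≈g 0 (s≤s z≤n)) (∑-upTo-cong n (λ i i<n → f≈g (suc i) (s≤s i<n))) ⟩
    g 0 + ∑ (upTo n) (λ i → g (suc i))   ≈⟨ ∑-upTo-suc n g ⟨
    ∑ (upTo (suc n)) g                   ∎

  ∑-upTo-δ : ∀ n j f → j < n → ∑ (upTo n) (λ i → ⟦ i == j ⟧ * f i) ≈ f j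
  ∑-upTo-δ (suc n) zero    f j<n = begin
    ∑ (upTo (suc n)) (λ i → ⟦ i == 0 ⟧ * f i)           ≈⟨ ∑-upTo-suc n _ ⟩
    1# * f 0 + ∑ (upTo n) (λ i → 0# * f (suc i))        ≈⟨ +-cong (*-identityˡ _) (trans (∑-cong (upTo n) (λ i → zeroˡ _)) (∑-zero (upTo n))) ⟩
    f 0 + 0#                                            ≈⟨ +-identityʳ _ ⟩
    f 0                                                 ∎
  ∑-upTo-δ (suc n) (suc j) f (s≤s j<n) = begin
    ∑ (upTo (suc n)) (λ i → ⟦ i == suc j ⟧ * f i)          ≈⟨ ∑-upTo-suc n _ ⟩
    0# * f 0 + ∑ (upTo n) (λ i → ⟦ i == j ⟧ * f (suc i))   ≈⟨ +-cong (zeroˡ _) (∑-upTo-δ n j (λ i → f (suc i)) j<n) ⟩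
    0# + f (suc j)                                         ≈⟨ +-identityˡ _ ⟩
    f (suc j)                                              ∎

  -- `E` selects the single index `m`, which `A` misses; `o` decides whether `B` gains it, for
  -- instance whether a letter may be followed by itself.
  ∑-split : ∀ {l m} o (A E B : ℕ → Bool) (f : ℕ → Carrier) → m < l →
            (∀ i → E i ≡ (i == m)) → (∀ i → A i ∧ E i ≡ false) → (∀ i → B i ≡ A i ∨ (E i ∧ o)) →
            ∑ (upTo l) (λ i → ⟦ B i ⟧ * f i) ≈ ∑ (upTo l) (λ i → ⟦ A i ⟧ * f i) + ⟦ o ⟧ * f m
  ∑-split {l} {m} o A E B f m<l E≡ disjoint B≡ = begin
    ∑ (upTo l) (λ i → ⟦ B i ⟧ * f i)
      ≈⟨ ∑-cong (upTo l) (λ i → trans (*-congʳ (pointwise i)) (solve 4 (λ a e o f → (a :+ e :* o) :* f := a :* f :+ o :* (e :* f)) refl ⟦ A i ⟧ ⟦ i == m ⟧ ⟦ o ⟧ (f i))) ⟩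
    ∑ (upTo l) (λ i → ⟦ A i ⟧ * f i + ⟦ o ⟧ * (⟦ i == m ⟧ * f i))
      ≈⟨ ∑-+ (upTo l) _ _ ⟩
    ∑ (upTo l) (λ i → ⟦ A i ⟧ * f i) + ∑ (upTo l) (λ i → ⟦ o ⟧ * (⟦ i == m ⟧ * f i))
      ≈⟨ +-congˡ (*-∑ (upTo l) ⟦ o ⟧ _) ⟨
    ∑ (upTo l) (λ i → ⟦ A i ⟧ * f i) + ⟦ o ⟧ * ∑ (upTo l) (λ i → ⟦ i == m ⟧ * f i)
      ≈⟨ +-congˡ (*-congˡ (∑-upTo-δ l m f m<l)) ⟩
    ∑ (upTo l) (λ i → ⟦ A i ⟧ * f i) + ⟦ o ⟧ * f m
      ∎
    where
    exclusive : ∀ a e → a ∧ e ≡ false → ⟦ a ∨ (e ∧ o) ⟧ ≈ ⟦ a ⟧ + ⟦ e ⟧ * ⟦ o ⟧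
    exclusive true  false _ = sym (trans (+-congˡ (zeroˡ _)) (+-identityʳ _))
    exclusive false true  _ = sym (trans (+-identityˡ _) (*-identityˡ _))
    exclusive false false _ = sym (trans (+-identityˡ _) (zeroˡ _))

    pointwise : ∀ i → ⟦ B i ⟧ ≈ ⟦ A i ⟧ + ⟦ i == m ⟧ * ⟦ o ⟧
    pointwise i rewrite B≡ i | ≡.sym (E≡ i) = exclusive (A i) (E i) (disjoint i)

-- Formal power series over a commutative ring

module PowerSeries {c ℓ} (R : CommutativeRing c ℓ) where
  open CommutativeRing R hiding (zero)
  open import Relation.Binary.Reasoning.Setoid setoid
  open import Algebra.Solver.Ring.NaturalCoefficients.Default commutativeSemiring using (solve; _:+_; _:*_; _:=_)

  PS : Set c
  PS = ℕ → Carrier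

  infix 4 _≋_
  _≋_ : PS → PS → Set ℓ
  f ≋ g = ∀ n → f n ≈ g n

  tail : PS → PS
  tail f n = f (suc n)

  constant : Carrier → PS
  constant r zero    = r
  constant r (suc n) = 0#

  shift : PS → PS
  shift f zero    = 0#
  shift f (suc n) = f n

  infixl 7 _⋆_
  infixl 6 _✦_
  _✦_ : PS → PS → PS
  (f ✦ g) n = f n + g n

  -- Recursion on the head and tail of the first factor, in place of a sum over splittings of n,
  -- turns the ring laws into structural inductions; `⋆-sumTo` recovers the sum.
  _⋆_ : PS → PS → PS
  (f ⋆ g) zero    = f 0 * g 0
  (f ⋆ g) (suc n) = f 0 * g (suc n) + (tail f ⋆ g) n

  ⋆-cong : ∀ {f f′ g g′} → f ≋ f′ → g ≋ g′ → f ⋆ g ≋ f′ ⋆ g′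
  ⋆-cong p q zero    = *-cong (p 0) (q 0)
  ⋆-cong p q (suc n) = +-cong (*-cong (p 0) (q (suc n))) (⋆-cong (λ i → p (suc i)) q n)

  ⋆-zeroˡ : ∀ g → (λ _ → 0#) ⋆ g ≋ λ _ → 0#
  ⋆-zeroˡ g zero    = zeroˡ _
  ⋆-zeroˡ g (suc n) = trans (+-cong (zeroˡ _) (⋆-zeroˡ g n)) (+-identityˡ 0#)

  constant-⋆ : ∀ r g → constant r ⋆ g ≋ λ n → r * g n
  constant-⋆ r g zero    = refl
  constant-⋆ r g (suc n) = trans (+-congˡ (⋆-zeroˡ g n)) (+-identityʳ _)

  ⋆-distribʳ : ∀ h f g → (f ✦ g) ⋆ h ≋ (f ⋆ h) ✦ (g ⋆ h)
  ⋆-distribʳ h f g zero    = distribʳ _ _ _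
  ⋆-distribʳ h f g (suc n) = begin
    (f 0 + g 0) * h (suc n) + ((tail f ✦ tail g) ⋆ h) n                     ≈⟨ +-congˡ (⋆-distribʳ h (tail f) (tail g) n) ⟩
    (f 0 + g 0) * h (suc n) + ((tail f ⋆ h) n + (tail g ⋆ h) n)             ≈⟨ solve 5 (λ a b c d e → (a :+ b) :* c :+ (d :+ e) := a :* c :+ d :+ (b :* c :+ e)) refl (f 0) (g 0) (h (suc n)) ((tail f ⋆ h) n) ((tail g ⋆ h) n) ⟩
    f 0 * h (suc n) + (tail f ⋆ h) n + (g 0 * h (suc n) + (tail g ⋆ h) n)   ∎

  scale-⋆ : ∀ r f g → (λ n → r * f n) ⋆ g ≋ λ n → r * (f ⋆ g) n
  scale-⋆ r f g zero    = *-assoc _ _ _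
  scale-⋆ r f g (suc n) = begin
    r * f 0 * g (suc n) + ((λ n → r * f (suc n)) ⋆ g) n  ≈⟨ +-cong (*-assoc _ _ _) (scale-⋆ r (tail f) g n) ⟩
    r * (f 0 * g (suc n)) + r * (tail f ⋆ g) n           ≈⟨ distribˡ _ _ _ ⟨
    r * (f 0 * g (suc n) + (tail f ⋆ g) n)               ∎

  ⋆-assoc : ∀ f g h → (f ⋆ g) ⋆ h ≋ f ⋆ (g ⋆ h)
  ⋆-assoc f g h zero    = *-assoc _ _ _
  ⋆-assoc f g h (suc n) = begin
    f 0 * g 0 * h (suc n) + ((((λ n → f 0 * g (suc n)) ✦ (tail f ⋆ g)) ⋆ h) n)     ≈⟨ +-congˡ (⋆-distribʳ h _ (tail f ⋆ g) n) ⟩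
    f 0 * g 0 * h (suc n) + (((λ n → f 0 * g (suc n)) ⋆ h) n + ((tail f ⋆ g) ⋆ h) n) ≈⟨ +-congˡ (+-cong (scale-⋆ (f 0) (tail g) h n) (⋆-assoc (tail f) g h n)) ⟩
    f 0 * g 0 * h (suc n) + (f 0 * (tail g ⋆ h) n + (tail f ⋆ (g ⋆ h)) n)          ≈⟨ solve 5 (λ a b c d e → a :* b :* c :+ (a :* d :+ e) := a :* (b :* c :+ d) :+ e) refl (f 0) (g 0) (h (suc n)) ((tail g ⋆ h) n) ((tail f ⋆ (g ⋆ h)) n) ⟩
    f 0 * (g 0 * h (suc n) + (tail g ⋆ h) n) + (tail f ⋆ (g ⋆ h)) n                ∎

  -- The mirror image of the defining recursion: the head of `g` is split off instead of that of
  -- `f`. Commutativity follows by comparing the two.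
  ⋆-sucʳ : ∀ f g n → (f ⋆ g) (suc n) ≈ f (suc n) * g 0 + (f ⋆ tail g) n
  ⋆-sucʳ f g zero    = +-comm _ _
  ⋆-sucʳ f g (suc n) = begin
    f 0 * g (suc (suc n)) + (tail f ⋆ g) (suc n)                               ≈⟨ +-congˡ (⋆-sucʳ (tail f) g n) ⟩
    f 0 * g (suc (suc n)) + (f (suc (suc n)) * g 0 + (tail f ⋆ tail g) n)      ≈⟨ solve 3 (λ a b c → a :+ (b :+ c) := b :+ (a :+ c)) refl _ _ _ ⟩
    f (suc (suc n)) * g 0 + (f 0 * g (suc (suc n)) + (tail f ⋆ tail g) n)      ∎

  ⋆-comm : ∀ f g → f ⋆ g ≋ g ⋆ f
  ⋆-comm f g zero    = *-comm _ _
  ⋆-comm f g (suc n) = begin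
    f 0 * g (suc n) + (tail f ⋆ g) n  ≈⟨ +-cong (*-comm _ _) (⋆-comm (tail f) g n) ⟩
    g (suc n) * f 0 + (g ⋆ tail f) n  ≈⟨ ⋆-sucʳ g f n ⟨
    (g ⋆ f) (suc n)                   ∎

  ⋆-identityˡ : ∀ f → constant 1# ⋆ f ≋ f
  ⋆-identityˡ f n = trans (constant-⋆ 1# f n) (*-identityˡ _)

  shift-⋆ : ∀ f g → shift f ⋆ g ≋ shift (f ⋆ g)
  shift-⋆ f g zero    = zeroˡ _
  shift-⋆ f g (suc n) = trans (+-congʳ (zeroˡ _)) (+-identityˡ _)

  commutativeRing′ : CommutativeRing c ℓ
  commutativeRing′ = record
    { Carrier = PS
    ; _≈_ = _≋_
    ; _+_ = _✦_
    ; _*_ = _⋆_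
    ; -_ = λ f n → - f n
    ; 0# = λ _ → 0#
    ; 1# = constant 1#
    ; isCommutativeRing = record
      { isRing = record
        { +-isAbelianGroup = record
          { isGroup = record
            { isMonoid = record
              { isSemigroup = record
                { isMagma = record
                  { isEquivalence = record
                    { refl = λ _ → refl
                    ; sym = λ p n → sym (p n)
                    ; trans = λ p q n → trans (p n) (q n)
                    }
                  ; ∙-cong = λ p q n → +-cong (p n) (q n)
                  }
                ; assoc = λ f g h n → +-assoc _ _ _
                }
              ; identity = (λ f n → +-identityˡ _) , (λ f n → +-identityʳ _)
              }
            ; inverse = (λ f n → -‿inverseˡ _) , (λ f n → -‿inverseʳ _)
            ; ⁻¹-cong = λ p n → -‿cong (p n)
            }
          ; comm = λ f g n → +-comm _ _
          }
        ; *-cong = ⋆-cong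
        ; *-assoc = ⋆-assoc
        ; *-identity = ⋆-identityˡ , (λ f n → trans (⋆-comm f _ n) (⋆-identityˡ f n))
        ; distrib =
            (λ h f g n → trans (⋆-comm h _ n) (trans (⋆-distribʳ h f g n) (+-cong (⋆-comm f h n) (⋆-comm g h n))))
          , ⋆-distribʳ
        }
      ; *-comm = ⋆-comm
      }
    }

-- Boolean comparisons, parity and turns

open ≡ using (refl; cong; cong₂; sym; trans; subst)

T⇒≡ : ∀ {b} → T b → b ≡ true
T⇒≡ {true} _ = refl

≡⇒T : ∀ {b} → b ≡ true → T b
≡⇒T refl = _

¬T⇒≡ : ∀ {b} → ¬ T b → b ≡ false
¬T⇒≡ {true}  ¬t = ⊥-elim (¬t _)
¬T⇒≡ {false} _  = refl

<⇒<ᵇ≡ : ∀ {m n} → m < n → (m <ᵇ n) ≡ true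
<⇒<ᵇ≡ m<n = T⇒≡ (ℕ.<⇒<ᵇ m<n)

≤⇒<ᵇ≡ : ∀ {m n} → n ≤ m → (m <ᵇ n) ≡ false
≤⇒<ᵇ≡ {m} n≤m = ¬T⇒≡ (λ t → ℕ.<⇒≱ (ℕ.<ᵇ⇒< m _ t) n≤m)

<ᵇ≡⇒< : ∀ {m n} → (m <ᵇ n) ≡ true → m < n
<ᵇ≡⇒< {m} eq = ℕ.<ᵇ⇒< m _ (≡⇒T eq)

<ᵇ-flip : ∀ {m n} → m ≢ n → (n <ᵇ m) ≡ not (m <ᵇ n)
<ᵇ-flip {m} {n} m≢n with ℕ.<-cmp m n
... | tri< m<n _ _ = trans (≤⇒<ᵇ≡ (ℕ.<⇒≤ m<n)) (cong not (sym (<⇒<ᵇ≡ m<n)))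
... | tri≈ _ m≡n _ = contradiction m≡n m≢n
... | tri> _ _ n<m = trans (<⇒<ᵇ≡ n<m) (cong not (sym (≤⇒<ᵇ≡ (ℕ.<⇒≤ n<m))))

≡⇒==  : ∀ {m n} → m ≡ n → (m == n) ≡ true
≡⇒== {m} eq = T⇒≡ (ℕ.≡⇒≡ᵇ m _ eq)

==⇒≡ : ∀ {m n} → (m == n) ≡ true → m ≡ n
==⇒≡ {m} eq = ℕ.≡ᵇ⇒≡ m _ (≡⇒T eq)

≢⇒== : ∀ {m n} → m ≢ n → (m == n) ≡ false
≢⇒== {m} m≢n = ¬T⇒≡ (m≢n ∘ ℕ.≡ᵇ⇒≡ m _)

Bool-ext : ∀ {x y} → (x ≡ true → y ≡ true) → (y ≡ true → x ≡ true) → x ≡ y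
Bool-ext {true}  {y}     f g = sym (f refl)
Bool-ext {false} {true}  f g = g refl
Bool-ext {false} {false} f g = refl

∧-split : ∀ {x y} → x ∧ y ≡ true → x ≡ true × y ≡ true
∧-split {true} {true} _ = refl , refl

∧-swap : ∀ x y z → x ∧ (y ∧ z) ≡ y ∧ (x ∧ z)
∧-swap true  y     z = refl
∧-swap false true  z = refl
∧-swap false false z = refl

<ᵇ-==-disjoint : ∀ m n → (m <ᵇ n) ∧ (n == m) ≡ false
<ᵇ-==-disjoint zero    zero    = refl
<ᵇ-==-disjoint zero    (suc n) = refl
<ᵇ-==-disjoint (suc m) zero    = refl
<ᵇ-==-disjoint (suc m) (suc n) = <ᵇ-==-disjoint m n

<ᵇ-==-disjoint′ : ∀ m n → (n <ᵇ m) ∧ (n == m) ≡ false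
<ᵇ-==-disjoint′ zero    zero    = refl
<ᵇ-==-disjoint′ zero    (suc n) = refl
<ᵇ-==-disjoint′ (suc m) zero    = refl
<ᵇ-==-disjoint′ (suc m) (suc n) = <ᵇ-==-disjoint′ m n

≤ᵇ-split : ∀ m n → (m ≤ᵇ n) ≡ (m <ᵇ n) ∨ ((n == m) ∧ true)
≤ᵇ-split zero          zero    = refl
≤ᵇ-split zero          (suc n) = refl
≤ᵇ-split (suc m)       zero    = refl
≤ᵇ-split (suc zero)    (suc n) = ≤ᵇ-split zero n
≤ᵇ-split (suc (suc m)) (suc n) = ≤ᵇ-split (suc m) n

<ᵇ-suc-split : ∀ m n → (n <ᵇ suc m) ≡ (n <ᵇ m) ∨ ((n == m) ∧ true)
<ᵇ-suc-split zero    zero    = refl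
<ᵇ-suc-split zero    (suc n) = refl
<ᵇ-suc-split (suc m) zero    = refl
<ᵇ-suc-split (suc m) (suc n) = <ᵇ-suc-split m n

odd : ℕ → Bool
odd zero    = false
odd (suc n) = not (odd n)

same : Bool → Bool → Bool
same true  e = e
same false e = not e

-- The direction that a step receives under standardization: equal odd letters ascend, equal even
-- letters descend.
superAscent : ℕ → ℕ → Bool
superAscent b c = (b <ᵇ c) ∨ ((c == b) ∧ odd b)

not-superAscent : ∀ o m n → not ((m <ᵇ n) ∨ ((n == m) ∧ o)) ≡ (n <ᵇ m) ∨ ((n == m) ∧ not o)
not-superAscent o zero    zero    = refl
not-superAscent o zero    (suc n) = refl
not-superAscent o (suc m) zero    = refl
not-superAscent o (suc m) (suc n) = not-superAscent o m n

double : ℕ → ℕ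
double zero    = zero
double (suc n) = suc (suc (double n))

double≡2* : ∀ n → double n ≡ 2 ℕ.* n
double≡2* zero    = refl
double≡2* (suc n) = cong suc (trans (cong suc (double≡2* n)) (sym (ℕ.+-suc n (n ℕ.+ 0))))

odd-double : ∀ n → odd (double n) ≡ false
odd-double zero    = refl
odd-double (suc n) = cong (λ b → not (not b)) (odd-double n)

-- The argument `d` acts as the direction of a virtual step in front of the word. With `d` = `true`
-- an initial descent is a turn, which accounts for the extra up-down run π(1).
turns : Bool → List Bool → ℕ
turns d []      = 0
turns d (e ∷ p) = (if same d e then 0 else 1) ℕ.+ turns e p

-- Generating function of the cuttings of a fixed pattern of ascents and descents

module Transfer {c ℓ} (R : CommutativeRing c ℓ) where
  open CommutativeRing R renaming (refl to ≈-refl; sym to ≈-sym; trans to ≈-trans)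
  open import Relation.Binary.Reasoning.Setoid setoid
  open import Algebra.Solver.Ring.NaturalCoefficients.Default commutativeSemiring using (solve; _:+_; _:*_; _:=_; con)
  open import Algebra.Properties.Group +-group using () renaming (∙-cancelˡ to +-cancelˡ)
  open import Algebra.Properties.Semiring.Exp semiring using (_^_)
  open FiniteSums commutativeSemiring using (⟦_⟧)

  -- Division by 1 - z, whose inverse is `i`. Both equations are written without subtraction, so
  -- that identities with natural coefficients and a single cancellation suffice.
  geometric-unique : ∀ {z i x y} → i ≈ 1# + z * i → x ≈ z * x + y → x ≈ i * y
  geometric-unique {z} {i} {x} {y} i-eq x-eq = +-cancelˡ (z * i * x) x (i * y) (begin
    z * i * x + x          ≈⟨ solve 3 (λ z i x → z :* i :* x :+ x := (con 1 :+ z :* i) :* x) ≈-refl z i x ⟩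
    (1# + z * i) * x       ≈⟨ *-congʳ i-eq ⟨
    i * x                  ≈⟨ *-congˡ x-eq ⟩
    i * (z * x + y)        ≈⟨ solve 4 (λ z i x y → i :* (z :* x :+ y) := z :* i :* x :+ i :* y) ≈-refl z i x y ⟩
    z * i * x + i * y      ∎)

  -- `i₁`, `i₂`, `j` and `h` are 1/(1-z), 1/(1-z²), 1/(1+z²) and 1/2, known only through their
  -- equations. `G d p` stands for the series of all cuttings that start in direction `d`, and
  -- `H d p` for that of the cuttings with nonempty first piece, without the factor z of this piece.
  module _
    (z i₁ i₂ j h : Carrier)
    (i₁-eq : i₁ ≈ 1# + z * i₁) (i₂-eq : i₂ ≈ 1# + z * z * i₂)
    (j-eq : (1# + z * z) * j ≈ 1#) (h-eq : h * (1# + 1#) ≈ 1#)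
    (G H : Bool → List Bool → Carrier)
    (G-eq : ∀ d p → G d p ≈ z * G (not d) p + z * H d p)
    (H-[] : ∀ d → H d [] ≈ i₁)
    (H-∷ : ∀ d e p → H d (e ∷ p) ≈ G (not d) p + ⟦ same d e ⟧ * H d p)
    where

    private
      -- Substituting the equation of the opposite direction leaves an equation in `G d p` alone
      -- with multiplier z²: two empty pieces restore the direction.
      G-twice : ∀ d d′ p → G d p ≈ z * G d′ p + z * H d p → G d′ p ≈ z * G d p + z * H d′ p →
                G d p ≈ i₂ * (z * z * H d′ p + z * H d p)
      G-twice d d′ p eq eq′ = geometric-unique i₂-eq (begin
        G d p                                            ≈⟨ eq ⟩
        z * G d′ p + z * H d p                           ≈⟨ +-congʳ (*-congˡ eq′) ⟩
        z * (z * G d p + z * H d′ p) + z * H d p         ≈⟨ solve 4 (λ z g h h′ → z :* (z :* g :+ z :* h′) :+ z :* h := z :* z :* g :+ (z :* z :* h′ :+ z :* h)) ≈-refl z (G d p) (H d p) (H d′ p) ⟩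
        z * z * G d p + (z * z * H d′ p + z * H d p)     ∎)

      G-solved : ∀ d p → G d p ≈ i₂ * (z * z * H (not d) p + z * H d p)
      G-solved true  p = G-twice true false p (G-eq true p) (G-eq false p)
      G-solved false p = G-twice false true p (G-eq false p) (G-eq true p)

      -- Deletion of the first letter: a first piece that follows the step `e` may become empty by
      -- this, so that an arbitrary cutting of the rest remains.
      zH-same : ∀ e p → ⟦ same e e ⟧ ≈ 1# → z * H e (e ∷ p) ≈ G e p
      zH-same e p s = begin
        z * H e (e ∷ p)                               ≈⟨ *-congˡ (H-∷ e e p) ⟩
        z * (G (not e) p + ⟦ same e e ⟧ * H e p)      ≈⟨ *-congˡ (+-congˡ (≈-trans (*-congʳ s) (*-identityˡ _))) ⟩
        z * (G (not e) p + H e p)                     ≈⟨ distribˡ _ _ _ ⟩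
        z * G (not e) p + z * H e p                   ≈⟨ G-eq e p ⟨
        G e p                                         ∎

      -- A nonempty first piece directed against the first step consists of the first letter only.
      -- Without it, a cutting of the rest that starts in direction `e` remains.
      H-diff : ∀ d e p → not d ≡ e → ⟦ same d e ⟧ ≈ 0# → H d (e ∷ p) ≈ G e p
      H-diff d e p refl s = begin
        H d (e ∷ p)                                ≈⟨ H-∷ d e p ⟩
        G (not d) p + ⟦ same d e ⟧ * H d p         ≈⟨ +-congˡ (≈-trans (*-congʳ s) (zeroˡ _)) ⟩
        G (not d) p + 0#                           ≈⟨ +-identityʳ _ ⟩
        G (not d) p                                ∎

      G-straight : ∀ e p → ⟦ same e e ⟧ ≈ 1# → H (not e) (e ∷ p) ≈ G e p →
                   G e (e ∷ p) ≈ i₂ * (z * z * G e p + G e p)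
      G-straight e p s diff = ≈-trans (G-solved e (e ∷ p)) (*-congˡ (+-cong (*-congˡ diff) (zH-same e p s)))

      G-turn : ∀ d e p → not d ≡ e → ⟦ same d e ⟧ ≈ 0# → ⟦ same e e ⟧ ≈ 1# →
               G d (e ∷ p) ≈ i₂ * (z * G e p + z * G e p)
      G-turn d e p refl s s′ = ≈-trans (G-solved d (e ∷ p))
        (*-congˡ (+-cong (≈-trans (*-assoc _ _ _) (*-congˡ (zH-same e p s′))) (*-congˡ (H-diff d e p refl s))))

      -- `v` is the argument 2z/(1+z²) of the polynomial. A straight step has weight `w * i₂`; a
      -- turn has weight 2z · `i₂`, which is the same with an additional factor `v`.
      w v : Carrier
      w = 1# + z * z
      v = (1# + 1#) * z * j

      wv : w * v ≈ (1# + 1#) * z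
      wv = begin
        w * ((1# + 1#) * z * j)    ≈⟨ solve 3 (λ w t j → w :* (t :* j) := w :* j :* t) ≈-refl w _ j ⟩
        w * j * ((1# + 1#) * z)    ≈⟨ *-congʳ j-eq ⟩
        1# * ((1# + 1#) * z)       ≈⟨ *-identityˡ _ ⟩
        (1# + 1#) * z              ∎

      closed : ℕ → ℕ → Carrier
      closed m t = h * i₁ ^ 2 * w ^ suc m * i₂ ^ m * v ^ suc t

      i₁-as-i₂ : i₁ ≈ i₂ * (1# + z)
      i₁-as-i₂ = geometric-unique i₂-eq (begin
        i₁                        ≈⟨ i₁-eq ⟩
        1# + z * i₁               ≈⟨ +-congˡ (*-congˡ i₁-eq) ⟩
        1# + z * (1# + z * i₁)    ≈⟨ solve 2 (λ z i → con 1 :+ z :* (con 1 :+ z :* i) := z :* z :* i :+ (con 1 :+ z)) ≈-refl z i₁ ⟩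
        z * z * i₁ + (1# + z)     ∎)

      -- One letter gives z/(1-z)². Rewriting its z as h · (1+z²) · v brings this into the shape of
      -- `closed`, and is where the factor 1/2 arises.
      single : ∀ d → G d [] ≈ closed 0 0
      single d = begin
        G d []                                            ≈⟨ G-solved d [] ⟩
        i₂ * (z * z * H (not d) [] + z * H d [])          ≈⟨ *-congˡ (+-cong (*-congˡ (H-[] (not d))) (*-congˡ (H-[] d))) ⟩
        i₂ * (z * z * i₁ + z * i₁)                        ≈⟨ solve 3 (λ z i i₂ → i₂ :* (z :* z :* i :+ z :* i) := z :* i :* (i₂ :* (con 1 :+ z))) ≈-refl z i₁ i₂ ⟩
        z * i₁ * (i₂ * (1# + z))                          ≈⟨ *-congˡ i₁-as-i₂ ⟨
        z * i₁ * i₁                                       ≈⟨ *-identityˡ _ ⟨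
        1# * (z * i₁ * i₁)                                ≈⟨ *-congʳ h-eq ⟨
        h * (1# + 1#) * (z * i₁ * i₁)                     ≈⟨ solve 4 (λ z i h t → h :* t :* (z :* i :* i) := h :* (i :* i) :* (t :* z)) ≈-refl z i₁ h (1# + 1#) ⟩
        h * (i₁ * i₁) * ((1# + 1#) * z)                   ≈⟨ *-congˡ wv ⟨
        h * (i₁ * i₁) * (w * v)                           ≈⟨ solve 4 (λ h i w v → h :* (i :* i) :* (w :* v) := h :* (i :* (i :* con 1)) :* (w :* con 1) :* con 1 :* (v :* con 1)) ≈-refl h i₁ w v ⟩
        closed 0 0                                        ∎

      straight : ∀ m t → i₂ * (z * z * closed m t + closed m t) ≈ closed (suc m) t
      straight m t = solve 6
        (λ z i₂ a b c d →
          i₂ :* (z :* z :* (a :* b :* c :* d) :+ a :* b :* c :* d) :=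
          a :* ((con 1 :+ z :* z) :* b) :* (i₂ :* c) :* d)
        ≈-refl z i₂ (h * i₁ ^ 2) (w ^ suc m) (i₂ ^ m) (v ^ suc t)

      turn : ∀ m t → i₂ * (z * closed m t + z * closed m t) ≈ closed (suc m) (suc t)
      turn m t = begin
        i₂ * (z * closed m t + z * closed m t)
          ≈⟨ solve 6
               (λ z i₂ a b c d →
                 i₂ :* (z :* (a :* b :* c :* d) :+ z :* (a :* b :* c :* d)) :=
                 (con 1 :+ con 1) :* z :* (a :* b :* (i₂ :* c) :* d))
               ≈-refl z i₂ A B C D ⟩
        (1# + 1#) * z * (A * B * (i₂ * C) * D)  ≈⟨ *-congʳ wv ⟨
        w * v * (A * B * (i₂ * C) * D)
          ≈⟨ solve 6
               (λ w v a b c d → w :* v :* (a :* b :* c :* d) := a :* (w :* b) :* c :* (v :* d))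
               ≈-refl w v A B (i₂ * C) D ⟩
        closed (suc m) (suc t)                  ∎
        where
        A = h * i₁ ^ 2
        B = w ^ suc m
        C = i₂ ^ m
        D = v ^ suc t

    -- Induction on the steps, for both directions at once: when the first letter is removed, the
    -- direction of its step becomes the starting direction of the rest.
    transfer : ∀ d p → G d p ≈ h * i₁ ^ 2 * (1# + z * z) ^ suc (length p) * i₂ ^ length p * ((1# + 1#) * z * j) ^ suc (turns d p)
    transfer d []      = single d
    transfer d (e ∷ p) = by-direction d e (transfer e p)
      where
      go-straight : ∀ e → G e p ≈ closed (length p) (turns e p) → G e (e ∷ p) ≈ i₂ * (z * z * G e p + G e p) →
                    G e (e ∷ p) ≈ closed (suc (length p)) (turns e p)
      go-straight e ih eq = ≈-trans eq (≈-trans (*-congˡ (+-cong (*-congˡ ih) ih)) (straight (length p) (turns e p)))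

      go-turn : ∀ d e → G e p ≈ closed (length p) (turns e p) → G d (e ∷ p) ≈ i₂ * (z * G e p + z * G e p) →
                G d (e ∷ p) ≈ closed (suc (length p)) (suc (turns e p))
      go-turn d e ih eq = ≈-trans eq (≈-trans (*-congˡ (+-cong (*-congˡ ih) (*-congˡ ih))) (turn (length p) (turns e p)))

      by-direction : ∀ d e → G e p ≈ closed (length p) (turns e p) → G d (e ∷ p) ≈ closed (suc (length p)) (turns d (e ∷ p))
      by-direction true  true  ih = go-straight true ih (G-straight true p ≈-refl (H-diff false true p refl ≈-refl))
      by-direction false false ih = go-straight false ih (G-straight false p ≈-refl (H-diff true false p refl ≈-refl))
      by-direction true  false ih = go-turn true false ih (G-turn true false p refl ≈-refl ≈-refl)
      by-direction false true  ih = go-turn false true ih (G-turn false true p refl ≈-refl ≈-refl)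

-- Product formula over the alphabet and its closed forms

module Alphabet {c ℓ} (R : CommutativeRing c ℓ) where
  open CommutativeRing R renaming (refl to ≈-refl; sym to ≈-sym; trans to ≈-trans)
  open Transfer R using (geometric-unique)
  open FiniteSums commutativeSemiring using (⟦_⟧; ∑; ∑-upTo-cong; ∑-zero; ∑-split)
  open import Relation.Binary.Reasoning.Setoid setoid
  open import Algebra.Solver.Ring.NaturalCoefficients.Default commutativeSemiring using (solve; _:+_; _:*_; _:=_; con)
  open import Algebra.Properties.CommutativeSemiring.Exp commutativeSemiring

  module _ (x i : Carrier) (i-eq : i ≈ 1# + x * i) where

    -- The contribution of one letter to one piece: 1/(1-x) if it may be repeated there, 1 + x if it
    -- occurs at most once.
    κ : Bool → Carrier
    κ true  = i
    κ false = 1# + x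

    Πκ : Bool → ℕ → Carrier
    Πκ d zero    = 1#
    Πκ d (suc m) = κ (same d (odd (suc m))) * Πκ d m

    private
      -- `h` collects the continuations that begin with the new letter and `t` the others. The new
      -- letter is followed by a continuation in `t`, or again by one in `h` if `o` permits
      -- repetition.
      add-letter : ∀ o h t → h ≈ x * (t + ⟦ o ⟧ * h) → t + h ≈ κ o * t
      add-letter true h t eq = begin
        t + h                  ≈⟨ +-congˡ (geometric-unique i-eq (≈-trans eq (solve 3 (λ x t h → x :* (t :+ con 1 :* h) := x :* h :+ x :* t) ≈-refl x t h))) ⟩
        t + i * (x * t)        ≈⟨ solve 3 (λ x i t → t :+ i :* (x :* t) := (con 1 :+ x :* i) :* t) ≈-refl x i t ⟩
        (1# + x * i) * t       ≈⟨ *-congʳ i-eq ⟨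
        i * t                  ∎
      add-letter false h t eq = begin
        t + h                       ≈⟨ +-congˡ eq ⟩
        t + x * (t + 0# * h)        ≈⟨ +-congˡ (*-congˡ (≈-trans (+-congˡ (zeroˡ h)) (+-identityʳ t))) ⟩
        t + x * t                   ≈⟨ solve 2 (λ x t → t :+ x :* t := (con 1 :+ x) :* t) ≈-refl x t ⟩
        (1# + x) * t                ∎

    -- `V` stands for the cuttings with empty first piece and `H c` for those whose first piece
    -- begins with the letter c + 1; `partial A` restricts this letter to `A`.
    module _ (l : ℕ) (V : Carrier) (H : ℕ → Carrier) where
      private
        partial : (ℕ → Bool) → Carrier
        partial A = V + ∑ (upTo l) (λ c → ⟦ A c ⟧ * H c)

        partial-none : ∀ A → (∀ c → c < l → A c ≡ false) → partial A ≈ V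
        partial-none A none = ≈-trans (+-congˡ (≈-trans (∑-upTo-cong l zero-term) (∑-zero (upTo l)))) (+-identityʳ V)
          where
          zero-term : ∀ c → c < l → ⟦ A c ⟧ * H c ≈ 0#
          zero-term c c<l rewrite none c c<l = zeroˡ (H c)

        partial-all : ∀ A → (∀ c → c < l → A c ≡ true) → partial A ≈ V + ∑ (upTo l) H
        partial-all A all = +-congˡ (∑-upTo-cong l one-term)
          where
          one-term : ∀ c → c < l → ⟦ A c ⟧ * H c ≈ H c
          one-term c c<l rewrite all c c<l = *-identityˡ (H c)

        -- `A` consists of the letters strictly beyond m + 1 in the direction of the piece, `B` adds
        -- the letter m + 1 itself, and `C` consists of the letters that may follow it.
        extend : ∀ {m} o (A B C : ℕ → Bool) → m < l → (∀ c → A c ∧ (c == m) ≡ false) →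
                 (∀ c → B c ≡ A c ∨ ((c == m) ∧ true)) → (∀ c → C c ≡ A c ∨ ((c == m) ∧ o)) →
                 H m ≈ x * partial C → partial B ≈ κ o * partial A
        extend {m} o A B C m<l disjoint B≡ C≡ H-eq = begin
          partial B                                                        ≈⟨ +-congˡ (∑-split true A (_== m) B H m<l (λ _ → refl) disjoint B≡) ⟩
          V + (∑ (upTo l) (λ c → ⟦ A c ⟧ * H c) + 1# * H m)                ≈⟨ solve 3 (λ v s h → v :+ (s :+ con 1 :* h) := v :+ s :+ h) ≈-refl V (∑ (upTo l) (λ c → ⟦ A c ⟧ * H c)) (H m) ⟩
          partial A + H m                                                  ≈⟨ add-letter o (H m) (partial A) (≈-trans H-eq (*-congˡ expand)) ⟩
          κ o * partial A                                                  ∎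
          where
          expand : partial C ≈ partial A + ⟦ o ⟧ * H m
          expand = ≈-trans (+-congˡ (∑-split o A (_== m) C H m<l (λ _ → refl) disjoint C≡)) (≈-sym (+-assoc V (∑ (upTo l) (λ c → ⟦ A c ⟧ * H c)) (⟦ o ⟧ * H m)))

      -- Each letter splits off its factor `κ` in turn. For an increasing piece the lower bound on
      -- its first letter moves up until no letter is left; for a decreasing one the upper bound is
      -- lowered to zero.
      alphabet-product : ∀ d →
        (∀ c → H c ≈ x * (V + ∑ (upTo l) (λ c′ → ⟦ same d (superAscent (suc c) (suc c′)) ⟧ * H c′))) →
        V + ∑ (upTo l) H ≈ Πκ d l * V
      alphabet-product true H-eq = begin
        V + ∑ (upTo l) H           ≈⟨ partial-all (0 ≤ᵇ_) (λ _ _ → refl) ⟨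
        partial (0 ≤ᵇ_)            ≈⟨ up l ℕ.≤-refl ⟩
        Πκ true l * partial (l ≤ᵇ_) ≈⟨ *-congˡ (partial-none (l ≤ᵇ_) (λ c c<l → ¬T⇒≡ (λ t → ℕ.<⇒≱ c<l (ℕ.≤ᵇ⇒≤ l c t)))) ⟩
        Πκ true l * V              ∎
        where
        up : ∀ m → m ≤ l → partial (0 ≤ᵇ_) ≈ Πκ true m * partial (m ≤ᵇ_)
        up zero    m≤l = ≈-sym (*-identityˡ _)
        up (suc m) m<l = begin
          partial (0 ≤ᵇ_)                                             ≈⟨ up m (ℕ.<⇒≤ m<l) ⟩
          Πκ true m * partial (m ≤ᵇ_)                                 ≈⟨ *-congˡ (extend (odd (suc m)) (m <ᵇ_) (m ≤ᵇ_) _ m<l (<ᵇ-==-disjoint m) (≤ᵇ-split m) (λ _ → refl) (H-eq m)) ⟩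
          Πκ true m * (κ (odd (suc m)) * partial (m <ᵇ_))             ≈⟨ solve 3 (λ a b c → a :* (b :* c) := b :* a :* c) ≈-refl (Πκ true m) (κ (odd (suc m))) (partial (m <ᵇ_)) ⟩
          Πκ true (suc m) * partial (m <ᵇ_)                           ∎
      alphabet-product false H-eq = begin
        V + ∑ (upTo l) H           ≈⟨ partial-all (_<ᵇ l) (λ c → <⇒<ᵇ≡) ⟨
        partial (_<ᵇ l)            ≈⟨ down l ℕ.≤-refl ⟩
        Πκ false l * V             ∎
        where
        down : ∀ m → m ≤ l → partial (_<ᵇ m) ≈ Πκ false m * V
        down zero    m≤l = ≈-trans (partial-none (_<ᵇ 0) (λ _ _ → refl)) (≈-sym (*-identityˡ V))
        down (suc m) m<l = begin
          partial (_<ᵇ suc m)                               ≈⟨ extend (not (odd (suc m))) (_<ᵇ m) (_<ᵇ suc m) _ m<l (<ᵇ-==-disjoint′ m) (<ᵇ-suc-split m) (not-superAscent (odd (suc m)) m) (H-eq m) ⟩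
          κ (not (odd (suc m))) * partial (_<ᵇ m)           ≈⟨ *-congˡ (down m (ℕ.<⇒≤ m<l)) ⟩
          κ (not (odd (suc m))) * (Πκ false m * V)          ≈⟨ *-assoc _ _ _ ⟨
          Πκ false (suc m) * V                              ∎

    private
      r : Carrier
      r = (1# + x) * i

      Πκ-even : ∀ d j → Πκ d (double j) ≈ r ^ j
      Πκ-even d     zero    = ≈-refl
      Πκ-even true  (suc j) rewrite odd-double j = ≈-trans (*-congˡ (*-congˡ (Πκ-even true j))) (≈-sym (*-assoc _ _ _))
      Πκ-even false (suc j) rewrite odd-double j = ≈-trans (*-congˡ (*-congˡ (Πκ-even false j))) (≈-trans (≈-sym (*-assoc _ _ _)) (*-congʳ (*-comm i (1# + x))))

      Πκ-odd-true : ∀ j → Πκ true (suc (double j)) ≈ i * r ^ j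
      Πκ-odd-true j rewrite odd-double j = *-congˡ (Πκ-even true j)

      Πκ-odd-false : ∀ j → Πκ false (suc (double j)) ≈ (1# + x) * r ^ j
      Πκ-odd-false j rewrite odd-double j = *-congˡ (Πκ-even false j)

      r-power : ∀ j k → (r ^ j * r ^ j) ^ k ≈ r ^ (2 ℕ.* k ℕ.* j)
      r-power j k = begin
        (r ^ j * r ^ j) ^ k          ≈⟨ ^-congˡ k (^-homo-* r j j) ⟨
        (r ^ (j ℕ.+ j)) ^ k          ≈⟨ ^-assocʳ r (j ℕ.+ j) k ⟩
        r ^ ((j ℕ.+ j) ℕ.* k)        ≈⟨ ^-congʳ r (ℕsolve 2 (λ j k → (j ⊹ j) ⊠ k ⊜ con′ 2 ⊠ k ⊠ j) refl j k) ⟩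
        r ^ (2 ℕ.* k ℕ.* j)          ∎
        where
        open +-*-Solver using () renaming (solve to ℕsolve; _:+_ to _⊹_; _:*_ to _⊠_; _:=_ to _⊜_; con to con′)

    -- Pieces are taken in pairs, one of each direction. Over 2j letters every piece contributes
    -- r^j; over 2j + 1 letters an increasing piece has an extra `i` and a decreasing one an extra 1
    -- + x, so that a pair gains a factor r.
    module _ (l : ℕ) (V : ℕ → Bool → Carrier) (V-zero : ∀ d → V 0 d ≈ 1#)
             (V-suc : ∀ k d → V (suc k) d ≈ Πκ d l * V k (not d)) where
      private
        V-even : ∀ a b k d → Πκ d l ≈ a → Πκ (not d) l ≈ b → not (not d) ≡ d → V (double k) d ≈ (a * b) ^ k
        V-even a b zero    d p p′ nn = V-zero d
        V-even a b (suc k) d p p′ nn = begin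
          V (suc (suc (double k))) d                            ≈⟨ V-suc (suc (double k)) d ⟩
          Πκ d l * V (suc (double k)) (not d)                   ≈⟨ *-congˡ (V-suc (double k) (not d)) ⟩
          Πκ d l * (Πκ (not d) l * V (double k) (not (not d)))  ≡⟨ cong (λ e → Πκ d l * (Πκ (not d) l * V (double k) e)) nn ⟩
          Πκ d l * (Πκ (not d) l * V (double k) d)              ≈⟨ *-cong p (*-cong p′ (V-even a b k d p p′ nn)) ⟩
          a * (b * (a * b) ^ k)                                 ≈⟨ *-assoc _ _ _ ⟨
          (a * b) ^ suc k                                       ∎

        V-odd : ∀ a b k → Πκ true l ≈ a → Πκ false l ≈ b → V (suc (double k)) true ≈ a * (b * a) ^ k
        V-odd a b k p p′ = ≈-trans (V-suc (double k) true) (*-cong p (V-even b a k false p′ p refl))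

      closed-even-even : ∀ j k → l ≡ double j → V (double k) true ≈ r ^ (2 ℕ.* k ℕ.* j)
      closed-even-even j k refl = ≈-trans (V-even _ _ k true (Πκ-even true j) (Πκ-even false j) refl) (r-power j k)

      closed-odd-even : ∀ j k → l ≡ double j → V (suc (double k)) true ≈ r ^ (2 ℕ.* k ℕ.* j) * r ^ j
      closed-odd-even j k refl = ≈-trans (V-odd _ _ k (Πκ-even true j) (Πκ-even false j)) (≈-trans (*-congˡ (r-power j k)) (*-comm _ _))

      private
        mixed : ∀ j k → (i * r ^ j * ((1# + x) * r ^ j)) ^ k ≈ r ^ (2 ℕ.* k ℕ.* j) * r ^ k
        mixed j k = begin
          (i * r ^ j * ((1# + x) * r ^ j)) ^ k     ≈⟨ ^-congˡ k (solve 3 (λ i y p → i :* p :* (y :* p) := p :* p :* (y :* i)) ≈-refl i (1# + x) (r ^ j)) ⟩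
          (r ^ j * r ^ j * r) ^ k                  ≈⟨ ^-distrib-* (r ^ j * r ^ j) r k ⟩
          (r ^ j * r ^ j) ^ k * r ^ k              ≈⟨ *-congʳ (r-power j k) ⟩
          r ^ (2 ℕ.* k ℕ.* j) * r ^ k              ∎

      closed-even-odd : ∀ j k → l ≡ suc (double j) → V (double k) true ≈ r ^ (2 ℕ.* k ℕ.* j) * r ^ k
      closed-even-odd j k refl = ≈-trans (V-even _ _ k true (Πκ-odd-true j) (Πκ-odd-false j) refl) (mixed j k)

      -- The unpaired increasing piece contributes `i` · r^j. Its extra `i` is the reason why the
      -- exponents of 1 + x and 1/(1-x) differ by one in this case only.
      closed-odd-odd : ∀ j k → l ≡ suc (double j) →
        V (suc (double k)) true ≈ r ^ (2 ℕ.* k ℕ.* j) * ((1# + x) ^ (k ℕ.+ j) * i ^ (k ℕ.+ j ℕ.+ 1))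
      closed-odd-odd j k refl = begin
        V (suc (double k)) true                                        ≈⟨ V-odd _ _ k (Πκ-odd-true j) (Πκ-odd-false j) ⟩
        i * r ^ j * ((1# + x) * r ^ j * (i * r ^ j)) ^ k               ≈⟨ *-congˡ (^-congˡ k (*-comm _ _)) ⟩
        i * r ^ j * (i * r ^ j * ((1# + x) * r ^ j)) ^ k               ≈⟨ *-congˡ (mixed j k) ⟩
        i * r ^ j * (r ^ (2 ℕ.* k ℕ.* j) * r ^ k)                      ≈⟨ solve 4 (λ i p r s → i :* p :* (r :* s) := r :* ((s :* p) :* i)) ≈-refl i (r ^ j) (r ^ (2 ℕ.* k ℕ.* j)) (r ^ k) ⟩
        r ^ (2 ℕ.* k ℕ.* j) * ((r ^ k * r ^ j) * i)                    ≈⟨ *-congˡ (*-congʳ (≈-trans (≈-sym (^-homo-* r k j)) (^-distrib-* (1# + x) i (k ℕ.+ j)))) ⟩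
        r ^ (2 ℕ.* k ℕ.* j) * ((1# + x) ^ (k ℕ.+ j) * i ^ (k ℕ.+ j) * i)   ≈⟨ *-congˡ (≈-trans (*-assoc _ _ _) (*-congˡ (≈-sym (≈-trans (^-homo-* i (k ℕ.+ j) 1) (*-congˡ (*-identityʳ i)))))) ⟩
        r ^ (2 ℕ.* k ℕ.* j) * ((1# + x) ^ (k ℕ.+ j) * i ^ (k ℕ.+ j ℕ.+ 1)) ∎

-- Rearrangement of the summands on both sides

module _ {c ℓ} (R : CommutativeRing c ℓ) where
  open CommutativeRing R renaming (refl to ≈-refl; sym to ≈-sym; trans to ≈-trans)
  open import Algebra.Solver.Ring.NaturalCoefficients.Default commutativeSemiring using (solve; _:+_; _:*_; _:=_; con)

  -- The summand becomes four monomials in s and t, each times a series in x, one for each pair of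
  -- parities of the exponents.
  regroup : ∀ s t Q qⁱ qʲ Y I S T {A B C D} →
    A ≈ Q → B ≈ Q * qʲ → C ≈ Q * qⁱ → D ≈ Q * (Y * I) →
    Q * (1# + s * qʲ + t * qⁱ + s * t * Y * I) * S * T ≈
    S * (T * A) + (s * S) * (T * B) + S * ((t * T) * C) + (s * S) * ((t * T) * D)
  regroup s t Q qⁱ qʲ Y I S T A≈ B≈ C≈ D≈ = ≈-trans
    (solve 9 (λ s t Q qⁱ qʲ Y I S T →
        Q :* (con 1 :+ s :* qʲ :+ t :* qⁱ :+ s :* t :* Y :* I) :* S :* T :=
        S :* (T :* Q) :+ (s :* S) :* (T :* (Q :* qʲ)) :+ S :* ((t :* T) :* (Q :* qⁱ)) :+ (s :* S) :* ((t :* T) :* (Q :* (Y :* I))))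
      ≈-refl s t Q qⁱ qʲ Y I S T)
    (≈-sym (+-cong (+-cong (+-cong (*-congˡ (*-congˡ A≈)) (*-congˡ (*-congˡ B≈))) (*-congˡ (*-congˡ C≈))) (*-congˡ (*-congˡ D≈))))

  pull-out : ∀ k a b c d p x → k * (a * b * c * d * p * x) ≈ x * (k * a * b * c * d * p)
  pull-out = solve 7 (λ k a b c d p x → k :* (a :* b :* c :* d :* p :* x) := x :* (k :* a :* b :* c :* d :* p)) ≈-refl

  separate : ∀ h i j a b c d u v {k} → k ≈ h * h →
             k * i * j * a * b * c * d * (u * v) ≈ (h * i * a * c * u) * (h * j * b * d * v)
  separate h i j a b c d u v k≈ = ≈-trans
    (*-congʳ (*-congʳ (*-congʳ (*-congʳ (*-congʳ (*-congʳ (*-congʳ k≈)))))))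
    (solve 9 (λ h i j a b c d u v → h :* h :* i :* j :* a :* b :* c :* d :* (u :* v) := (h :* i :* a :* c :* u) :* (h :* j :* b :* d :* v)) ≈-refl h i j a b c d u v)

-- The ring of power series in s, t and x

ℚ-ring : CommutativeRing _ _
ℚ-ring = ℚ.+-*-commutativeRing

module ℚ∑ = FiniteSums (CommutativeRing.commutativeSemiring ℚ-ring)
module ℕ∑ = FiniteSums ℕ.+-*-commutativeSemiring

sumTo-suc : ∀ n f → sumTo (suc n) f ≡ f 0 ℚ.+ sumTo n (λ i → f (suc i))
sumTo-suc zero    f = refl
sumTo-suc (suc n) f = trans (cong (ℚ._+ f (suc (suc n))) (sumTo-suc n f)) (ℚ.+-assoc (f 0) _ _)

-- The evaluation map `ev` reads off a coefficient, so that iterated power series can be handled one variable at a time.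
module _ {c ℓ} (R : CommutativeRing c ℓ) where
  open CommutativeRing R using (Carrier; _+_; _*_)
  open PowerSeries R

  ⋆-sumTo : (ev : Carrier → ℚ) → (∀ x y → ev (x + y) ≡ ev x ℚ.+ ev y) →
            ∀ f g n → ev ((f ⋆ g) n) ≡ sumTo n (λ i → ev (f i * g (n ∸ i)))
  ⋆-sumTo ev ev-+ f g zero    = refl
  ⋆-sumTo ev ev-+ f g (suc n) =
    trans (ev-+ _ _) (trans (cong (ev (f 0 * g (suc n)) ℚ.+_) (⋆-sumTo ev ev-+ (tail f) g n)) (sym (sumTo-suc n _)))

private
  module PS₁ = PowerSeries ℚ-ring
  module PS₂ = PowerSeries PS₁.commutativeRing′
  module PS₃ = PowerSeries PS₂.commutativeRing′
  module 𝕊₃ = CommutativeRing PS₃.commutativeRing′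

sumTo-cong : ∀ n {f g} → (∀ i → i ≤ n → f i ≡ g i) → sumTo n f ≡ sumTo n g
sumTo-cong zero    p = p 0 z≤n
sumTo-cong (suc n) p = cong₂ ℚ._+_ (sumTo-cong n (λ i i≤n → p i (ℕ.m≤n⇒m≤1+n i≤n))) (p (suc n) ℕ.≤-refl)

sumTo-zero : ∀ n {f} → (∀ i → i ≤ n → f i ≡ 0ℚ) → sumTo n f ≡ 0ℚ
sumTo-zero zero    p = p 0 z≤n
sumTo-zero (suc n) p = trans (cong₂ ℚ._+_ (sumTo-zero n (λ i i≤n → p i (ℕ.m≤n⇒m≤1+n i≤n))) (p (suc n) ℕ.≤-refl)) (ℚ.+-identityˡ 0ℚ)

sumTo-extend : ∀ {n N f} → n ≤ N → (∀ k → n < k → f k ≡ 0ℚ) → sumTo n f ≡ sumTo N f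
sumTo-extend {n} {zero}  z≤n vanish = refl
sumTo-extend {n} {suc N} {f} n≤N vanish with ℕ.m≤n⇒m<n∨m≡n n≤N
... | inj₂ refl      = refl
... | inj₁ (s≤s n≤N′) =
  trans (sumTo-extend n≤N′ vanish)
        (trans (sym (ℚ.+-identityʳ _)) (cong (sumTo N f ℚ.+_) (sym (vanish (suc N) (s≤s n≤N′)))))

sumTo-∑ : ∀ n f → sumTo n f ≡ ℚ∑.∑ (upTo (suc n)) f
sumTo-∑ zero    f = sym (ℚ.+-identityʳ _)
sumTo-∑ (suc n) f = trans (cong (ℚ._+ f (suc n)) (sumTo-∑ n f)) (sym (ℚ∑.∑-upTo-last (suc n) f))

infix 4 _≈ˢ_
_≈ˢ_ : Series → Series → Set
f ≈ˢ g = ∀ a b c → f a b c ≡ g a b c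

⊗-local : ∀ f {g h} a b c →
          (∀ a′ b′ c′ → a′ ≤ a → b′ ≤ b → c′ ≤ c → g a′ b′ c′ ≡ h a′ b′ c′) →
          (f ⊗ g) a b c ≡ (f ⊗ h) a b c
⊗-local f a b c p =
  sumTo-cong a λ i _ → sumTo-cong b λ j _ → sumTo-cong c λ k _ →
    cong (f i j k ℚ.*_) (p _ _ _ (ℕ.m∸n≤m a i) (ℕ.m∸n≤m b j) (ℕ.m∸n≤m c k))

⊗-cong : ∀ {f f′ g g′} → f ≈ˢ f′ → g ≈ˢ g′ → f ⊗ g ≈ˢ f′ ⊗ g′
⊗-cong p q a b c =
  sumTo-cong a λ i _ → sumTo-cong b λ j _ → sumTo-cong c λ k _ → cong₂ ℚ._*_ (p i j k) (q _ _ _)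

-- A `Series` is an iterated power series with s outermost and x innermost, so the ring laws can be
-- inherited. Besides the product only `const` has to be identified pointwise.
⊗≈⋆ : ∀ f g → f ⊗ g ≈ˢ f PS₃.⋆ g
⊗≈⋆ f g a b c = sym (trans (⋆-sumTo _ (λ h → h b c) (λ _ _ → refl) f g a)
  (sumTo-cong a λ i _ → trans (⋆-sumTo _ (λ h → h c) (λ _ _ → refl) (f i) (g (a ∸ i)) b)
    (sumTo-cong b λ j _ → ⋆-sumTo _ (λ h → h) (λ _ _ → refl) (f i j) (g (a ∸ i) (b ∸ j)) c)))

const≈ : ∀ q → const q ≈ˢ PS₃.constant (PS₂.constant (PS₁.constant q))
const≈ q zero    zero    zero    = refl
const≈ q zero    zero    (suc c) = refl
const≈ q zero    (suc b) c       = refl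
const≈ q (suc a) b       c       = refl

const0 : const 0ℚ ≈ˢ λ _ _ _ → 0ℚ
const0 zero    zero    zero    = refl
const0 zero    zero    (suc c) = refl
const0 zero    (suc b) c       = refl
const0 (suc a) b       c       = refl

private
  via : ∀ {f g f′ g′} → f ≈ˢ f′ → g ≈ˢ g′ → f ⊗ g ≈ˢ f′ PS₃.⋆ g′
  via p q = 𝕊₃.trans (⊗≈⋆ _ _) (𝕊₃.*-cong p q)

  ⊗-comm : ∀ f g → f ⊗ g ≈ˢ g ⊗ f
  ⊗-comm f g = 𝕊₃.trans (⊗≈⋆ f g) (𝕊₃.trans (𝕊₃.*-comm f g) (𝕊₃.sym (⊗≈⋆ g f)))

  ⊗-identityˡ : ∀ f → one ⊗ f ≈ˢ f
  ⊗-identityˡ f = 𝕊₃.trans (via {g = f} (const≈ 1ℚ) 𝕊₃.refl) (𝕊₃.*-identityˡ f)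

  ⊗-distribʳ : ∀ h f g → (f ⊕ g) ⊗ h ≈ˢ (f ⊗ h) ⊕ (g ⊗ h)
  ⊗-distribʳ h f g = 𝕊₃.trans (⊗≈⋆ (f ⊕ g) h) (𝕊₃.trans (𝕊₃.distribʳ h f g) (𝕊₃.sym (𝕊₃.+-cong (⊗≈⋆ f h) (⊗≈⋆ g h))))

𝕊 : CommutativeRing 0ℓ 0ℓ
𝕊 = record
  { Carrier = Series
  ; _≈_ = _≈ˢ_
  ; _+_ = _⊕_
  ; _*_ = _⊗_
  ; -_ = ⊖_
  ; 0# = const 0ℚ
  ; 1# = one
  ; isCommutativeRing = record
    { isRing = record
      { +-isAbelianGroup = record
        { isGroup = record
          { isMonoid = record
            { isSemigroup = 𝕊₃.+-isSemigroup
            ; identity = (λ f a b c → trans (cong (ℚ._+ f a b c) (const0 a b c)) (ℚ.+-identityˡ _))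
                       , (λ f a b c → trans (cong (f a b c ℚ.+_) (const0 a b c)) (ℚ.+-identityʳ _))
            }
          ; inverse = (λ f a b c → trans (ℚ.+-inverseˡ (f a b c)) (sym (const0 a b c)))
                    , (λ f a b c → trans (ℚ.+-inverseʳ (f a b c)) (sym (const0 a b c)))
          ; ⁻¹-cong = λ p a b c → cong ℚ.-_ (p a b c)
          }
        ; comm = 𝕊₃.+-comm
        }
      ; *-cong = ⊗-cong
      ; *-assoc = λ f g h → 𝕊₃.trans (via {g = h} (⊗≈⋆ f g) 𝕊₃.refl)
          (𝕊₃.trans (𝕊₃.*-assoc f g h) (𝕊₃.sym (via {f = f} 𝕊₃.refl (⊗≈⋆ g h))))
      ; *-identity = ⊗-identityˡ , (λ f → 𝕊₃.trans (⊗-comm f one) (⊗-identityˡ f))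
      ; distrib = (λ h f g → 𝕊₃.trans (⊗-comm h (f ⊕ g))
                     (𝕊₃.trans (⊗-distribʳ h f g) (𝕊₃.+-cong (⊗-comm f h) (⊗-comm g h))))
                , ⊗-distribʳ
      }
    ; *-comm = ⊗-comm
    }
  }

module 𝕊 = CommutativeRing 𝕊
module 𝕊∑ = FiniteSums 𝕊.commutativeSemiring

∑-coeff : ∀ {A : Set} (xs : List A) (F : A → Series) a b c →
          𝕊∑.∑ xs F a b c ≡ ℚ∑.∑ xs (λ x → F x a b c)
∑-coeff []       F a b c = const0 a b c
∑-coeff (x ∷ xs) F a b c = cong (F x a b c ℚ.+_) (∑-coeff xs F a b c)

⊗-sumTo : ∀ f n (F : ℕ → Series) →
          f ⊗ (λ a b c → sumTo n (λ k → F k a b c)) ≈ˢ λ a b c → sumTo n (λ k → (f ⊗ F k) a b c)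
⊗-sumTo f n F = 𝕊.trans (𝕊.*-congˡ {f} (fold F)) (𝕊.trans (𝕊∑.*-∑ (upTo (suc n)) f F) (𝕊.sym (fold _)))
  where
  fold : ∀ (F : ℕ → Series) → (λ a b c → sumTo n (λ k → F k a b c)) ≈ˢ 𝕊∑.∑ (upTo (suc n)) F
  fold F a b c = trans (sumTo-∑ n _) (sym (∑-coeff (upTo (suc n)) F a b c))

-- Multiplication by a variable, series in one variable and geometric series

shiftˢ shiftᵗ shiftˣ : Series → Series
shiftˢ f zero    b c = 0ℚ
shiftˢ f (suc a) b c = f a b c
shiftᵗ f a zero    c = 0ℚ
shiftᵗ f a (suc b) c = f a b c
shiftˣ f a b zero    = 0ℚ
shiftˣ f a b (suc c) = f a b c

sV-⊗ : ∀ f → sV ⊗ f ≈ˢ shiftˢ f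
sV-⊗ f a b c = trans (via {g = f} sV≈ 𝕊₃.refl a b c) (trans (PS₃.shift-⋆ _ f a b c) (unshift a))
  where
  sV≈ : sV ≈ˢ PS₃.shift 𝕊₃.1#
  sV≈ zero          b       c       = refl
  sV≈ (suc zero)    zero    zero    = refl
  sV≈ (suc zero)    zero    (suc c) = refl
  sV≈ (suc zero)    (suc b) c       = refl
  sV≈ (suc (suc a)) b       c       = refl

  unshift : ∀ a → PS₃.shift (𝕊₃.1# PS₃.⋆ f) a b c ≡ shiftˢ f a b c
  unshift zero    = refl
  unshift (suc a) = 𝕊₃.*-identityˡ f a b c

tV-⊗ : ∀ f → tV ⊗ f ≈ˢ shiftᵗ f
tV-⊗ f a b c = trans (via {g = f} tV≈ 𝕊₃.refl a b c)
  (trans (PS₃.constant-⋆ _ f a b c) (trans (PS₂.shift-⋆ _ (f a) b c) (unshift b)))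
  where
  tV≈ : tV ≈ˢ PS₃.constant (PS₂.shift (PS₂.constant (PS₁.constant 1ℚ)))
  tV≈ zero    zero          c       = refl
  tV≈ zero    (suc zero)    zero    = refl
  tV≈ zero    (suc zero)    (suc c) = refl
  tV≈ zero    (suc (suc b)) c       = refl
  tV≈ (suc a) b             c       = refl

  unshift : ∀ b → PS₂.shift (PS₂.constant (PS₁.constant 1ℚ) PS₂.⋆ f a) b c ≡ shiftᵗ f a b c
  unshift zero    = refl
  unshift (suc b) = PS₂.⋆-identityˡ (f a) b c

xV-⊗ : ∀ f → xV ⊗ f ≈ˢ shiftˣ f
xV-⊗ f a b c = trans (via {g = f} xV≈ 𝕊₃.refl a b c)
  (trans (PS₃.constant-⋆ _ f a b c) (trans (PS₂.constant-⋆ _ (f a) b c) (trans (PS₁.shift-⋆ _ (f a b) c) (unshift c))))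
  where
  xV≈ : xV ≈ˢ PS₃.constant (PS₂.constant (PS₁.shift (PS₁.constant 1ℚ)))
  xV≈ zero    zero    zero          = refl
  xV≈ zero    zero    (suc zero)    = refl
  xV≈ zero    zero    (suc (suc c)) = refl
  xV≈ zero    (suc b) c             = refl
  xV≈ (suc a) b       c             = refl

  unshift : ∀ c → PS₁.shift (PS₁.constant 1ℚ PS₁.⋆ f a b) c ≡ shiftˣ f a b c
  unshift zero    = refl
  unshift (suc c) = PS₁.⋆-identityˡ (f a b) c

inˢ inᵗ inˣ : (ℕ → ℚ) → Series
inˢ φ a b c = ℚ∑.⟦ (b == 0) ∧ (c == 0) ⟧ ℚ.* φ a
inᵗ φ a b c = ℚ∑.⟦ (a == 0) ∧ (c == 0) ⟧ ℚ.* φ b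
inˣ φ a b c = ℚ∑.⟦ (a == 0) ∧ (b == 0) ⟧ ℚ.* φ c

-- Each factor is constant in the variable of the other, so at most one term of the convolution is
-- nonzero.
inˢ-⊗-inᵗ : ∀ φ ψ a b c → (inˢ φ ⊗ inᵗ ψ) a b c ≡ ℚ∑.⟦ c == 0 ⟧ ℚ.* (φ a ℚ.* ψ b)
inˢ-⊗-inᵗ φ ψ a b c = begin
  (inˢ φ ⊗ inᵗ ψ) a b c                                   ≡⟨ via inˢ≈ inᵗ≈ a b c ⟩
  (Φ PS₃.⋆ PS₃.constant Ψ) a b c                          ≡⟨ PS₃.⋆-comm Φ (PS₃.constant Ψ) a b c ⟩
  (PS₃.constant Ψ PS₃.⋆ Φ) a b c                          ≡⟨ PS₃.constant-⋆ Ψ Φ a b c ⟩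
  (Ψ PS₂.⋆ Φ a) b c                                       ≡⟨ PS₂.⋆-comm Ψ (Φ a) b c ⟩
  (Φ a PS₂.⋆ Ψ) b c                                       ≡⟨ PS₂.constant-⋆ (PS₁.constant (φ a)) Ψ b c ⟩
  (PS₁.constant (φ a) PS₁.⋆ PS₁.constant (ψ b)) c         ≡⟨ PS₁.constant-⋆ (φ a) (PS₁.constant (ψ b)) c ⟩
  φ a ℚ.* PS₁.constant (ψ b) c                            ≡⟨ last c ⟩
  ℚ∑.⟦ c == 0 ⟧ ℚ.* (φ a ℚ.* ψ b)                         ∎
  where
  open ≡.≡-Reasoning
  Φ = λ i → PS₂.constant (PS₁.constant (φ i))
  Ψ = λ j → PS₁.constant (ψ j)

  inˢ≈ : inˢ φ ≈ˢ Φ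
  inˢ≈ a zero    zero    = ℚ.*-identityˡ (φ a)
  inˢ≈ a zero    (suc c) = ℚ.*-zeroˡ (φ a)
  inˢ≈ a (suc b) c       = ℚ.*-zeroˡ (φ a)

  inᵗ≈ : inᵗ ψ ≈ˢ PS₃.constant Ψ
  inᵗ≈ zero    b zero    = ℚ.*-identityˡ (ψ b)
  inᵗ≈ zero    b (suc c) = ℚ.*-zeroˡ (ψ b)
  inᵗ≈ (suc a) b c       = ℚ.*-zeroˡ (ψ b)

  last : ∀ c → φ a ℚ.* PS₁.constant (ψ b) c ≡ ℚ∑.⟦ c == 0 ⟧ ℚ.* (φ a ℚ.* ψ b)
  last zero    = sym (ℚ.*-identityˡ _)
  last (suc c) = trans (ℚ.*-zeroʳ (φ a)) (sym (ℚ.*-zeroˡ (φ a ℚ.* ψ b)))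

-- Without a constant term, each factor `u` raises the total degree by at least one.
^^-vanishes : ∀ u → u 0 0 0 ≡ 0ℚ → ∀ k a b c → a ℕ.+ b ℕ.+ c < k → (u ^^ k) a b c ≡ 0ℚ
^^-vanishes u u₀ (suc k) a b c (s≤s lt) =
  sumTo-zero a λ i i≤a → sumTo-zero b λ j j≤b → sumTo-zero c λ l l≤c → term i j l i≤a j≤b l≤c
  where
  smaller : ∀ {m i} → i < m → m ∸ suc i < m
  smaller {suc m} {i} _ = s≤s (ℕ.m∸n≤m m i)

  rest : ∀ a′ b′ c′ → a′ ℕ.+ b′ ℕ.+ c′ < a ℕ.+ b ℕ.+ c → ∀ q → q ℚ.* (u ^^ k) a′ b′ c′ ≡ 0ℚ
  rest a′ b′ c′ p q = trans (cong (q ℚ.*_) (^^-vanishes u u₀ k a′ b′ c′ (ℕ.<-≤-trans p lt))) (ℚ.*-zeroʳ q)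

  term : ∀ i j l → i ≤ a → j ≤ b → l ≤ c → u i j l ℚ.* (u ^^ k) (a ∸ i) (b ∸ j) (c ∸ l) ≡ 0ℚ
  term zero    zero    zero    _   _   _   = trans (cong (ℚ._* (u ^^ k) a b c) u₀) (ℚ.*-zeroˡ ((u ^^ k) a b c))
  term zero    zero    (suc l) _   _   l≤c = rest a b (c ∸ suc l) (ℕ.+-monoʳ-< (a ℕ.+ b) (smaller l≤c)) (u 0 0 (suc l))
  term zero    (suc j) l       _   j≤b _   = rest a (b ∸ suc j) (c ∸ l) (ℕ.+-mono-<-≤ (ℕ.+-monoʳ-< a (smaller j≤b)) (ℕ.m∸n≤m c l)) (u 0 (suc j) l)
  term (suc i) j       l       i≤a _   _   = rest (a ∸ suc i) (b ∸ j) (c ∸ l) (ℕ.+-mono-<-≤ (ℕ.+-mono-<-≤ (smaller i≤a) (ℕ.m∸n≤m b j)) (ℕ.m∸n≤m c l)) (u (suc i) j l)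

geom-unfold : ∀ u → u 0 0 0 ≡ 0ℚ → geom u ≈ˢ one ⊕ u ⊗ geom u
geom-unfold u u₀ a b c = begin
  -- The power N + 1 vanishes in this degree. With it included, splitting off the power 0 leaves `u`
  -- times exactly the powers up to N.
  geom u a b c                                                            ≡⟨ truncate a b c (ℕ.n≤1+n N) ⟩
  sumTo (suc N) (λ k → (u ^^ k) a b c)                                    ≡⟨ sumTo-suc N _ ⟩
  one a b c ℚ.+ sumTo N (λ k → (u ⊗ u ^^ k) a b c)                        ≡⟨ cong (one a b c ℚ.+_) (⊗-sumTo u N (u ^^_) a b c) ⟨
  -- `geom` truncates every coefficient at its own degree, whereas linearity needs one bound; N is
  -- large enough for all coefficients that enter the product.
  one a b c ℚ.+ (u ⊗ (λ a b c → sumTo N (λ k → (u ^^ k) a b c))) a b c    ≡⟨ cong (one a b c ℚ.+_) (⊗-local u a b c λ a′ b′ c′ p q r → truncate a′ b′ c′ (ℕ.+-mono-≤ (ℕ.+-mono-≤ p q) r)) ⟨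
  one a b c ℚ.+ (u ⊗ geom u) a b c                                        ∎
  where
  open ≡.≡-Reasoning
  N = a ℕ.+ b ℕ.+ c
  truncate : ∀ a b c {M} → a ℕ.+ b ℕ.+ c ≤ M → geom u a b c ≡ sumTo M (λ k → (u ^^ k) a b c)
  truncate a b c le = sumTo-extend le (λ k → ^^-vanishes u u₀ k a b c)

sV^-⊗ : ∀ n f a b c → (sV ^^ n ⊗ f) a b c ≡ (if n ≤ᵇ a then f (a ∸ n) b c else 0ℚ)
sV^-⊗ zero    f a b c = 𝕊.*-identityˡ f a b c
sV^-⊗ (suc n) f a b c = trans (𝕊.*-assoc sV (sV ^^ n) f a b c) (trans (sV-⊗ _ a b c) (step a n))
  where
  step : ∀ a n → shiftˢ (sV ^^ n ⊗ f) a b c ≡ (if suc n ≤ᵇ a then f (a ∸ suc n) b c else 0ℚ)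
  step zero    n       = refl
  step (suc a) zero    = sV^-⊗ zero f a b c
  step (suc a) (suc n) = sV^-⊗ (suc n) f a b c

tV^-⊗ : ∀ n f a b c → (tV ^^ n ⊗ f) a b c ≡ (if n ≤ᵇ b then f a (b ∸ n) c else 0ℚ)
tV^-⊗ zero    f a b c = 𝕊.*-identityˡ f a b c
tV^-⊗ (suc n) f a b c = trans (𝕊.*-assoc tV (tV ^^ n) f a b c) (trans (tV-⊗ _ a b c) (step b n))
  where
  step : ∀ b n → shiftᵗ (tV ^^ n ⊗ f) a b c ≡ (if suc n ≤ᵇ b then f a (b ∸ suc n) c else 0ℚ)
  step zero    n       = refl
  step (suc b) zero    = tV^-⊗ zero f a b c
  step (suc b) (suc n) = tV^-⊗ (suc n) f a b c

xV^-⊗ : ∀ n f a b c → (xV ^^ n ⊗ f) a b c ≡ (if n ≤ᵇ c then f a b (c ∸ n) else 0ℚ)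
xV^-⊗ zero    f a b c = 𝕊.*-identityˡ f a b c
xV^-⊗ (suc n) f a b c = trans (𝕊.*-assoc xV (xV ^^ n) f a b c) (trans (xV-⊗ _ a b c) (step c n))
  where
  step : ∀ c n → shiftˣ (xV ^^ n ⊗ f) a b c ≡ (if suc n ≤ᵇ c then f a b (c ∸ suc n) else 0ℚ)
  step zero    n       = refl
  step (suc c) zero    = xV^-⊗ zero f a b c
  step (suc c) (suc n) = xV^-⊗ (suc n) f a b c

open ℚ∑

open import Algebra.Properties.Semiring.Exp 𝕊.semiring using (_^_; ^-congˡ)

^^≡^ : ∀ f n → f ^^ n ≡ f ^ n
^^≡^ f zero    = refl
^^≡^ f (suc n) = cong (f ⊗_) (^^≡^ f n)

shiftℚ : (ℕ → ℚ) → ℕ → ℚ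
shiftℚ φ zero    = 0ℚ
shiftℚ φ (suc n) = φ n

-- The properties of an embedded one-variable series that generating functions need. Stated
-- abstractly, they let one computation serve both s and t; the series in x that count words use the
-- same interface.
record SeriesIn (z : Series) : Set where
  field
    embed       : (ℕ → ℚ) → Series
    embed-cong  : ∀ {φ ψ} → (∀ n → φ n ≡ ψ n) → embed φ ≈ˢ embed ψ
    embed-+     : ∀ φ ψ → embed (λ n → φ n ℚ.+ ψ n) ≈ˢ embed φ ⊕ embed ψ
    embed-0     : embed (λ _ → 0ℚ) ≈ˢ const 0ℚ
    embed-1     : embed (λ n → ℚ∑.⟦ n == 0 ⟧) ≈ˢ one
    embed-shift : ∀ φ → embed (shiftℚ φ) ≈ˢ z ⊗ embed φ

  embed-⟦⟧ : ∀ b φ → embed (λ n → ℚ∑.⟦ b ⟧ ℚ.* φ n) ≈ˢ 𝕊∑.⟦ b ⟧ ⊗ embed φ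
  embed-⟦⟧ true  φ = 𝕊.trans (embed-cong (λ n → ℚ.*-identityˡ (φ n))) (𝕊.sym (𝕊.*-identityˡ (embed φ)))
  embed-⟦⟧ false φ = 𝕊.trans (embed-cong (λ n → ℚ.*-zeroˡ (φ n))) (𝕊.trans embed-0 (𝕊.sym (𝕊.zeroˡ (embed φ))))

  embed-∑ : ∀ {A : Set} (xs : List A) (φ : A → ℕ → ℚ) →
            embed (λ n → ℚ∑.∑ xs (λ x → φ x n)) ≈ˢ 𝕊∑.∑ xs (λ x → embed (φ x))
  embed-∑ []       φ = embed-0
  embed-∑ (x ∷ xs) φ = 𝕊.trans (embed-+ (φ x) _) (𝕊.+-congˡ {embed (φ x)} (embed-∑ xs φ))

inS : SeriesIn sV
inS = record
  { embed = inˢ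
  ; embed-cong = λ p a b c → cong (ℚ∑.⟦ (b == 0) ∧ (c == 0) ⟧ ℚ.*_) (p a)
  ; embed-+ = λ φ ψ a b c → ℚ.*-distribˡ-+ ℚ∑.⟦ (b == 0) ∧ (c == 0) ⟧ (φ a) (ψ a)
  ; embed-0 = λ a b c → trans (ℚ.*-zeroʳ ℚ∑.⟦ (b == 0) ∧ (c == 0) ⟧) (sym (const0 a b c))
  ; embed-1 = λ { zero zero zero → refl ; zero zero (suc c) → refl ; zero (suc b) c → refl
                ; (suc a) zero zero → refl ; (suc a) zero (suc c) → refl ; (suc a) (suc b) c → refl }
  ; embed-shift = λ φ → λ { zero b c → trans (ℚ.*-zeroʳ ℚ∑.⟦ (b == 0) ∧ (c == 0) ⟧) (sym (sV-⊗ (inˢ φ) zero b c))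
                          ; (suc a) b c → sym (sV-⊗ (inˢ φ) (suc a) b c) }
  }

inT : SeriesIn tV
inT = record
  { embed = inᵗ
  ; embed-cong = λ p a b c → cong (ℚ∑.⟦ (a == 0) ∧ (c == 0) ⟧ ℚ.*_) (p b)
  ; embed-+ = λ φ ψ a b c → ℚ.*-distribˡ-+ ℚ∑.⟦ (a == 0) ∧ (c == 0) ⟧ (φ b) (ψ b)
  ; embed-0 = λ a b c → trans (ℚ.*-zeroʳ ℚ∑.⟦ (a == 0) ∧ (c == 0) ⟧) (sym (const0 a b c))
  ; embed-1 = λ { zero zero zero → refl ; zero zero (suc c) → refl ; zero (suc b) zero → refl
                ; zero (suc b) (suc c) → refl ; (suc a) zero c → refl ; (suc a) (suc b) c → refl }
  ; embed-shift = λ φ → λ { a zero c → trans (ℚ.*-zeroʳ ℚ∑.⟦ (a == 0) ∧ (c == 0) ⟧) (sym (tV-⊗ (inᵗ φ) a zero c))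
                          ; a (suc b) c → sym (tV-⊗ (inᵗ φ) a (suc b) c) }
  }

inX : SeriesIn xV
inX = record
  { embed = inˣ
  ; embed-cong = λ p a b c → cong (ℚ∑.⟦ (a == 0) ∧ (b == 0) ⟧ ℚ.*_) (p c)
  ; embed-+ = λ φ ψ a b c → ℚ.*-distribˡ-+ ℚ∑.⟦ (a == 0) ∧ (b == 0) ⟧ (φ c) (ψ c)
  ; embed-0 = λ a b c → trans (ℚ.*-zeroʳ ℚ∑.⟦ (a == 0) ∧ (b == 0) ⟧) (sym (const0 a b c))
  ; embed-1 = λ { zero zero zero → refl ; zero zero (suc c) → refl ; zero (suc b) zero → refl
                ; zero (suc b) (suc c) → refl ; (suc a) b zero → refl ; (suc a) b (suc c) → refl }
  ; embed-shift = λ φ → λ { a b zero → trans (ℚ.*-zeroʳ ℚ∑.⟦ (a == 0) ∧ (b == 0) ⟧) (sym (xV-⊗ (inˣ φ) a b zero))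
                          ; a b (suc c) → sym (xV-⊗ (inˣ φ) a b (suc c)) }
  }

-- Series that count the cuttings of a fixed word

half : Series
half = const (+ 1 ℚ./ 2)

two≈ : two ≈ˢ one ⊕ one
two≈ zero    zero    zero    = refl
two≈ zero    zero    (suc c) = refl
two≈ zero    (suc b) c       = refl
two≈ (suc a) b       c       = refl

half⊕half : half ⊕ half ≈ˢ one
half⊕half zero    zero    zero    = refl
half⊕half zero    zero    (suc c) = refl
half⊕half zero    (suc b) c       = refl
half⊕half (suc a) b       c       = refl

half-⊗-2 : half ⊗ (one ⊕ one) ≈ˢ one
half-⊗-2 = 𝕊.trans (𝕊.distribˡ half one one) (𝕊.trans (𝕊.+-cong (𝕊.*-identityʳ half) (𝕊.*-identityʳ half)) half⊕half)

quarter≈ : const (+ 1 ℚ./ 4) ≈ˢ half ⊗ half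
quarter≈ = begin
  quarter                              ≈⟨ 𝕊.*-identityˡ quarter ⟨
  one ⊗ quarter                        ≈⟨ 𝕊.*-congʳ {quarter} half⊕half ⟨
  (half ⊕ half) ⊗ quarter              ≈⟨ 𝕊.distribʳ quarter half half ⟩
  half ⊗ quarter ⊕ half ⊗ quarter      ≈⟨ 𝕊.distribˡ half quarter quarter ⟨
  half ⊗ (quarter ⊕ quarter)           ≈⟨ 𝕊.*-congˡ {half} quarter⊕quarter ⟩
  half ⊗ half                          ∎
  where
  open import Relation.Binary.Reasoning.Setoid 𝕊.setoid
  quarter = const (+ 1 ℚ./ 4)
  quarter⊕quarter : quarter ⊕ quarter ≈ˢ half
  quarter⊕quarter zero    zero    zero    = refl
  quarter⊕quarter zero    zero    (suc c) = refl
  quarter⊕quarter zero    (suc b) c       = refl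
  quarter⊕quarter (suc a) b       c       = refl

-- A nonempty word is given by its list of ascents (`true`) and descents (`false`).
-- `labelings k d p` counts the ways of cutting it into k consecutive, possibly empty
-- pieces that are alternately increasing and decreasing, the first one in direction d;
-- `labelings₁ k d p` counts the cuttings into k + 1 pieces whose first piece is nonempty.
labelings labelings₁ : ℕ → Bool → List Bool → ℚ
labelings zero    d p = 0ℚ
labelings (suc k) d p = labelings k (not d) p ℚ.+ labelings₁ k d p
labelings₁ k d []      = 1ℚ
labelings₁ k d (e ∷ p) = labelings k (not d) p ℚ.+ ℚ∑.⟦ same d e ⟧ ℚ.* labelings₁ k d p

module LabelingSeries {z : Series} (z₀ : z 0 0 0 ≡ 0ℚ) (Z : SeriesIn z) where
  open SeriesIn Z
  open Transfer 𝕊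
  open import Relation.Binary.Reasoning.Setoid 𝕊.setoid

  embed-ones : embed (λ _ → 1ℚ) ≈ˢ geom z
  embed-ones = begin
    embed (λ _ → 1ℚ)   ≈⟨ geometric-unique {z} {geom z} {embed (λ _ → 1ℚ)} {one} (geom-unfold z z₀) unfold ⟩
    geom z ⊗ one       ≈⟨ 𝕊.*-identityʳ (geom z) ⟩
    geom z             ∎
    where
    unfold : embed (λ _ → 1ℚ) ≈ˢ z ⊗ embed (λ _ → 1ℚ) ⊕ one
    unfold = begin
      embed (λ _ → 1ℚ)                                                   ≈⟨ embed-cong (λ { zero → sym (ℚ.+-identityˡ 1ℚ) ; (suc n) → sym (ℚ.+-identityʳ 1ℚ) }) ⟩
      embed (λ n → shiftℚ (λ _ → 1ℚ) n ℚ.+ ℚ∑.⟦ n == 0 ⟧)                ≈⟨ embed-+ _ _ ⟩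
      embed (shiftℚ (λ _ → 1ℚ)) ⊕ embed (λ n → ℚ∑.⟦ n == 0 ⟧)            ≈⟨ 𝕊.+-cong (embed-shift _) embed-1 ⟩
      z ⊗ embed (λ _ → 1ℚ) ⊕ one                                         ∎

  private
    J : Series
    J = geom (⊖ (z ^^ 2))

    square : z ^^ 2 ≈ˢ z ⊗ z
    square = 𝕊.*-congˡ {z} (𝕊.*-identityʳ z)

    square₀ : (z ^^ 2) 0 0 0 ≡ 0ℚ
    square₀ = ^^-vanishes z z₀ 2 0 0 0 (ℕ.s≤s ℕ.z≤n)

    geom-square : geom (z ^^ 2) ≈ˢ one ⊕ z ⊗ z ⊗ geom (z ^^ 2)
    geom-square = 𝕊.trans (geom-unfold (z ^^ 2) square₀) (𝕊.+-congˡ {one} (𝕊.*-congʳ {geom (z ^^ 2)} square))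

    J-inverse : (one ⊕ z ⊗ z) ⊗ J ≈ˢ one
    J-inverse = begin
      (one ⊕ z ⊗ z) ⊗ J                              ≈⟨ 𝕊.*-congʳ {J} (𝕊.+-congˡ {one} square) ⟨
      (one ⊕ z ^^ 2) ⊗ J                             ≈⟨ 𝕊.distribʳ J one (z ^^ 2) ⟩
      one ⊗ J ⊕ z ^^ 2 ⊗ J                           ≈⟨ 𝕊.+-congʳ {z ^^ 2 ⊗ J} (𝕊.*-identityˡ J) ⟩
      J ⊕ z ^^ 2 ⊗ J                                 ≈⟨ 𝕊.+-congʳ {z ^^ 2 ⊗ J} (geom-unfold (⊖ (z ^^ 2)) (cong ℚ.-_ square₀)) ⟩
      one ⊕ (⊖ (z ^^ 2)) ⊗ J ⊕ z ^^ 2 ⊗ J            ≈⟨ 𝕊.+-assoc one ((⊖ (z ^^ 2)) ⊗ J) (z ^^ 2 ⊗ J) ⟩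
      one ⊕ ((⊖ (z ^^ 2)) ⊗ J ⊕ z ^^ 2 ⊗ J)          ≈⟨ 𝕊.+-congˡ {one} (𝕊.distribʳ J (⊖ (z ^^ 2)) (z ^^ 2)) ⟨
      one ⊕ ((⊖ (z ^^ 2)) ⊕ z ^^ 2) ⊗ J              ≈⟨ 𝕊.+-congˡ {one} (𝕊.*-congʳ {J} (𝕊.-‿inverseˡ (z ^^ 2))) ⟩
      one ⊕ const 0ℚ ⊗ J                             ≈⟨ 𝕊.+-congˡ {one} (𝕊.zeroˡ J) ⟩
      one ⊕ const 0ℚ                                 ≈⟨ 𝕊.+-identityʳ one ⟩
      one                                            ∎

    embed-split : ∀ φ ψ → φ 0 ≡ 0ℚ → (∀ n → φ (suc n) ≡ ψ n) → embed φ ≈ˢ z ⊗ embed ψ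
    embed-split φ ψ p q = 𝕊.trans (embed-cong (λ { zero → p ; (suc n) → q n })) (embed-shift ψ)

  -- The recursion that defines `labelings` yields the equations required by `transfer`, with one
  -- factor z for the first piece. For one letter `labelings₁` is constantly 1, hence the value
  -- 1/(1-z) there.
  labelings-series : ∀ d p →
    embed (λ k → labelings k d p) ≈ˢ
    half ⊗ geom z ^ 2 ⊗ (one ⊕ z ^^ 2) ^ suc (length p) ⊗ geom (z ^^ 2) ^ length p
      ⊗ (two ⊗ z ⊗ J) ^ suc (turns d p)
  labelings-series d p = begin
    G d p
      ≈⟨ transfer z (geom z) (geom (z ^^ 2)) J half (geom-unfold z z₀) geom-square J-inverse half-⊗-2 G H G-eq (λ d → embed-ones) H-∷ d p ⟩
    half ⊗ geom z ^ 2 ⊗ (one ⊕ z ⊗ z) ^ suc n ⊗ geom (z ^^ 2) ^ n ⊗ ((one ⊕ one) ⊗ z ⊗ J) ^ suc (turns d p)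
      ≈⟨ 𝕊.*-cong
           {x = half ⊗ geom z ^ 2 ⊗ (one ⊕ z ⊗ z) ^ suc n ⊗ geom (z ^^ 2) ^ n}
           {y = half ⊗ geom z ^ 2 ⊗ (one ⊕ z ^^ 2) ^ suc n ⊗ geom (z ^^ 2) ^ n}
           (𝕊.*-congʳ {geom (z ^^ 2) ^ n} (𝕊.*-congˡ {half ⊗ geom z ^ 2} (^-congˡ (suc n) (𝕊.+-congˡ {one} (𝕊.sym square)))))
           (^-congˡ (suc (turns d p)) (𝕊.*-congʳ {J} (𝕊.*-congʳ {z} (𝕊.sym two≈)))) ⟩
    half ⊗ geom z ^ 2 ⊗ (one ⊕ z ^^ 2) ^ suc n ⊗ geom (z ^^ 2) ^ n ⊗ (two ⊗ z ⊗ J) ^ suc (turns d p) ∎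
    where
    n = length p
    G H : Bool → List Bool → Series
    G d p = embed (λ k → labelings k d p)
    H d p = embed (λ k → labelings₁ k d p)

    G-eq : ∀ d p → G d p ≈ˢ z ⊗ G (not d) p ⊕ z ⊗ H d p
    G-eq d p = begin
      G d p                                                               ≈⟨ embed-split _ _ refl (λ k → refl) ⟩
      z ⊗ embed (λ k → labelings k (not d) p ℚ.+ labelings₁ k d p)        ≈⟨ 𝕊.*-congˡ {z} (embed-+ _ _) ⟩
      z ⊗ (G (not d) p ⊕ H d p)                                           ≈⟨ 𝕊.distribˡ z (G (not d) p) (H d p) ⟩
      z ⊗ G (not d) p ⊕ z ⊗ H d p                                         ∎

    H-∷ : ∀ d e p → H d (e ∷ p) ≈ˢ G (not d) p ⊕ 𝕊∑.⟦ same d e ⟧ ⊗ H d p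
    H-∷ d e p = 𝕊.trans (embed-+ _ _) (𝕊.+-congˡ {G (not d) p} (embed-⟦⟧ (same d e) _))

-- Biruns and turns

steps : (ℕ → ℕ → Bool) → List ℕ → List Bool
steps r []          = []
steps r (a ∷ [])    = []
steps r (a ∷ b ∷ w) = r a b ∷ steps r (b ∷ w)

-- The summation used by `biruns` is local to its definition, hence only accessible through its defining equations.
∑-descending : ∀ (S : ℕ → (ℕ → ℕ) → ℕ) → (∀ f → S 0 f ≡ 0) → (∀ k f → S (suc k) f ≡ f k ℕ.+ S k f) →
               ∀ k f → S k f ≡ ℕ∑.∑ (upTo k) f
∑-descending S S-zero S-suc zero    f = S-zero f
∑-descending S S-zero S-suc (suc k) f = begin
  S (suc k) f                  ≡⟨ S-suc k f ⟩
  f k ℕ.+ S k f                ≡⟨ cong (f k ℕ.+_) (∑-descending S S-zero S-suc k f) ⟩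
  f k ℕ.+ ℕ∑.∑ (upTo k) f      ≡⟨ ℕ.+-comm (f k) _ ⟩
  ℕ∑.∑ (upTo k) f ℕ.+ f k      ≡⟨ ℕ∑.∑-upTo-last k f ⟨
  ℕ∑.∑ (upTo (suc k)) f        ∎
  where open ≡.≡-Reasoning

biruns-∑ : ∀ w → biruns w ≡ ℕ∑.∑ (upTo (length w)) (λ i → count (length w) (isBirun w i))
-- Once the bound and the summand are abstracted to variables, the goal determines the local
-- summation as the function applied to them.
biruns-∑ w with ∑-descending _ (λ f → refl) (λ k f → refl) | length w | (λ i → count (length w) (isBirun w i))
... | unfold | n | f = unfold n f

if≡⟦⟧ : ∀ b → (if b then 1 else 0) ≡ ℕ∑.⟦ b ⟧
if≡⟦⟧ true  = refl
if≡⟦⟧ false = refl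

if-not≡⟦⟧ : ∀ b → (if b then 0 else 1) ≡ ℕ∑.⟦ not b ⟧
if-not≡⟦⟧ true  = refl
if-not≡⟦⟧ false = refl

-- As `m` never returns from false to true, each counted drop is a difference of consecutive
-- indicators, and the sum telescopes.
count-telescope : ∀ (m : ℕ → Bool) → (∀ l → m (suc l) ≡ true → m l ≡ true) →
                  ∀ K → count K (λ l → m l ∧ not (m (suc l))) ℕ.+ ℕ∑.⟦ m K ⟧ ≡ ℕ∑.⟦ m 0 ⟧
count-telescope m anti zero    = refl
count-telescope m anti (suc K) = trans (step (m K) (m (suc K)) (anti K) (count K _)) (count-telescope m anti K)
  where
  step : ∀ x y → (y ≡ true → x ≡ true) → ∀ c →
         (if x ∧ not y then 1 else 0) ℕ.+ c ℕ.+ ℕ∑.⟦ y ⟧ ≡ c ℕ.+ ℕ∑.⟦ x ⟧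
  step true  true  p c = refl
  step true  false p c = trans (ℕ.+-identityʳ (suc c)) (ℕ.+-comm 1 c)
  step false true  p c with () ← p refl
  step false false p c = refl

count-cong : ∀ K {p q : ℕ → Bool} → (∀ l → p l ≡ q l) → count K p ≡ count K q
count-cong zero    p≡q = refl
count-cong (suc K) p≡q = cong₂ (λ b c → (if b then 1 else 0) ℕ.+ c) (p≡q K) (count-cong K p≡q)

count-false : ∀ K {p : ℕ → Bool} → (∀ l → p l ≡ false) → count K p ≡ 0
count-false zero    p≡f = refl
count-false (suc K) p≡f = cong₂ (λ b c → (if b then 1 else 0) ℕ.+ c) (p≡f K) (count-false K p≡f)

AdjacentDistinct : List ℕ → Set
AdjacentDistinct w = ∀ i → suc i < length w → at w i ≢ at w (suc i)

module Biruns (w : List ℕ) (distinct-steps : AdjacentDistinct w) where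
  private
    n = length w
    δ : ℕ → Bool
    δ i = at w i <ᵇ at w (suc i)

  isStart : ℕ → Bool
  isStart zero    = true
  isStart (suc i) = not (same (δ i) (δ (suc i)))

  private
    incr-left : ∀ i l → incr w i (suc l) ≡ δ i ∧ incr w (suc i) l
    incr-left i zero    rewrite ℕ.+-identityʳ i | ℕ.+-comm i 1 = refl
    incr-left i (suc l) rewrite incr-left i l | ℕ.+-suc i (suc l) | ℕ.+-suc i l =
      ∧-swap (at w (suc (i ℕ.+ l)) <ᵇ at w (suc (suc (i ℕ.+ l)))) (δ i) (incr w (suc i) l)

    decr-left : ∀ i l → decr w i (suc l) ≡ (at w (suc i) <ᵇ at w i) ∧ decr w (suc i) l
    decr-left i zero    rewrite ℕ.+-identityʳ i | ℕ.+-comm i 1 = refl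
    decr-left i (suc l) rewrite decr-left i l | ℕ.+-suc i (suc l) | ℕ.+-suc i l =
      ∧-swap (at w (suc (suc (i ℕ.+ l))) <ᵇ at w (suc (i ℕ.+ l))) (at w (suc i) <ᵇ at w i) (decr w (suc i) l)

    mono-left : ∀ i l → suc i < n → mono w i (suc l) ≡ (δ i ∧ incr w (suc i) l) ∨ (not (δ i) ∧ decr w (suc i) l)
    mono-left i l lt rewrite incr-left i l | decr-left i l | <ᵇ-flip (distinct-steps i lt) = refl

    mono-one : ∀ i → suc i < n → mono w i 1 ≡ true
    mono-one i lt rewrite mono-left i 0 lt with δ i
    ... | true  = refl
    ... | false = refl

    -- A monotone segment with at least two entries has the direction of its first step, so the
    -- entry before it fits exactly if the preceding step has that direction too.
    mono-extend : ∀ i l → suc (suc i) < n → mono w (suc i) (suc l) ≡ true →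
                  mono w i (suc (suc l)) ≡ same (δ i) (δ (suc i))
    mono-extend i l lt eq
      rewrite mono-left i (suc l) (ℕ.<-trans (ℕ.n<1+n _) lt) | mono-left (suc i) l lt
            | incr-left (suc i) l | decr-left (suc i) l | <ᵇ-flip (distinct-steps (suc i) lt)
      = cases (δ i) (δ (suc i)) (incr w (suc (suc i)) l) (decr w (suc (suc i)) l) eq
      where
      cases : ∀ e e′ I D → (e′ ∧ I) ∨ (not e′ ∧ D) ≡ true →
              (e ∧ (e′ ∧ I)) ∨ (not e ∧ (not e′ ∧ D)) ≡ same e e′
      cases true  true  true  D    eq = refl
      cases true  false I     D    eq = refl
      cases false true  I     D    eq = refl
      cases false false I     true eq = refl

    mono-shrink : ∀ i l → mono w i (suc l) ≡ true → mono w i l ≡ true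
    mono-shrink i l = cases (at w (i ℕ.+ l) <ᵇ at w (i ℕ.+ suc l)) (at w (i ℕ.+ suc l) <ᵇ at w (i ℕ.+ l)) (incr w i l) (decr w i l)
      where
      cases : ∀ x y I D → (x ∧ I) ∨ (y ∧ D) ≡ true → I ∨ D ≡ true
      cases x     y    true  D    eq = refl
      cases x     y    false true eq = refl
      cases true  true false false ()
      cases true  false false false ()
      cases false true false false ()
      cases false false false false ()

    -- With the range check included, the end of the word acts like a change of direction: right
    -- maximality is in all cases the drop from `fits i l` to `fits i (suc l)`.
    fits : ℕ → ℕ → Bool
    fits i l = (suc (i ℕ.+ l) ≤ᵇ n) ∧ mono w i l

    fits-shrink : ∀ i l → fits i (suc l) ≡ true → fits i l ≡ true
    fits-shrink i l eq with i ℕ.+ suc l <ᵇ n in lt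
    ... | true rewrite <⇒<ᵇ≡ {i ℕ.+ l} {n} (ℕ.<-trans (ℕ.+-monoʳ-< i (ℕ.n<1+n l)) (<ᵇ≡⇒< {i ℕ.+ suc l} {n} lt)) = mono-shrink i l eq

    -- Left maximality depends on i alone, except for segments with one entry; those are never
    -- biruns here, because they extend to the right.
    birun-split : ∀ i l → suc i < n → isBirun w i l ≡ isStart i ∧ (fits i l ∧ not (fits i (suc l)))
    birun-split i l lt with ℕ.<-cmp (suc (i ℕ.+ l)) n
    ... | tri> _ _ gt rewrite ≤⇒<ᵇ≡ {i ℕ.+ l} {n} (ℕ.≤-pred gt) = sym (∧-zeroʳ (isStart i))
    ... | tri≈ _ eq _ rewrite <⇒<ᵇ≡ {i ℕ.+ l} {n} (ℕ.≤-reflexive eq) | ≡⇒== eq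
                            | ≤⇒<ᵇ≡ {i ℕ.+ suc l} {n} (ℕ.≤-reflexive (trans (sym eq) (sym (ℕ.+-suc i l))))
                      = at-end i l lt eq
      where
      at-end : ∀ i l → suc i < n → suc (i ℕ.+ l) ≡ n →
               mono w i l ∧ (if i == 0 then true else not (mono w (i ∸ 1) (suc l))) ∧ true ≡ isStart i ∧ (mono w i l ∧ true)
      at-end zero    l       lt eq = refl
      at-end (suc i) zero    lt eq = contradiction (trans (cong suc (sym (ℕ.+-identityʳ (suc i)))) eq) (ℕ.<⇒≢ lt)
      at-end (suc i) (suc l) lt eq with mono w (suc i) (suc l) in m
      ... | false = sym (∧-zeroʳ _)
      ... | true rewrite mono-extend i l lt m = refl
    ... | tri< lt′ neq _ rewrite <⇒<ᵇ≡ {i ℕ.+ l} {n} (ℕ.<⇒≤ lt′) | ≢⇒== neq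
                               | <⇒<ᵇ≡ {i ℕ.+ suc l} {n} (subst (_< n) (sym (ℕ.+-suc i l)) lt′)
                         = inside i l lt
      where
      inside : ∀ i l → suc i < n →
               mono w i l ∧ (if i == 0 then true else not (mono w (i ∸ 1) (suc l))) ∧ not (mono w i (suc l)) ≡
               isStart i ∧ (mono w i l ∧ not (mono w i (suc l)))
      inside zero    l       lt = refl
      inside (suc i) zero    lt rewrite mono-one (suc i) lt = trans (∧-zeroʳ _) (sym (∧-zeroʳ _))
      inside (suc i) (suc l) lt with mono w (suc i) (suc l) in m
      ... | false = sym (∧-zeroʳ _)
      ... | true rewrite mono-extend i l lt m = refl

  -- Exactly one of the monotone segments from i is longest: l = 0 fits and l = n does not, so the
  -- drops telescope to 1.
  count-biruns : ∀ i → suc i < n → count n (isBirun w i) ≡ ℕ∑.⟦ isStart i ⟧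
  count-biruns i lt = trans (count-cong n (λ l → birun-split i l lt)) (by-start (isStart i))
    where
    one-maximal : count n (λ l → fits i l ∧ not (fits i (suc l))) ≡ 1
    one-maximal = begin
      count n (λ l → fits i l ∧ not (fits i (suc l)))                      ≡⟨ ℕ.+-identityʳ _ ⟨
      count n (λ l → fits i l ∧ not (fits i (suc l))) ℕ.+ 0                ≡⟨ cong (λ b → count n (λ l → fits i l ∧ not (fits i (suc l))) ℕ.+ ℕ∑.⟦ b ⟧) fits-n ⟨
      count n (λ l → fits i l ∧ not (fits i (suc l))) ℕ.+ ℕ∑.⟦ fits i n ⟧  ≡⟨ count-telescope (fits i) (fits-shrink i) n ⟩
      ℕ∑.⟦ fits i 0 ⟧                                                      ≡⟨ cong ℕ∑.⟦_⟧ fits-0 ⟩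
      1                                                                    ∎
      where
      open ≡.≡-Reasoning
      fits-n : fits i n ≡ false
      fits-n = cong (_∧ mono w i n) (≤⇒<ᵇ≡ (ℕ.m≤n+m n i))
      fits-0 : fits i 0 ≡ true
      fits-0 = cong (_∧ true) (<⇒<ᵇ≡ (subst (_< n) (sym (ℕ.+-identityʳ i)) (ℕ.<-trans (ℕ.n<1+n i) lt)))

    by-start : ∀ b → count n (λ l → b ∧ (fits i l ∧ not (fits i (suc l)))) ≡ ℕ∑.⟦ b ⟧
    by-start true  = one-maximal
    by-start false = count-false n (λ l → refl)

  -- At the last position of a word with at least two letters, a single entry extends to the left
  -- and anything longer leaves the word.
  count-biruns-last : ∀ i → suc (suc i) ≡ n → count n (isBirun w (suc i)) ≡ 0
  count-biruns-last i eq = count-false n none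
    where
    none : ∀ l → isBirun w (suc i) l ≡ false
    none zero    rewrite mono-one i (ℕ.≤-reflexive eq) = ∧-zeroʳ _
    none (suc l) rewrite ≤⇒<ᵇ≡ {suc i ℕ.+ suc l} {n} (subst (_≤ suc i ℕ.+ suc l) eq (s≤s (subst (suc i ≤_) (sym (ℕ.+-suc i l)) (s≤s (ℕ.m≤m+n i l))))) = refl

  biruns-starts : ∀ k → suc (suc k) ≡ n → biruns w ≡ ℕ∑.∑ (upTo (suc k)) (λ i → ℕ∑.⟦ isStart i ⟧)
  biruns-starts k eq = begin
    biruns w                                            ≡⟨ biruns-∑ w ⟩
    ℕ∑.∑ (upTo n) c                                     ≡⟨ cong (λ m → ℕ∑.∑ (upTo m) c) eq ⟨
    ℕ∑.∑ (upTo (suc (suc k))) c                         ≡⟨ ℕ∑.∑-upTo-last (suc k) c ⟩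
    ℕ∑.∑ (upTo (suc k)) c ℕ.+ c (suc k)                 ≡⟨ cong₂ ℕ._+_ (ℕ∑.∑-upTo-cong (suc k) (λ i i<k → count-biruns i (subst (suc i <_) eq (s≤s i<k)))) (count-biruns-last k eq) ⟩
    ℕ∑.∑ (upTo (suc k)) (λ i → ℕ∑.⟦ isStart i ⟧) ℕ.+ 0  ≡⟨ ℕ.+-identityʳ _ ⟩
    ℕ∑.∑ (upTo (suc k)) (λ i → ℕ∑.⟦ isStart i ⟧)        ∎
    where
    open ≡.≡-Reasoning
    c = λ i → count n (isBirun w i)

turns-∑ : ∀ d a b w → turns d (steps _<ᵇ_ (a ∷ b ∷ w)) ≡
  ℕ∑.⟦ not (same d (a <ᵇ b)) ⟧ ℕ.+
  ℕ∑.∑ (upTo (length w)) (λ i → ℕ∑.⟦ not (same (at (a ∷ b ∷ w) i <ᵇ at (b ∷ w) i) (at (b ∷ w) i <ᵇ at w i)) ⟧)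
turns-∑ d a b []      = cong₂ ℕ._+_ (if-not≡⟦⟧ (same d (a <ᵇ b))) refl
turns-∑ d a b (c ∷ w) = cong₂ ℕ._+_ (if-not≡⟦⟧ (same d (a <ᵇ b))) (trans (turns-∑ (a <ᵇ b) b c w) (sym (ℕ∑.∑-upTo-suc (length w) _)))

-- One birun starts at the first entry and one more at each inner change of direction. The extra run
-- of an initial descent is its turn against the virtual ascent in front of the word.
udr-turns : ∀ a w → AdjacentDistinct (a ∷ w) → udr (a ∷ w) ≡ suc (turns true (steps _<ᵇ_ (a ∷ w)))
udr-turns a []      _ = refl
udr-turns a (b ∷ w) distinct-steps = begin
  biruns (a ∷ b ∷ w) ℕ.+ (if b <ᵇ a then 1 else 0)
    ≡⟨ cong₂ ℕ._+_ (biruns-starts (length w) refl) (trans (if≡⟦⟧ (b <ᵇ a)) (cong ℕ∑.⟦_⟧ (<ᵇ-flip (distinct-steps 0 (s≤s (s≤s z≤n)))))) ⟩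
  ℕ∑.∑ (upTo (suc (length w))) (λ i → ℕ∑.⟦ isStart i ⟧) ℕ.+ ℕ∑.⟦ not (a <ᵇ b) ⟧
    ≡⟨ cong (ℕ._+ ℕ∑.⟦ not (a <ᵇ b) ⟧) (ℕ∑.∑-upTo-suc (length w) (λ i → ℕ∑.⟦ isStart i ⟧)) ⟩
  suc (ℕ∑.∑ (upTo (length w)) (λ i → ℕ∑.⟦ isStart (suc i) ⟧) ℕ.+ ℕ∑.⟦ not (a <ᵇ b) ⟧)
    ≡⟨ cong suc (ℕ.+-comm _ ℕ∑.⟦ not (a <ᵇ b) ⟧) ⟩
  suc (ℕ∑.⟦ not (a <ᵇ b) ⟧ ℕ.+ ℕ∑.∑ (upTo (length w)) (λ i → ℕ∑.⟦ isStart (suc i) ⟧))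
    ≡⟨ cong suc (turns-∑ true a b w) ⟨
  suc (turns true (steps _<ᵇ_ (a ∷ b ∷ w))) ∎
  where
  open ≡.≡-Reasoning
  open Biruns (a ∷ b ∷ w) distinct-steps

-- Cuttings as weakly increasing labelings

∑-words-suc : ∀ n l F → ∑ (words (suc n) l) F ≡ ∑ (words n l) (λ w → ∑ (upTo l) (λ a → F (suc a ∷ w)))
∑-words-suc n l F = trans (∑-concatMap _ (words n l) F) (∑-cong (words n l) (λ w → ∑-map _ (upTo l) F))

⟦∧⟧ : ∀ x y → ⟦ x ∧ y ⟧ ≡ ⟦ x ⟧ ℚ.* ⟦ y ⟧
⟦∧⟧ true  y = sym (ℚ.*-identityˡ ⟦ y ⟧)
⟦∧⟧ false y = sym (ℚ.*-zeroˡ ⟦ y ⟧)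

-- Labels are the numbers of pieces, and odd pieces are increasing. Neighbouring letters may share a
-- label only if their step `e` follows the direction of the piece; otherwise the label grows, and
-- skipped labels are empty pieces.
precedes : ℕ → ℕ → Bool → Bool
precedes b c e = (b <ᵇ c) ∨ ((c == b) ∧ same (odd b) e)

validFrom : ℕ → List ℕ → List Bool → Bool
validFrom b []      []      = true
validFrom b (c ∷ g) (e ∷ p) = precedes b c e ∧ validFrom c g p
validFrom b _       _       = false

valid : List ℕ → List Bool → Bool
valid []      p = false
valid (b ∷ g) p = validFrom b g p

-- The sum runs over the number c + 1 of the first nonempty piece when the m pieces from b + 1 to l
-- are available. The induction decides whether piece b + 1 is empty.
labelings-∑ : ∀ l p m b → m ℕ.+ b ≡ l →
              ∑ (upTo l) (λ c → ⟦ b ≤ᵇ c ⟧ ℚ.* labelings₁ (l ∸ suc c) (odd (suc c)) p) ≡ labelings m (odd (suc b)) p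
labelings-∑ l p zero    b refl = trans (∑-upTo-cong b vanish) (∑-zero (upTo b))
  where
  vanish : ∀ c → c < b → ⟦ b ≤ᵇ c ⟧ ℚ.* labelings₁ (b ∸ suc c) (odd (suc c)) p ≡ 0ℚ
  vanish c c<b rewrite ¬T⇒≡ {b ≤ᵇ c} (λ t → ℕ.<⇒≱ c<b (ℕ.≤ᵇ⇒≤ b c t)) = ℚ.*-zeroˡ (labelings₁ (b ∸ suc c) (odd (suc c)) p)
labelings-∑ l p (suc m) b eq = begin
  ∑ (upTo l) (λ c → ⟦ b ≤ᵇ c ⟧ ℚ.* f c)                         ≡⟨ ∑-split true (b <ᵇ_) (_== b) (b ≤ᵇ_) f b<l (λ c → refl) (<ᵇ-==-disjoint b) (≤ᵇ-split b) ⟩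
  ∑ (upTo l) (λ c → ⟦ b <ᵇ c ⟧ ℚ.* f c) ℚ.+ 1ℚ ℚ.* f b          ≡⟨ cong₂ ℚ._+_ (labelings-∑ l p m (suc b) (trans (ℕ.+-suc m b) eq)) (ℚ.*-identityˡ (f b)) ⟩
  labelings m (odd (suc (suc b))) p ℚ.+ f b                     ≡⟨ cong (λ k → labelings m (odd (suc (suc b))) p ℚ.+ labelings₁ k (odd (suc b)) p) l∸ ⟩
  labelings m (odd (suc (suc b))) p ℚ.+ labelings₁ m (odd (suc b)) p  ∎
  where
  open ≡.≡-Reasoning
  f = λ c → labelings₁ (l ∸ suc c) (odd (suc c)) p
  b<l : b < l
  b<l = subst (b <_) eq (s≤s (ℕ.m≤n+m b m))
  l∸ : l ∸ suc b ≡ m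
  l∸ = trans (cong (_∸ suc b) (trans (sym eq) (sym (ℕ.+-suc m b)))) (ℕ.m+n∸n≡m m (suc b))

-- A letter labeled b + 1 leaves l - (b + 1) pieces after its own. The next letter opens a later
-- piece, or stays in this one if the step allows it.
validFrom-count : ∀ l p b → b < l →
                  ∑ (words (length p) l) (λ g → ⟦ validFrom (suc b) g p ⟧) ≡ labelings₁ (l ∸ suc b) (odd (suc b)) p
validFrom-count l []      b b<l = ℚ.+-identityʳ 1ℚ
validFrom-count l (e ∷ p) b b<l = begin
  ∑ (words (suc (length p)) l) (λ g → ⟦ validFrom (suc b) g (e ∷ p) ⟧)
    ≡⟨ ∑-words-suc (length p) l _ ⟩
  ∑ (words (length p) l) (λ g → ∑ (upTo l) (λ c → ⟦ precedes (suc b) (suc c) e ∧ validFrom (suc c) g p ⟧))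
    ≡⟨ ∑-swap (words (length p) l) (upTo l) _ ⟩
  ∑ (upTo l) (λ c → ∑ (words (length p) l) (λ g → ⟦ precedes (suc b) (suc c) e ∧ validFrom (suc c) g p ⟧))
    ≡⟨ ∑-upTo-cong l inner ⟩
  ∑ (upTo l) (λ c → ⟦ precedes (suc b) (suc c) e ⟧ ℚ.* f c)
    ≡⟨ ∑-split (same (odd (suc b)) e) (b <ᵇ_) (_== b) (λ c → precedes (suc b) (suc c) e) f b<l (λ c → refl) (<ᵇ-==-disjoint b) (λ c → refl) ⟩
  ∑ (upTo l) (λ c → ⟦ b <ᵇ c ⟧ ℚ.* f c) ℚ.+ ⟦ same (odd (suc b)) e ⟧ ℚ.* f b
    ≡⟨ cong (ℚ._+ ⟦ same (odd (suc b)) e ⟧ ℚ.* f b) (labelings-∑ l p (l ∸ suc b) (suc b) (ℕ.m∸n+n≡m b<l)) ⟩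
  labelings₁ (l ∸ suc b) (odd (suc b)) (e ∷ p) ∎
  where
  open ≡.≡-Reasoning
  f = λ c → labelings₁ (l ∸ suc c) (odd (suc c)) p
  inner : ∀ c → c < l → ∑ (words (length p) l) (λ g → ⟦ precedes (suc b) (suc c) e ∧ validFrom (suc c) g p ⟧) ≡ ⟦ precedes (suc b) (suc c) e ⟧ ℚ.* f c
  inner c c<l = begin
    ∑ (words (length p) l) (λ g → ⟦ precedes (suc b) (suc c) e ∧ validFrom (suc c) g p ⟧)         ≡⟨ ∑-cong (words (length p) l) (λ g → ⟦∧⟧ (precedes (suc b) (suc c) e) _) ⟩
    ∑ (words (length p) l) (λ g → ⟦ precedes (suc b) (suc c) e ⟧ ℚ.* ⟦ validFrom (suc c) g p ⟧)   ≡⟨ *-∑ (words (length p) l) ⟦ precedes (suc b) (suc c) e ⟧ _ ⟨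
    ⟦ precedes (suc b) (suc c) e ⟧ ℚ.* ∑ (words (length p) l) (λ g → ⟦ validFrom (suc c) g p ⟧)   ≡⟨ cong (⟦ precedes (suc b) (suc c) e ⟧ ℚ.*_) (validFrom-count l p c c<l) ⟩
    ⟦ precedes (suc b) (suc c) e ⟧ ℚ.* f c                                                        ∎

valid-count : ∀ l p → ∑ (words (suc (length p)) l) (λ g → ⟦ valid g p ⟧) ≡ labelings l true p
valid-count l p = begin
  ∑ (words (suc (length p)) l) (λ g → ⟦ valid g p ⟧)                                       ≡⟨ ∑-words-suc (length p) l _ ⟩
  ∑ (words (length p) l) (λ g → ∑ (upTo l) (λ c → ⟦ validFrom (suc c) g p ⟧))              ≡⟨ ∑-swap (words (length p) l) (upTo l) _ ⟩
  ∑ (upTo l) (λ c → ∑ (words (length p) l) (λ g → ⟦ validFrom (suc c) g p ⟧))              ≡⟨ ∑-upTo-cong l (λ c c<l → trans (validFrom-count l p c c<l) (sym (ℚ.*-identityˡ _))) ⟩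
  ∑ (upTo l) (λ c → ⟦ 0 ≤ᵇ c ⟧ ℚ.* labelings₁ (l ∸ suc c) (odd (suc c)) p)                 ≡⟨ labelings-∑ l p l 0 (ℕ.+-identityʳ l) ⟩
  labelings l true p                                                                       ∎
  where open ≡.≡-Reasoning

-- Cuttings of all words over an alphabet

-- Cuttings of a possibly empty word over the ordered alphabet in which odd letters may be
-- repeated in increasing pieces and even letters in decreasing pieces.
cuttings : ℕ → Bool → List ℕ → ℚ
cuttings k d []      = 1ℚ
cuttings k d (a ∷ u) = labelings k d (steps superAscent (a ∷ u))

cuttings-zero : ∀ d l n → ∑ (words n l) (cuttings 0 d) ≡ ⟦ n == 0 ⟧
cuttings-zero d l zero    = ℚ.+-identityʳ 1ℚ
cuttings-zero d l (suc n) = begin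
  ∑ (words (suc n) l) (cuttings 0 d)                   ≡⟨ ∑-words-suc n l _ ⟩
  ∑ (words n l) (λ w → ∑ (upTo l) (λ a → 0ℚ))          ≡⟨ ∑-cong (words n l) (λ w → ∑-zero (upTo l)) ⟩
  ∑ (words n l) (λ w → 0ℚ)                             ≡⟨ ∑-zero (words n l) ⟩
  0ℚ                                                   ∎
  where open ≡.≡-Reasoning

cuttings₁ : ℕ → Bool → ℕ → ℕ → ℕ → ℚ
cuttings₁ k d l c n = ∑ (words n l) (λ u → labelings₁ k d (steps superAscent (suc c ∷ u)))

-- The first piece is empty or begins with some letter c + 1, which accounts for the shift in the
-- length.
cuttings-suc : ∀ k d l n → ∑ (words n l) (cuttings (suc k) d) ≡
               ∑ (words n l) (cuttings k (not d)) ℚ.+ shiftℚ (λ n → ∑ (upTo l) (λ c → cuttings₁ k d l c n)) n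
cuttings-suc k d l zero    = refl
cuttings-suc k d l (suc n) = begin
  ∑ (words (suc n) l) (cuttings (suc k) d)
    ≡⟨ ∑-words-suc n l _ ⟩
  ∑ (words n l) (λ w → ∑ (upTo l) (λ a → F a w ℚ.+ F₁ a w))
    ≡⟨ ∑-cong (words n l) (λ w → ∑-+ (upTo l) _ _) ⟩
  ∑ (words n l) (λ w → ∑ (upTo l) (λ a → F a w) ℚ.+ ∑ (upTo l) (λ a → F₁ a w))
    ≡⟨ ∑-+ (words n l) _ _ ⟩
  ∑ (words n l) (λ w → ∑ (upTo l) (λ a → F a w)) ℚ.+ ∑ (words n l) (λ w → ∑ (upTo l) (λ a → F₁ a w))
    ≡⟨ cong₂ ℚ._+_ (sym (∑-words-suc n l _)) (∑-swap (words n l) (upTo l) _) ⟩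
  ∑ (words (suc n) l) (cuttings k (not d)) ℚ.+ ∑ (upTo l) (λ c → cuttings₁ k d l c n)
    ∎
  where
  open ≡.≡-Reasoning
  F  = λ a w → labelings k (not d) (steps superAscent (suc a ∷ w))
  F₁ = λ a w → labelings₁ k d (steps superAscent (suc a ∷ w))

-- The first piece ends after the letter c + 1 or continues with a letter c′ + 1 in direction `d`.
-- For n = 0 both sides are 1, since only empty pieces follow.
cuttings₁-unfold : ∀ k d l c n → cuttings₁ k d l c n ≡
  ∑ (words n l) (cuttings k (not d)) ℚ.+
  shiftℚ (λ n → ∑ (upTo l) (λ c′ → ⟦ same d (superAscent (suc c) (suc c′)) ⟧ ℚ.* cuttings₁ k d l c′ n)) n
cuttings₁-unfold k d l c zero    = refl
cuttings₁-unfold k d l c (suc n) = begin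
  cuttings₁ k d l c (suc n)
    ≡⟨ ∑-words-suc n l _ ⟩
  ∑ (words n l) (λ w → ∑ (upTo l) (λ a → F a w ℚ.+ S a ℚ.* F₁ a w))
    ≡⟨ ∑-cong (words n l) (λ w → ∑-+ (upTo l) _ _) ⟩
  ∑ (words n l) (λ w → ∑ (upTo l) (λ a → F a w) ℚ.+ ∑ (upTo l) (λ a → S a ℚ.* F₁ a w))
    ≡⟨ ∑-+ (words n l) _ _ ⟩
  ∑ (words n l) (λ w → ∑ (upTo l) (λ a → F a w)) ℚ.+ ∑ (words n l) (λ w → ∑ (upTo l) (λ a → S a ℚ.* F₁ a w))
    ≡⟨ cong₂ ℚ._+_ (sym (∑-words-suc n l _)) (trans (∑-swap (words n l) (upTo l) _) (∑-cong (upTo l) (λ a → sym (*-∑ (words n l) (S a) _)))) ⟩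
  ∑ (words (suc n) l) (cuttings k (not d)) ℚ.+ ∑ (upTo l) (λ a → S a ℚ.* cuttings₁ k d l a n)
    ∎
  where
  open ≡.≡-Reasoning
  S  = λ a → ⟦ same d (superAscent (suc c) (suc a)) ⟧
  F  = λ a w → labelings k (not d) (steps superAscent (suc a ∷ w))
  F₁ = λ a w → labelings₁ k d (steps superAscent (suc a ∷ w))

private
  module A = Alphabet 𝕊

module _ (l : ℕ) where
  open SeriesIn inX
  open import Relation.Binary.Reasoning.Setoid 𝕊.setoid

  cuttingSeries : ℕ → Bool → Series
  cuttingSeries k d = inˣ (λ n → ∑ (words n l) (cuttings k d))

  cuttingSeries-zero : ∀ d → cuttingSeries 0 d ≈ˢ one
  cuttingSeries-zero d = 𝕊.trans (embed-cong (cuttings-zero d l)) embed-1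

  -- No condition links the letters on the two sides of a cut, so the first piece splits off as the
  -- alphabet product of its direction.
  cuttingSeries-suc : ∀ k d → cuttingSeries (suc k) d ≈ˢ A.Πκ xV inv1-x (geom-unfold xV refl) d l ⊗ cuttingSeries k (not d)
  cuttingSeries-suc k d = begin
    cuttingSeries (suc k) d                                          ≈⟨ embed-cong (cuttings-suc k d l) ⟩
    inˣ (λ n → ∑ (words n l) (cuttings k (not d)) ℚ.+ shiftℚ (λ n → ∑ (upTo l) (λ c → cuttings₁ k d l c n)) n)
                                                                     ≈⟨ embed-+ _ _ ⟩
    V ⊕ inˣ (shiftℚ (λ n → ∑ (upTo l) (λ c → cuttings₁ k d l c n)))  ≈⟨ 𝕊.+-congˡ {V} (embed-shift _) ⟩
    V ⊕ xV ⊗ inˣ (λ n → ∑ (upTo l) (λ c → cuttings₁ k d l c n))      ≈⟨ 𝕊.+-congˡ {V} (𝕊.*-congˡ {xV} (embed-∑ (upTo l) (cuttings₁ k d l))) ⟩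
    V ⊕ xV ⊗ 𝕊∑.∑ (upTo l) E                                         ≈⟨ 𝕊.+-congˡ {V} (𝕊∑.*-∑ (upTo l) xV E) ⟩
    V ⊕ 𝕊∑.∑ (upTo l) H                                              ≈⟨ A.alphabet-product xV inv1-x (geom-unfold xV refl) l V H d H-eq ⟩
    A.Πκ xV inv1-x (geom-unfold xV refl) d l ⊗ V                     ∎
    where
    V = cuttingSeries k (not d)
    E H : ℕ → Series
    E c = inˣ (cuttings₁ k d l c)
    H c = xV ⊗ E c
    S : ℕ → ℕ → Bool
    S c c′ = same d (superAscent (suc c) (suc c′))

    swap : ∀ f g h → f ⊗ (g ⊗ h) ≈ˢ g ⊗ (f ⊗ h)
    swap f g h = 𝕊.trans (𝕊.sym (𝕊.*-assoc f g h)) (𝕊.trans (𝕊.*-congʳ {h} (𝕊.*-comm f g)) (𝕊.*-assoc g f h))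

    H-eq : ∀ c → H c ≈ˢ xV ⊗ (V ⊕ 𝕊∑.∑ (upTo l) (λ c′ → 𝕊∑.⟦ S c c′ ⟧ ⊗ H c′))
    H-eq c = 𝕊.*-congˡ {xV} (begin
      E c                                                                                    ≈⟨ embed-cong (cuttings₁-unfold k d l c) ⟩
      inˣ (λ n → ∑ (words n l) (cuttings k (not d)) ℚ.+ shiftℚ (λ n → ∑ (upTo l) (λ c′ → ⟦ S c c′ ⟧ ℚ.* cuttings₁ k d l c′ n)) n)
                                                                                             ≈⟨ embed-+ _ _ ⟩
      V ⊕ inˣ (shiftℚ (λ n → ∑ (upTo l) (λ c′ → ⟦ S c c′ ⟧ ℚ.* cuttings₁ k d l c′ n)))       ≈⟨ 𝕊.+-congˡ {V} (embed-shift _) ⟩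
      V ⊕ xV ⊗ inˣ (λ n → ∑ (upTo l) (λ c′ → ⟦ S c c′ ⟧ ℚ.* cuttings₁ k d l c′ n))           ≈⟨ 𝕊.+-congˡ {V} (𝕊.*-congˡ {xV} (embed-∑ (upTo l) _)) ⟩
      V ⊕ xV ⊗ 𝕊∑.∑ (upTo l) (λ c′ → inˣ (λ n → ⟦ S c c′ ⟧ ℚ.* cuttings₁ k d l c′ n))        ≈⟨ 𝕊.+-congˡ {V} (𝕊∑.*-∑ (upTo l) xV _) ⟩
      V ⊕ 𝕊∑.∑ (upTo l) (λ c′ → xV ⊗ inˣ (λ n → ⟦ S c c′ ⟧ ℚ.* cuttings₁ k d l c′ n))        ≈⟨ 𝕊.+-congˡ {V} (𝕊∑.∑-cong (upTo l) (λ c′ → 𝕊.trans (𝕊.*-congˡ {xV} (embed-⟦⟧ (S c c′) (cuttings₁ k d l c′))) (swap xV 𝕊∑.⟦ S c c′ ⟧ (E c′)))) ⟩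
      V ⊕ 𝕊∑.∑ (upTo l) (λ c′ → 𝕊∑.⟦ S c c′ ⟧ ⊗ H c′)                                        ∎)

totalCuttings : ℕ → ℕ → ℕ → ℚ
totalCuttings k l n = ∑ (words n l) (cuttings k true)

module _ (i j : ℕ) where
  private
    closed : ∀ {k l k′ l′ f} → k ≡ k′ → l ≡ l′ → cuttingSeries l k true ≈ˢ f → inˣ (totalCuttings k′ l′) ≈ˢ f
    closed refl refl p = p

    geomX : inv1-x ≈ˢ one ⊕ xV ⊗ inv1-x
    geomX = geom-unfold xV refl

  series-even-even : inˣ (totalCuttings (2 ℕ.* i) (2 ℕ.* j)) ≈ˢ q ^ (2 ℕ.* i ℕ.* j)
  series-even-even = closed (double≡2* i) (double≡2* j)
    (A.closed-even-even xV inv1-x geomX (double j) (cuttingSeries (double j)) (cuttingSeries-zero _) (cuttingSeries-suc _) j i refl)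

  series-odd-even : inˣ (totalCuttings (suc (2 ℕ.* i)) (2 ℕ.* j)) ≈ˢ q ^ (2 ℕ.* i ℕ.* j) ⊗ q ^ j
  series-odd-even = closed (cong suc (double≡2* i)) (double≡2* j)
    (A.closed-odd-even xV inv1-x geomX (double j) (cuttingSeries (double j)) (cuttingSeries-zero _) (cuttingSeries-suc _) j i refl)

  series-even-odd : inˣ (totalCuttings (2 ℕ.* i) (suc (2 ℕ.* j))) ≈ˢ q ^ (2 ℕ.* i ℕ.* j) ⊗ q ^ i
  series-even-odd = closed (double≡2* i) (cong suc (double≡2* j))
    (A.closed-even-odd xV inv1-x geomX (suc (double j)) (cuttingSeries (suc (double j))) (cuttingSeries-zero _) (cuttingSeries-suc _) j i refl)

  series-odd-odd : inˣ (totalCuttings (suc (2 ℕ.* i)) (suc (2 ℕ.* j))) ≈ˢ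
    q ^ (2 ℕ.* i ℕ.* j) ⊗ ((one ⊕ xV) ^ (i ℕ.+ j) ⊗ inv1-x ^ (i ℕ.+ j ℕ.+ 1))
  series-odd-odd = closed (cong suc (double≡2* i)) (cong suc (double≡2* j))
    (A.closed-odd-odd xV inv1-x geomX (suc (double j)) (cuttingSeries (suc (double j))) (cuttingSeries-zero _) (cuttingSeries-suc _) j i refl)

-- Coefficients of the right-hand side

≤ᵇ-∸-== : ∀ m n → (m ≤ᵇ n) ∧ (n ∸ m == 0) ≡ (n == m)
≤ᵇ-∸-== zero          n       = refl
≤ᵇ-∸-== (suc m)       zero    = refl
≤ᵇ-∸-== (suc zero)    (suc n) = ≤ᵇ-∸-== zero n
≤ᵇ-∸-== (suc (suc m)) (suc n) = ≤ᵇ-∸-== (suc m) n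

monomial-coeff : ∀ α β φ a b c → (sV ^^ α ⊗ (tV ^^ β ⊗ inˣ φ)) a b c ≡ ⟦ a == α ⟧ ℚ.* (⟦ b == β ⟧ ℚ.* φ c)
monomial-coeff α β φ a b c
  rewrite sV^-⊗ α (tV ^^ β ⊗ inˣ φ) a b c | tV^-⊗ β (inˣ φ) (a ∸ α) b c | sym (≤ᵇ-∸-== α a) | sym (≤ᵇ-∸-== β b)
  = cases (α ≤ᵇ a) (a ∸ α == 0) (β ≤ᵇ b) (b ∸ β == 0)
  where
  z : ∀ y → 0ℚ ≡ 0ℚ ℚ.* y
  z y = sym (ℚ.*-zeroˡ y)
  cases : ∀ p p′ r r′ → (if p then if r then ⟦ p′ ∧ r′ ⟧ ℚ.* φ c else 0ℚ else 0ℚ) ≡ ⟦ p ∧ p′ ⟧ ℚ.* (⟦ r ∧ r′ ⟧ ℚ.* φ c)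
  cases false p′    r     r′ = z (⟦ r ∧ r′ ⟧ ℚ.* φ c)
  cases true  false true  r′ = trans (ℚ.*-zeroˡ (φ c)) (z (⟦ r′ ⟧ ℚ.* φ c))
  cases true  false false r′ = z (0ℚ ℚ.* φ c)
  cases true  true  true  r′ = sym (ℚ.*-identityˡ (⟦ r′ ⟧ ℚ.* φ c))
  cases true  true  false r′ = trans (z (φ c)) (sym (ℚ.*-identityˡ (0ℚ ℚ.* φ c)))

parityIndicator : ℕ → ℕ → ℚ
parityIndicator a i = ⟦ a == 2 ℕ.* i ⟧ ℚ.+ ⟦ a == suc (2 ℕ.* i) ⟧

parityIndicator-δ : ∀ a i → parityIndicator a i ≡ ⟦ i == ⌊ a /2⌋ ⟧
parityIndicator-δ a i rewrite sym (double≡2* i) = go a i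
  where
  go : ∀ a i → ⟦ a == double i ⟧ ℚ.+ ⟦ a == suc (double i) ⟧ ≡ ⟦ i == ⌊ a /2⌋ ⟧
  go zero          zero    = refl
  go zero          (suc i) = refl
  go (suc zero)    zero    = refl
  go (suc zero)    (suc i) = refl
  go (suc (suc a)) zero    = refl
  go (suc (suc a)) (suc i) = go a i

sumTo-parity : ∀ a x → sumTo a (λ i → parityIndicator a i ℚ.* x) ≡ x
sumTo-parity a x = begin
  sumTo a (λ i → parityIndicator a i ℚ.* x)               ≡⟨ sumTo-cong a (λ i _ → cong (ℚ._* x) (parityIndicator-δ a i)) ⟩
  sumTo a (λ i → ⟦ i == ⌊ a /2⌋ ⟧ ℚ.* x)                  ≡⟨ sumTo-∑ a _ ⟩
  ∑ (upTo (suc a)) (λ i → ⟦ i == ⌊ a /2⌋ ⟧ ℚ.* x)         ≡⟨ ∑-upTo-δ (suc a) ⌊ a /2⌋ (λ _ → x) (s≤s (ℕ.⌊n/2⌋≤n a)) ⟩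
  x                                                       ∎
  where open ≡.≡-Reasoning

-- Only i = ⌊a/2⌋ and j = ⌊b/2⌋ contribute, and of the four monomials there only the one with the
-- parities of a and b; its series in x counts the cuttings into a pieces over b letters.
RHS-coeff : ∀ a b c → RHS a b c ≡ totalCuttings a b c
RHS-coeff a b c = begin
  RHS a b c                                                                                     ≡⟨ sumTo-cong a (λ i _ → sumTo-cong b (λ j _ → term i j)) ⟩
  sumTo a (λ i → sumTo b (λ j → parityIndicator b j ℚ.* (parityIndicator a i ℚ.* W)))           ≡⟨ sumTo-cong a (λ i _ → sumTo-parity b (parityIndicator a i ℚ.* W)) ⟩
  sumTo a (λ i → parityIndicator a i ℚ.* W)                                                     ≡⟨ sumTo-parity a W ⟩
  W                                                                                             ∎
  where
  open ≡.≡-Reasoning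
  W = totalCuttings a b c

  substitute : ∀ α β → ⟦ a == α ⟧ ℚ.* (⟦ b == β ⟧ ℚ.* totalCuttings α β c) ≡ ⟦ a == α ⟧ ℚ.* (⟦ b == β ⟧ ℚ.* W)
  substitute α β with a == α in eq | b == β in eq′
  ... | true  | true  rewrite ==⇒≡ {a} eq | ==⇒≡ {b} eq′ = refl
  ... | true  | false = cong (1ℚ ℚ.*_) (trans (ℚ.*-zeroˡ (totalCuttings α β c)) (sym (ℚ.*-zeroˡ W)))
  ... | false | r     = trans (ℚ.*-zeroˡ (⟦ r ⟧ ℚ.* totalCuttings α β c)) (sym (ℚ.*-zeroˡ (⟦ r ⟧ ℚ.* W)))

  monomial : ∀ α β → (sV ^^ α ⊗ (tV ^^ β ⊗ inˣ (totalCuttings α β))) a b c ≡ ⟦ a == α ⟧ ℚ.* (⟦ b == β ⟧ ℚ.* W)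
  monomial α β = trans (monomial-coeff α β (totalCuttings α β) a b c) (substitute α β)

  factor : ∀ p p′ r r′ → p ℚ.* (r ℚ.* W) ℚ.+ p′ ℚ.* (r ℚ.* W) ℚ.+ p ℚ.* (r′ ℚ.* W) ℚ.+ p′ ℚ.* (r′ ℚ.* W) ≡ (r ℚ.+ r′) ℚ.* ((p ℚ.+ p′) ℚ.* W)
  factor p p′ r r′ = solve 5 (λ p p′ r r′ w → p :* (r :* w) :+ p′ :* (r :* w) :+ p :* (r′ :* w) :+ p′ :* (r′ :* w) := (r :+ r′) :* ((p :+ p′) :* w)) refl p p′ r r′ W
    where open import Algebra.Solver.Ring.NaturalCoefficients.Default (CommutativeRing.commutativeSemiring ℚ-ring) using (solve; _:+_; _:*_; _:=_)

  term : ∀ i j →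
    ((q ^^ (2 ℕ.* i ℕ.* j))
        ⊗ (one ⊕ sV ⊗ (q ^^ j) ⊕ tV ⊗ (q ^^ i)
           ⊕ sV ⊗ tV ⊗ ((one ⊕ xV) ^^ (i ℕ.+ j)) ⊗ (inv1-x ^^ (i ℕ.+ j ℕ.+ 1)))
        ⊗ (sV ^^ (2 ℕ.* i)) ⊗ (tV ^^ (2 ℕ.* j))) a b c ≡ parityIndicator b j ℚ.* (parityIndicator a i ℚ.* W)
  term i j
    rewrite ^^≡^ q (2 ℕ.* i ℕ.* j) | ^^≡^ q j | ^^≡^ q i | ^^≡^ (one ⊕ xV) (i ℕ.+ j) | ^^≡^ inv1-x (i ℕ.+ j ℕ.+ 1)
    = trans
      (regroup 𝕊 sV tV (q ^ (2 ℕ.* i ℕ.* j)) (q ^ i) (q ^ j) ((one ⊕ xV) ^ (i ℕ.+ j)) (inv1-x ^ (i ℕ.+ j ℕ.+ 1))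
        (sV ^^ (2 ℕ.* i)) (tV ^^ (2 ℕ.* j))
        {inˣ (totalCuttings (2 ℕ.* i) (2 ℕ.* j))} {inˣ (totalCuttings (suc (2 ℕ.* i)) (2 ℕ.* j))}
        {inˣ (totalCuttings (2 ℕ.* i) (suc (2 ℕ.* j)))} {inˣ (totalCuttings (suc (2 ℕ.* i)) (suc (2 ℕ.* j)))}
        (series-even-even i j) (series-odd-even i j) (series-even-odd i j) (series-odd-odd i j) a b c)
      (trans
        (cong₂ ℚ._+_ (cong₂ ℚ._+_ (cong₂ ℚ._+_
          (monomial (2 ℕ.* i) (2 ℕ.* j)) (monomial (suc (2 ℕ.* i)) (2 ℕ.* j)))
          (monomial (2 ℕ.* i) (suc (2 ℕ.* j)))) (monomial (suc (2 ℕ.* i)) (suc (2 ℕ.* j))))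
        (factor ⟦ a == 2 ℕ.* i ⟧ ⟦ a == suc (2 ℕ.* i) ⟧ ⟦ b == 2 ℕ.* j ⟧ ⟦ b == suc (2 ℕ.* j) ⟧))

-- Words, permutations and their inverses

infixr 5 _∷_
data IsWord (l : ℕ) : ℕ → List ℕ → Set where
  []  : IsWord l 0 []
  _∷_ : ∀ {n k w} → k < l → IsWord l n w → IsWord l (suc n) (suc k ∷ w)

word-length : ∀ {l n w} → IsWord l n w → length w ≡ n
word-length []      = refl
word-length (_ ∷ w) = cong suc (word-length w)

word-at : ∀ {l n w} → IsWord l n w → ∀ i → i < n → ∃ λ k → k < l × at w i ≡ suc k
word-at (k<l ∷ w) zero    _         = _ , k<l , refl
word-at (k<l ∷ w) (suc i) (s≤s i<n) = word-at w i i<n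

tabulate-word : ∀ {l} n {f} → (∀ i → i < n → ∃ λ k → k < l × f i ≡ suc k) → IsWord l n (applyUpTo f n)
tabulate-word zero    range = []
tabulate-word (suc n) range with range 0 (s≤s z≤n)
... | k , k<l , eq rewrite eq = k<l ∷ tabulate-word n (λ i i<n → range (suc i) (s≤s i<n))

words-are-words : ∀ n l → All (IsWord l n) (words n l)
words-are-words zero    l = [] ∷ []
words-are-words (suc n) l = All.concat⁺ (All.map⁺ (All.map (λ w → All.map⁺ (All.map (_∷ w) (All.all-upTo l))) (words-are-words n l)))

at-applyUpTo : ∀ f n i → i < n → at (applyUpTo f n) i ≡ f i
at-applyUpTo f (suc n) zero    _         = refl
at-applyUpTo f (suc n) (suc i) (s≤s i<n) = at-applyUpTo (f ∘ suc) n i i<n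

at-ext : ∀ {w v} → length w ≡ length v → (∀ i → i < length w → at w i ≡ at v i) → w ≡ v
at-ext {[]}    {[]}    _   _  = refl
at-ext {a ∷ w} {b ∷ v} len eq = cong₂ _∷_ (eq 0 (s≤s z≤n)) (at-ext (ℕ.suc-injective len) (λ i i< → eq (suc i) (s≤s i<)))

_≟ᵇ_ : List ℕ → List ℕ → Bool
[]      ≟ᵇ []      = true
(a ∷ w) ≟ᵇ (b ∷ v) = (a == b) ∧ (w ≟ᵇ v)
_       ≟ᵇ _       = false

≟ᵇ-sound : ∀ {w v} → (w ≟ᵇ v) ≡ true → w ≡ v
≟ᵇ-sound {[]}    {[]}    _  = refl
≟ᵇ-sound {a ∷ w} {b ∷ v} eq with p , r ← ∧-split {a == b} eq = cong₂ _∷_ (==⇒≡ p) (≟ᵇ-sound r)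

≟ᵇ-refl : ∀ w → (w ≟ᵇ w) ≡ true
≟ᵇ-refl []      = refl
≟ᵇ-refl (a ∷ w) rewrite ≡⇒== {a} refl = ≟ᵇ-refl w

≟ᵇ-complete : ∀ {w v} → w ≡ v → (w ≟ᵇ v) ≡ true
≟ᵇ-complete {w} refl = ≟ᵇ-refl w

-- `words` lists every word exactly once. The bijections between words and permutations enter
-- through this fact and an exchange of double sums.
∑-words-δ : ∀ {l n y} → IsWord l n y → ∀ f → ∑ (words n l) (λ w → ⟦ w ≟ᵇ y ⟧ ℚ.* f w) ≡ f y
∑-words-δ []                                          f = trans (ℚ.+-identityʳ _) (ℚ.*-identityˡ (f []))
∑-words-δ {l} {suc n} {_ ∷ y} (_∷_ {k = k} k<l word) f = begin
  ∑ (words (suc n) l) (λ w → ⟦ w ≟ᵇ (suc k ∷ y) ⟧ ℚ.* f w)                               ≡⟨ ∑-words-suc n l _ ⟩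
  ∑ (words n l) (λ w → ∑ (upTo l) (λ a → ⟦ (a == k) ∧ (w ≟ᵇ y) ⟧ ℚ.* f (suc a ∷ w)))      ≡⟨ ∑-cong (words n l) inner ⟩
  ∑ (words n l) (λ w → ⟦ w ≟ᵇ y ⟧ ℚ.* f (suc k ∷ w))                                      ≡⟨ ∑-words-δ word (λ w → f (suc k ∷ w)) ⟩
  f (suc k ∷ y)                                                                           ∎
  where
  open ≡.≡-Reasoning
  rearrange : ∀ x y z → ⟦ x ∧ y ⟧ ℚ.* z ≡ ⟦ y ⟧ ℚ.* (⟦ x ⟧ ℚ.* z)
  rearrange x y z = trans (cong (ℚ._* z) (trans (⟦∧⟧ x y) (ℚ.*-comm ⟦ x ⟧ ⟦ y ⟧))) (ℚ.*-assoc ⟦ y ⟧ ⟦ x ⟧ z)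

  inner : ∀ w → ∑ (upTo l) (λ a → ⟦ (a == k) ∧ (w ≟ᵇ y) ⟧ ℚ.* f (suc a ∷ w)) ≡ ⟦ w ≟ᵇ y ⟧ ℚ.* f (suc k ∷ w)
  inner w = begin
    ∑ (upTo l) (λ a → ⟦ (a == k) ∧ (w ≟ᵇ y) ⟧ ℚ.* f (suc a ∷ w))           ≡⟨ ∑-cong (upTo l) (λ a → rearrange (a == k) (w ≟ᵇ y) (f (suc a ∷ w))) ⟩
    ∑ (upTo l) (λ a → ⟦ w ≟ᵇ y ⟧ ℚ.* (⟦ a == k ⟧ ℚ.* f (suc a ∷ w)))        ≡⟨ *-∑ (upTo l) ⟦ w ≟ᵇ y ⟧ _ ⟨
    ⟦ w ≟ᵇ y ⟧ ℚ.* ∑ (upTo l) (λ a → ⟦ a == k ⟧ ℚ.* f (suc a ∷ w))          ≡⟨ cong (⟦ w ≟ᵇ y ⟧ ℚ.*_) (∑-upTo-δ l k (λ a → f (suc a ∷ w)) k<l) ⟩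
    ⟦ w ≟ᵇ y ⟧ ℚ.* f (suc k ∷ w)                                            ∎

elem-at : ∀ w i → i < length w → elem (at w i) w ≡ true
elem-at (a ∷ w) zero    _        rewrite ≡⇒== {a} refl = refl
elem-at (a ∷ w) (suc i) (s≤s i<) rewrite elem-at w i i< = ∨-zeroʳ _

at-elem : ∀ a w → elem a w ≡ true → ∃ λ i → i < length w × at w i ≡ a
at-elem a (b ∷ w) eq with a == b in a==b
... | true  = 0 , s≤s z≤n , sym (==⇒≡ a==b)
... | false with i , i< , p ← at-elem a w eq = suc i , s≤s i< , p

distinct⇒injective : ∀ w → distinct w ≡ true → ∀ i j → i < length w → j < length w → at w i ≡ at w j → i ≡ j
distinct⇒injective (a ∷ w) d zero    zero    _ _ _ = refl
distinct⇒injective (a ∷ w) d zero    (suc j) _ (s≤s j<) eq with () ← trans (sym (proj₁ (∧-split {not (elem a w)} d))) (cong not (trans (cong (λ x → elem x w) eq) (elem-at w j j<)))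
distinct⇒injective (a ∷ w) d (suc i) zero    (s≤s i<) _ eq with () ← trans (sym (proj₁ (∧-split {not (elem a w)} d))) (cong not (trans (cong (λ x → elem x w) (sym eq)) (elem-at w i i<)))
distinct⇒injective (a ∷ w) d (suc i) (suc j) (s≤s i<) (s≤s j<) eq = cong suc (distinct⇒injective w (proj₂ (∧-split {not (elem a w)} d)) i j i< j< eq)

injective⇒distinct : ∀ w → (∀ i j → i < length w → j < length w → at w i ≡ at w j → i ≡ j) → distinct w ≡ true
injective⇒distinct []      inj = refl
injective⇒distinct (a ∷ w) inj with elem a w in el
... | false = injective⇒distinct w (λ i j i< j< eq → ℕ.suc-injective (inj (suc i) (suc j) (s≤s i<) (s≤s j<) eq))
... | true with i , i< , p ← at-elem a w el with () ← inj 0 (suc i) (s≤s z≤n) (s≤s i<) (sym p)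

position-at : ∀ w i → distinct w ≡ true → i < length w → position (at w i) w ≡ suc i
position-at (a ∷ w) zero    d _ rewrite ≡⇒== {a} refl = refl
position-at (a ∷ w) (suc i) d (s≤s i<)
  rewrite ≢⇒== {at w i} {a} (λ eq → contradiction (distinct⇒injective (a ∷ w) d (suc i) 0 (s≤s i<) (s≤s z≤n) eq) λ ())
        | elem-at w i i< | position-at w i (proj₂ (∧-split {not (elem a w)} d)) i< = refl

no-long-distinct : ∀ {l n w} → IsWord l n w → distinct w ≡ true → n ≤ l
no-long-distinct {l} {n} {w} word d = ℕ.≮⇒≥ λ l<n →
  let i , j , i<j , eq = Fin.pigeonhole l<n letter in
  contradiction (distinct⇒injective w d (Fin.toℕ i) (Fin.toℕ j) (bound i) (bound j) (same-letter i j eq)) (ℕ.<⇒≢ i<j)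
  where
  letter : Fin n → Fin l
  letter i = Fin.fromℕ< (proj₁ (proj₂ (word-at word (Fin.toℕ i) (Fin.toℕ<n i))))

  bound : ∀ i → Fin.toℕ i < length w
  bound i = subst (Fin.toℕ i <_) (sym (word-length word)) (Fin.toℕ<n i)

  letter-at : ∀ i → at w (Fin.toℕ i) ≡ suc (Fin.toℕ (letter i))
  letter-at i = let _ , k<l , eq = word-at word (Fin.toℕ i) (Fin.toℕ<n i) in trans eq (cong suc (sym (Fin.toℕ-fromℕ< k<l)))

  same-letter : ∀ i j → letter i ≡ letter j → at w (Fin.toℕ i) ≡ at w (Fin.toℕ j)
  same-letter i j eq = trans (letter-at i) (trans (cong (suc ∘ Fin.toℕ) eq) (sym (letter-at j)))

-- A permutation of the 0-based indices below n together with its inverse, as functions on all of ℕ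
-- to match the reading of words by `at`.
record Bijection (n : ℕ) : Set where
  field
    to from : ℕ → ℕ
    to<     : ∀ {i} → i < n → to i < n
    from<   : ∀ {k} → k < n → from k < n
    to-from : ∀ {k} → k < n → to (from k) ≡ k
    from-to : ∀ {i} → i < n → from (to i) ≡ i

  from-injective : ∀ {k k′} → k < n → k′ < n → from k ≡ from k′ → k ≡ k′
  from-injective k< k′< eq = trans (sym (to-from k<)) (trans (cong to eq) (to-from k′<))

  to==≡==from : ∀ {i k} → i < n → k < n → (k == to i) ≡ (i == from k)
  to==≡==from {i} {k} i< k< = Bool-ext
    (λ eq → ≡⇒== (trans (sym (from-to i<)) (cong from (sym (==⇒≡ {k} eq)))))
    (λ eq → ≡⇒== (trans (sym (to-from k<)) (cong to (sym (==⇒≡ {i} eq)))))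

  ∑-reindex : ∀ f → ℕ∑.∑ (upTo n) f ≡ ℕ∑.∑ (upTo n) (λ k → f (from k))
  ∑-reindex f = begin
    ℕ∑.∑ (upTo n) f                                                              ≡⟨ ℕ∑.∑-upTo-cong n (λ i i< → sym (ℕ∑.∑-upTo-δ n (to i) (λ _ → f i) (to< i<))) ⟩
    ℕ∑.∑ (upTo n) (λ i → ℕ∑.∑ (upTo n) (λ k → ℕ∑.⟦ k == to i ⟧ ℕ.* f i))        ≡⟨ ℕ∑.∑-swap (upTo n) (upTo n) _ ⟩
    ℕ∑.∑ (upTo n) (λ k → ℕ∑.∑ (upTo n) (λ i → ℕ∑.⟦ k == to i ⟧ ℕ.* f i))        ≡⟨ ℕ∑.∑-upTo-cong n (λ k k< → ℕ∑.∑-upTo-cong n (λ i i< → cong (λ b → ℕ∑.⟦ b ⟧ ℕ.* f i) (to==≡==from i< k<))) ⟩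
    ℕ∑.∑ (upTo n) (λ k → ℕ∑.∑ (upTo n) (λ i → ℕ∑.⟦ i == from k ⟧ ℕ.* f i))      ≡⟨ ℕ∑.∑-upTo-cong n (λ k k< → ℕ∑.∑-upTo-δ n (from k) f (from< k<)) ⟩
    ℕ∑.∑ (upTo n) (λ k → f (from k))                                             ∎
    where open ≡.≡-Reasoning

  compose-word : ∀ {l u} → IsWord l n u → (f : ℕ → ℕ) → (∀ {k} → k < n → f k < n) → IsWord l n (applyUpTo (at u ∘ f) n)
  compose-word word f f< = tabulate-word n (λ i i<n → word-at word (f i) (f< i<n))

  private
    invert : ∀ {l u g} (f f′ : ℕ → ℕ) → (∀ {i} → i < n → f′ i < n) → (∀ {i} → i < n → f (f′ i) ≡ i) → IsWord l n g →
             u ≡ applyUpTo (at g ∘ f) n → g ≡ applyUpTo (at u ∘ f′) n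
    invert {g = g} f f′ f′< ff′ word refl = at-ext (trans (word-length word) (sym (length-applyUpTo _ n))) λ i i< →
      let i<n = subst (i <_) (word-length word) i< in sym (begin
        at (applyUpTo (at (applyUpTo (at g ∘ f) n) ∘ f′) n) i   ≡⟨ at-applyUpTo _ n i i<n ⟩
        at (applyUpTo (at g ∘ f) n) (f′ i)                      ≡⟨ at-applyUpTo _ n (f′ i) (f′< i<n) ⟩
        at g (f (f′ i))                                         ≡⟨ cong (at g) (ff′ i<n) ⟩
        at g i                                                  ∎)
      where open ≡.≡-Reasoning

  -- This moves labels from the values of a permutation to its positions. Composition with `to` and
  -- with `from` undo each other on words, so matching pairs can be summed in either order.
  ∑-words-reindex : ∀ l φ → ∑ (words n l) φ ≡ ∑ (words n l) (λ u → φ (applyUpTo (at u ∘ from) n))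
  ∑-words-reindex l φ = begin
    ∑ (words n l) φ
      ≡⟨ ∑-cong-All (words-are-words n l) (λ g word → sym (∑-words-δ (compose-word word to to<) (λ _ → φ g))) ⟩
    ∑ (words n l) (λ g → ∑ (words n l) (λ u → ⟦ u ≟ᵇ applyUpTo (at g ∘ to) n ⟧ ℚ.* φ g))
      ≡⟨ ∑-swap (words n l) (words n l) _ ⟩
    ∑ (words n l) (λ u → ∑ (words n l) (λ g → ⟦ u ≟ᵇ applyUpTo (at g ∘ to) n ⟧ ℚ.* φ g))
      ≡⟨ ∑-cong-All (words-are-words n l) (λ u word-u → ∑-cong-All (words-are-words n l) (λ g word-g → cong (λ b → ⟦ b ⟧ ℚ.* φ g) (swap word-u word-g))) ⟩
    ∑ (words n l) (λ u → ∑ (words n l) (λ g → ⟦ g ≟ᵇ applyUpTo (at u ∘ from) n ⟧ ℚ.* φ g))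
      ≡⟨ ∑-cong-All (words-are-words n l) (λ u word → ∑-words-δ (compose-word word from from<) φ) ⟩
    ∑ (words n l) (λ u → φ (applyUpTo (at u ∘ from) n))
      ∎
    where
    open ≡.≡-Reasoning
    swap : ∀ {u g} → IsWord l n u → IsWord l n g → (u ≟ᵇ applyUpTo (at g ∘ to) n) ≡ (g ≟ᵇ applyUpTo (at u ∘ from) n)
    swap {u} {g} word-u word-g = Bool-ext
      (λ eq → ≟ᵇ-complete (invert to from from< to-from word-g (≟ᵇ-sound {u} eq)))
      (λ eq → ≟ᵇ-complete (invert from to to< from-to word-u (≟ᵇ-sound {g} eq)))

inverse≡ : ∀ π → inverse π ≡ applyUpTo (λ k → position (suc k) π) (length π)
inverse≡ π = map-upTo _ (length π)

module Permutation {n π} (word : IsWord n n π) (π-distinct : distinct π ≡ true) where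
  private
    len : length π ≡ n
    len = word-length word

    index : ∀ k → k < n → ∃ λ i → i < n × at π i ≡ suc k
    index k k<n with elem (suc k) π in el
    ... | true  = let i , i< , eq = at-elem (suc k) π el in i , subst (i <_) len i< , eq
    -- A letter missing from π could be put in front of it, giving n + 1 distinct letters out of n.
    ... | false = contradiction (no-long-distinct (k<n ∷ word) (trans (cong (λ b → not b ∧ distinct π) el) π-distinct)) (ℕ.<⇒≱ (ℕ.n<1+n n))

    letter : ∀ i → i < n → at π i ≡ suc (pred (at π i)) × pred (at π i) < n
    letter i i<n with k , k<n , eq ← word-at word i i<n rewrite eq = refl , k<n

    at-inverse : ∀ k → k < n → at (inverse π) k ≡ position (suc k) π
    at-inverse k k<n rewrite inverse≡ π = at-applyUpTo _ (length π) k (subst (k <_) (sym len) k<n)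

    position-of : ∀ i → i < n → position (at π i) π ≡ suc i
    position-of i i<n = position-at π i π-distinct (subst (i <_) (sym len) i<n)

    at-inverse-index : ∀ k i → k < n → i < n → at π i ≡ suc k → at (inverse π) k ≡ suc i
    at-inverse-index k i k<n i<n eq = trans (at-inverse k k<n) (trans (cong (λ a → position a π) (sym eq)) (position-of i i<n))

  bijection : Bijection n
  bijection = record
    { to = λ i → pred (at π i)
    ; from = λ k → pred (at (inverse π) k)
    ; to< = λ {i} i<n → proj₂ (letter i i<n)
    ; from< = λ {k} k<n → let i , i<n , eq = index k k<n in subst (_< n) (cong pred (sym (at-inverse-index k i k<n i<n eq))) i<n
    ; to-from = λ {k} k<n → let i , i<n , eq = index k k<n in
        trans (cong (λ a → pred (at π (pred a))) (at-inverse-index k i k<n i<n eq)) (cong pred eq)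
    ; from-to = λ {i} i<n → cong pred (at-inverse-index _ i (proj₂ (letter i i<n)) i<n (proj₁ (letter i i<n)))
    }

  at-to : ∀ {i} → i < n → at π i ≡ suc (Bijection.to bijection i)
  at-to {i} i<n = proj₁ (letter i i<n)

  at-from : ∀ {k} → k < n → at (inverse π) k ≡ suc (Bijection.from bijection k)
  at-from {k} k<n = let i , i<n , eq = index k k<n in
    trans (at-inverse-index k i k<n i<n eq) (cong suc (cong pred (sym (at-inverse-index k i k<n i<n eq))))

  length-inverse : length (inverse π) ≡ n
  length-inverse = trans (cong length (inverse≡ π)) (trans (length-applyUpTo _ (length π)) len)

  adjacent-distinct : AdjacentDistinct π
  adjacent-distinct i i< eq = ℕ.<⇒≢ (ℕ.n<1+n i) (distinct⇒injective π π-distinct i (suc i) (ℕ.<-trans (ℕ.n<1+n i) i<) i< eq)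

  inverse-adjacent-distinct : AdjacentDistinct (inverse π)
  inverse-adjacent-distinct k k<′ eq = ℕ.<⇒≢ (ℕ.n<1+n k)
    (Bijection.from-injective bijection k<n sk<n (cong pred eq))
    where
    sk<n : suc k < n
    sk<n = subst (suc k <_) length-inverse k<′
    k<n : k < n
    k<n = ℕ.<-trans (ℕ.n<1+n k) sk<n

-- Standardization

∑-mono-≤ : ∀ n {f g} → (∀ i → i < n → f i ≤ g i) → ℕ∑.∑ (upTo n) f ≤ ℕ∑.∑ (upTo n) g
∑-mono-≤ zero    le = z≤n
∑-mono-≤ (suc n) {f} {g} le rewrite ℕ∑.∑-upTo-last n f | ℕ∑.∑-upTo-last n g =
  ℕ.+-mono-≤ (∑-mono-≤ n (λ i i<n → le i (ℕ.m≤n⇒m≤1+n i<n))) (le n ℕ.≤-refl)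

∑-mono-< : ∀ n {f g} j → j < n → (∀ i → i < n → f i ≤ g i) → f j < g j → ℕ∑.∑ (upTo n) f < ℕ∑.∑ (upTo n) g
∑-mono-< (suc n) {f} {g} zero j<n le lt rewrite ℕ∑.∑-upTo-suc n f | ℕ∑.∑-upTo-suc n g =
  ℕ.+-mono-<-≤ lt (∑-mono-≤ n (λ i i<n → le (suc i) (s≤s i<n)))
∑-mono-< (suc n) {f} {g} (suc j) (s≤s j<n) le lt rewrite ℕ∑.∑-upTo-suc n f | ℕ∑.∑-upTo-suc n g =
  ℕ.+-mono-≤-< (le 0 (s≤s z≤n)) (∑-mono-< n j j<n (λ i i<n → le (suc i) (s≤s i<n)) lt)

⟦⟧-mono : ∀ {x y} → (x ≡ true → y ≡ true) → ℕ∑.⟦ x ⟧ ≤ ℕ∑.⟦ y ⟧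
⟦⟧-mono {true}  imp rewrite imp refl = ℕ.≤-refl
⟦⟧-mono {false} imp = z≤n

∑-<ᵇ : ∀ n m → m ≤ n → ℕ∑.∑ (upTo n) (λ k → ℕ∑.⟦ k <ᵇ m ⟧) ≡ m
∑-<ᵇ n       zero    _         = ℕ∑.∑-zero (upTo n)
∑-<ᵇ (suc n) (suc m) (s≤s m≤n) = trans (ℕ∑.∑-upTo-suc n (λ k → ℕ∑.⟦ k <ᵇ suc m ⟧)) (cong suc (∑-<ᵇ n m m≤n))

<ᵇ-+ˡ : ∀ k m n → (k ℕ.+ m <ᵇ k ℕ.+ n) ≡ (m <ᵇ n)
<ᵇ-+ˡ zero    m n = refl
<ᵇ-+ˡ (suc k) m n = <ᵇ-+ˡ k m n

lex-< : ∀ n {b c r r′} → b < c → r < n → n ℕ.* b ℕ.+ r < n ℕ.* c ℕ.+ r′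
lex-< n {b} {c} {r} {r′} b<c r<n = begin-strict
  n ℕ.* b ℕ.+ r     <⟨ ℕ.+-monoʳ-< (n ℕ.* b) r<n ⟩
  n ℕ.* b ℕ.+ n     ≡⟨ ℕ.+-comm (n ℕ.* b) n ⟩
  n ℕ.+ n ℕ.* b     ≡⟨ ℕ.*-suc n b ⟨
  n ℕ.* suc b       ≤⟨ ℕ.*-monoʳ-≤ n b<c ⟩
  n ℕ.* c           ≤⟨ ℕ.m≤m+n (n ℕ.* c) r′ ⟩
  n ℕ.* c ℕ.+ r′    ∎
  where open ℕ.≤-Reasoning

module Standardization (n : ℕ) (u : List ℕ) where

  -- Lexicographic code of the order in which standardization numbers the positions:
  -- by letter, then from left to right for an odd letter and from right to left for an even one.
  key : ℕ → ℕ
  key i = n ℕ.* at u i ℕ.+ (if odd (at u i) then i else n ∸ suc i)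

  rank : ℕ → ℕ
  rank i = ℕ∑.∑ (upTo n) (λ j → ℕ∑.⟦ key j <ᵇ key i ⟧)

  std : List ℕ
  std = applyUpTo (suc ∘ rank) n

  private
    offset< : ∀ b {i} → i < n → (if b then i else n ∸ suc i) < n
    offset< true  i<n = i<n
    offset< false {i} i<n = ℕ.∸-monoʳ-< {o = 0} (s≤s z≤n) i<n

    offset-cmp : ∀ b {i j} → i < n → j < n → i ≢ j →
                 ((if b then i else n ∸ suc i) <ᵇ (if b then j else n ∸ suc j)) ≡ same b (i <ᵇ j)
    offset-cmp true  i<n j<n i≢j = refl
    offset-cmp false {i} {j} i<n j<n i≢j with ℕ.<-cmp i j
    ... | tri< i<j _ _ rewrite <⇒<ᵇ≡ i<j = ≤⇒<ᵇ≡ (ℕ.∸-monoʳ-≤ n (s≤s (ℕ.<⇒≤ i<j)))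
    ... | tri≈ _ i≡j _ = contradiction i≡j i≢j
    ... | tri> _ _ j<i rewrite ≤⇒<ᵇ≡ (ℕ.<⇒≤ j<i) = <⇒<ᵇ≡ (ℕ.∸-monoʳ-< (s≤s j<i) i<n)

  -- The offset stays below n, so the letter decides first. For equal letters the offsets are
  -- compared, and n ∸ suc i reverses the order of the positions.
  key-precedes : ∀ {i j} → i < n → j < n → i ≢ j → (key i <ᵇ key j) ≡ precedes (at u i) (at u j) (i <ᵇ j)
  key-precedes {i} {j} i<n j<n i≢j with ℕ.<-cmp (at u i) (at u j)
  ... | tri< b<c _ _ rewrite <⇒<ᵇ≡ b<c = <⇒<ᵇ≡ (lex-< n b<c (offset< (odd (at u i)) i<n))
  ... | tri≈ _ b≡c _ rewrite b≡c | ≤⇒<ᵇ≡ {at u j} ℕ.≤-refl | ≡⇒== {at u j} refl =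
    trans (<ᵇ-+ˡ (n ℕ.* at u j) _ _) (offset-cmp (odd (at u j)) i<n j<n i≢j)
  ... | tri> _ _ c<b rewrite ≤⇒<ᵇ≡ (ℕ.<⇒≤ c<b) | ≢⇒== (ℕ.<⇒≢ c<b) =
    ≤⇒<ᵇ≡ (ℕ.<⇒≤ (lex-< n c<b (offset< (odd (at u j)) j<n)))

  key-injective : ∀ {i j} → i < n → j < n → key i ≡ key j → i ≡ j
  key-injective {i} {j} i<n j<n eq with i ℕ.≟ j
  ... | yes i≡j = i≡j
  ... | no  i≢j with ℕ.<-cmp (at u i) (at u j)
  ...   | tri< b<c _ _ = contradiction eq (ℕ.<⇒≢ (lex-< n b<c (offset< (odd (at u i)) i<n)))
  ...   | tri> _ _ c<b = contradiction (sym eq) (ℕ.<⇒≢ (lex-< n c<b (offset< (odd (at u j)) j<n)))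
  ...   | tri≈ _ b≡c _ rewrite b≡c = offset-injective (odd (at u j)) (ℕ.+-cancelˡ-≡ (n ℕ.* at u j) _ _ eq)
    where
    offset-injective : ∀ b → (if b then i else n ∸ suc i) ≡ (if b then j else n ∸ suc j) → i ≡ j
    offset-injective true  eq = eq
    offset-injective false eq = ℕ.suc-injective (ℕ.∸-cancelˡ-≡ i<n j<n eq)

  rank-mono : ∀ {i j} → i < n → key i < key j → rank i < rank j
  rank-mono {i} {j} i<n lt = ∑-mono-< n i i<n
    (λ k _ → ⟦⟧-mono (λ eq → <⇒<ᵇ≡ (ℕ.<-trans (<ᵇ≡⇒< {key k} eq) lt)))
    (subst (λ b → ℕ∑.⟦ key i <ᵇ key i ⟧ < ℕ∑.⟦ b ⟧) (sym (<⇒<ᵇ≡ lt))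
      (subst (λ b → ℕ∑.⟦ b ⟧ < 1) (sym (≤⇒<ᵇ≡ {key i} ℕ.≤-refl)) (s≤s z≤n)))

  rank< : ∀ {i} → i < n → rank i < n
  rank< {i} i<n = subst (rank i <_) (∑-<ᵇ n n ℕ.≤-refl) (∑-mono-< n i i<n
    (λ k k<n → ⟦⟧-mono {key k <ᵇ key i} (λ _ → <⇒<ᵇ≡ k<n))
    (subst (λ b → ℕ∑.⟦ b ⟧ < ℕ∑.⟦ i <ᵇ n ⟧) (sym (≤⇒<ᵇ≡ {key i} ℕ.≤-refl))
      (subst (λ b → 0 < ℕ∑.⟦ b ⟧) (sym (<⇒<ᵇ≡ i<n)) (s≤s z≤n))))

  rank-<ᵇ : ∀ {i j} → i < n → j < n → (rank i <ᵇ rank j) ≡ (key i <ᵇ key j)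
  rank-<ᵇ {i} {j} i<n j<n with ℕ.<-cmp (key i) (key j)
  ... | tri< lt _ _ = trans (<⇒<ᵇ≡ (rank-mono i<n lt)) (sym (<⇒<ᵇ≡ lt))
  ... | tri≈ _ eq _ rewrite eq = trans (≤⇒<ᵇ≡ {rank j} ℕ.≤-refl) (sym (≤⇒<ᵇ≡ {key j} ℕ.≤-refl))
  ... | tri> _ _ gt = trans (≤⇒<ᵇ≡ (ℕ.<⇒≤ (rank-mono j<n gt))) (sym (≤⇒<ᵇ≡ (ℕ.<⇒≤ gt)))

  at-std : ∀ {i} → i < n → at std i ≡ suc (rank i)
  at-std {i} = at-applyUpTo (suc ∘ rank) n i

  length-std : length std ≡ n
  length-std = length-applyUpTo (suc ∘ rank) n

  std-word : IsWord n n std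
  std-word = tabulate-word n (λ i i<n → rank i , rank< i<n , refl)

  std-distinct : distinct std ≡ true
  std-distinct = injective⇒distinct std λ i j i< j< eq →
    injective i j (subst (i <_) length-std i<) (subst (j <_) length-std j<) eq
    where
    injective : ∀ i j → i < n → j < n → at std i ≡ at std j → i ≡ j
    injective i j i<n j<n eq with ℕ.<-cmp (key i) (key j)
    ... | tri< lt _ _ = contradiction (ℕ.suc-injective (trans (sym (at-std i<n)) (trans eq (at-std j<n)))) (ℕ.<⇒≢ (rank-mono i<n lt))
    ... | tri≈ _ eq′ _ = key-injective i<n j<n eq′
    ... | tri> _ _ gt = contradiction (ℕ.suc-injective (trans (sym (at-std j<n)) (trans (sym eq) (at-std i<n)))) (ℕ.<⇒≢ (rank-mono j<n gt))

steps-cong : ∀ {r r′} w v → length w ≡ length v →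
             (∀ i → suc i < length w → r (at w i) (at w (suc i)) ≡ r′ (at v i) (at v (suc i))) → steps r w ≡ steps r′ v
steps-cong []          []           _   _  = refl
steps-cong (a ∷ [])    (b ∷ [])     _   _  = refl
steps-cong (a ∷ c ∷ w) (b ∷ c′ ∷ v) len eq =
  cong₂ _∷_ (eq 0 (s≤s (s≤s z≤n))) (steps-cong (c ∷ w) (c′ ∷ v) (ℕ.suc-injective len) (λ i i< → eq (suc i) (s≤s i<)))

-- Ranks compare like keys; for the neighbours i < i + 1 the condition on equal letters reduces to
-- their parity.
steps-std : ∀ {l n u} → IsWord l n u → steps _<ᵇ_ (Standardization.std n u) ≡ steps superAscent u
steps-std {l} {n} {u} word = steps-cong std u (trans length-std (sym (word-length word)))
  λ i i< → let si<n = subst (suc i <_) length-std i< in ascent i (ℕ.<-trans (ℕ.n<1+n i) si<n) si<n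
  where
  open Standardization n u
  ascent : ∀ i → i < n → suc i < n → (at std i <ᵇ at std (suc i)) ≡ superAscent (at u i) (at u (suc i))
  ascent i i<n si<n
    rewrite at-std i<n | at-std si<n | rank-<ᵇ i<n si<n | key-precedes i<n si<n (ℕ.<⇒≢ (ℕ.n<1+n i)) | <⇒<ᵇ≡ (ℕ.n<1+n i)
    = cong (λ b → (at u i <ᵇ at u (suc i)) ∨ ((at u (suc i) == at u i) ∧ b)) (same-true (odd (at u i)))
    where
    same-true : ∀ b → same b true ≡ b
    same-true true  = refl
    same-true false = refl

-- Words with a given standardization

AllPrecede : List ℕ → List ℕ → Set
AllPrecede g ρ = ∀ k → suc k < length g → precedes (at g k) (at g (suc k)) (at ρ k <ᵇ at ρ (suc k)) ≡ true

valid-sound : ∀ g ρ → valid g (steps _<ᵇ_ ρ) ≡ true → length g ≡ length ρ → AllPrecede g ρ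
valid-sound (b ∷ [])    (r ∷ [])     v len k (s≤s ())
valid-sound (b ∷ c ∷ g) (r ∷ r′ ∷ ρ) v len zero    _        = proj₁ (∧-split v)
valid-sound (b ∷ c ∷ g) (r ∷ r′ ∷ ρ) v len (suc k) (s≤s k<) =
  valid-sound (c ∷ g) (r′ ∷ ρ) (proj₂ (∧-split {precedes b c (r <ᵇ r′)} v)) (ℕ.suc-injective len) k k<

valid-complete : ∀ g ρ → 0 < length g → length g ≡ length ρ → AllPrecede g ρ → valid g (steps _<ᵇ_ ρ) ≡ true
valid-complete (b ∷ [])    (r ∷ [])     _ len all = refl
valid-complete (b ∷ c ∷ g) (r ∷ r′ ∷ ρ) _ len all =
  cong₂ _∧_ (all 0 (s≤s (s≤s z≤n))) (valid-complete (c ∷ g) (r′ ∷ ρ) (s≤s z≤n) (ℕ.suc-injective len) (λ k k< → all (suc k) (s≤s k<)))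

increasing : ∀ n (K : ℕ → ℕ) → (∀ k → suc k < n → K k < K (suc k)) → ∀ {k k′} → k < k′ → k′ < n → K k < K k′
increasing n K step {k} {suc k′} (s≤s k≤k′) sk′<n with ℕ.m≤n⇒m<n∨m≡n k≤k′
... | inj₁ k<k′ = ℕ.<-trans (increasing n K step k<k′ (ℕ.<-trans (ℕ.n<1+n k′) sk′<n)) (step k′ sk′<n)
... | inj₂ refl = step k sk′<n

-- A labeling of the values of π that is compatible with π⁻¹ is the same thing as a word whose standardization is π.
valid-≟ᵇ-std : ∀ {n π} (word : IsWord n n π) (π-distinct : distinct π ≡ true) (u : List ℕ) → 0 < n →
  valid (applyUpTo (at u ∘ Bijection.from (Permutation.bijection word π-distinct)) n) (steps _<ᵇ_ (inverse π)) ≡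
  (π ≟ᵇ Standardization.std n u)
valid-≟ᵇ-std {n} {π} word π-distinct u 0<n = Bool-ext
  (λ v → ≟ᵇ-complete (at-ext {π} {std} (trans (word-length word) (sym length-std)) (λ i i< → ranked v i (subst (i <_) (word-length word) i<))))
  (λ eq → valid-complete g (inverse π) (subst (0 <_) (sym length-g) 0<n) lengths (sorted (≟ᵇ-sound eq)))
  where
  open Permutation word π-distinct
  open Bijection bijection
  open Standardization n u

  g : List ℕ
  g = applyUpTo (at u ∘ from) n

  length-g : length g ≡ n
  length-g = length-applyUpTo (at u ∘ from) n

  lengths : length g ≡ length (inverse π)
  lengths = trans length-g (sym length-inverse)

  precedes-key : ∀ k → k < n → suc k < n →
    precedes (at g k) (at g (suc k)) (at (inverse π) k <ᵇ at (inverse π) (suc k)) ≡ (key (from k) <ᵇ key (from (suc k)))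
  precedes-key k k<n sk<n
    rewrite at-applyUpTo (at u ∘ from) n k k<n | at-applyUpTo (at u ∘ from) n (suc k) sk<n | at-from k<n | at-from sk<n
    = sym (key-precedes (from< k<n) (from< sk<n) (λ eq → ℕ.<⇒≢ (ℕ.n<1+n k) (from-injective k<n sk<n eq)))

  module _ (v : valid g (steps _<ᵇ_ (inverse π)) ≡ true) where
    private
      K : ℕ → ℕ
      K = key ∘ from

      -- Validity only compares neighbouring values; transitivity of the order of the keys makes it
      -- global.
      K-increasing : ∀ {k k′} → k < k′ → k′ < n → K k < K k′
      K-increasing = increasing n K (λ k sk<n → <ᵇ≡⇒< {K k}
        (trans (sym (precedes-key k (ℕ.<-trans (ℕ.n<1+n k) sk<n) sk<n)) (valid-sound g (inverse π) v lengths k (subst (suc k <_) (sym length-g) sk<n))))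

      K-<ᵇ : ∀ k k′ → k < n → k′ < n → (K k <ᵇ K k′) ≡ (k <ᵇ k′)
      K-<ᵇ k k′ k<n k′<n with ℕ.<-cmp k k′
      ... | tri< lt _ _ = trans (<⇒<ᵇ≡ (K-increasing lt k′<n)) (sym (<⇒<ᵇ≡ lt))
      ... | tri≈ _ refl _ = trans (≤⇒<ᵇ≡ {K k} ℕ.≤-refl) (sym (≤⇒<ᵇ≡ {k} ℕ.≤-refl))
      ... | tri> _ _ gt = trans (≤⇒<ᵇ≡ (ℕ.<⇒≤ (K-increasing gt k<n))) (sym (≤⇒<ᵇ≡ (ℕ.<⇒≤ gt)))

    -- The keys increase along the values, so the positions with a key below that of i are those
    -- whose values are k < `to i`. Their number, the rank of i, is therefore `to i`.
    ranked : ∀ i → i < n → at π i ≡ at std i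
    ranked i i<n = trans (at-to i<n) (trans (cong suc (sym rank≡to)) (sym (at-std i<n)))
      where
      open ≡.≡-Reasoning
      rank≡to : rank i ≡ to i
      rank≡to = begin
        ℕ∑.∑ (upTo n) (λ j → ℕ∑.⟦ key j <ᵇ key i ⟧)          ≡⟨ ∑-reindex (λ j → ℕ∑.⟦ key j <ᵇ key i ⟧) ⟩
        ℕ∑.∑ (upTo n) (λ k → ℕ∑.⟦ K k <ᵇ key i ⟧)            ≡⟨ cong (λ j → ℕ∑.∑ (upTo n) (λ k → ℕ∑.⟦ K k <ᵇ key j ⟧)) (from-to i<n) ⟨
        ℕ∑.∑ (upTo n) (λ k → ℕ∑.⟦ K k <ᵇ K (to i) ⟧)         ≡⟨ ℕ∑.∑-upTo-cong n (λ k k<n → cong ℕ∑.⟦_⟧ (K-<ᵇ k (to i) k<n (to< i<n))) ⟩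
        ℕ∑.∑ (upTo n) (λ k → ℕ∑.⟦ k <ᵇ to i ⟧)               ≡⟨ ∑-<ᵇ n (to i) (ℕ.<⇒≤ (to< i<n)) ⟩
        to i                                                 ∎

  -- Here `from k` is the position of rank k, so the keys of `from k` and `from (suc k)` compare
  -- like k and k + 1.
  sorted : π ≡ std → AllPrecede g (inverse π)
  sorted eq k sk<′ = begin
    precedes (at g k) (at g (suc k)) (at (inverse π) k <ᵇ at (inverse π) (suc k))  ≡⟨ precedes-key k k<n sk<n ⟩
    (key (from k) <ᵇ key (from (suc k)))                                           ≡⟨ rank-<ᵇ (from< k<n) (from< sk<n) ⟨
    (rank (from k) <ᵇ rank (from (suc k)))                                         ≡⟨ cong₂ _<ᵇ_ (rank-from k<n) (rank-from sk<n) ⟩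
    (k <ᵇ suc k)                                                                   ≡⟨ <⇒<ᵇ≡ (ℕ.n<1+n k) ⟩
    true                                                                           ∎
    where
    open ≡.≡-Reasoning
    sk<n : suc k < n
    sk<n = subst (suc k <_) length-g sk<′
    k<n : k < n
    k<n = ℕ.<-trans (ℕ.n<1+n k) sk<n
    rank-from : ∀ {k} → k < n → rank (from k) ≡ k
    rank-from {k} k<n = ℕ.suc-injective (begin
      suc (rank (from k))      ≡⟨ at-std (from< k<n) ⟨
      at std (from k)          ≡⟨ cong (λ w → at w (from k)) eq ⟨
      at π (from k)            ≡⟨ at-to (from< k<n) ⟩
      suc (to (from k))        ≡⟨ cong suc (to-from k<n) ⟩
      suc k                    ∎)

-- From sums over permutations to sums over words

length-steps : ∀ r a w → length (steps r (a ∷ w)) ≡ length w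
length-steps r a []      = refl
length-steps r a (b ∷ w) = cong suc (length-steps r b w)

∑-perms : ∀ n f → ∑ (perms n) f ≡ ∑ (words n n) (λ π → ⟦ distinct π ⟧ ℚ.* f π)
∑-perms n f = trans (∑-filter _ (words n n) f) (∑-cong (words n n) (λ w → cong (λ b → ⟦ b ⟧ ℚ.* f w) (does-≟ (distinct w))))
  where
  does-≟ : ∀ b → does (b Bool.≟ true) ≡ b
  does-≟ true  = refl
  does-≟ false = refl

labelings-inverse : ∀ {n π} l → 0 < n → IsWord n n π → distinct π ≡ true →
  labelings l true (steps _<ᵇ_ (inverse π)) ≡ ∑ (words n l) (λ u → ⟦ π ≟ᵇ Standardization.std n u ⟧)
labelings-inverse {n} {π} l 0<n word d = begin
  labelings l true p                                                   ≡⟨ valid-count l p ⟨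
  ∑ (words (suc (length p)) l) (λ g → ⟦ valid g p ⟧)                   ≡⟨ cong (λ m → ∑ (words m l) (λ g → ⟦ valid g p ⟧)) (length-p (inverse π) length-inverse) ⟩
  ∑ (words n l) (λ g → ⟦ valid g p ⟧)                                  ≡⟨ ∑-words-reindex l (λ g → ⟦ valid g p ⟧) ⟩
  ∑ (words n l) (λ u → ⟦ valid (applyUpTo (at u ∘ from) n) p ⟧)        ≡⟨ ∑-cong (words n l) (λ u → cong ⟦_⟧ (valid-≟ᵇ-std word d u 0<n)) ⟩
  ∑ (words n l) (λ u → ⟦ π ≟ᵇ Standardization.std n u ⟧)               ∎
  where
  open ≡.≡-Reasoning
  open Permutation word d
  open Bijection bijection
  p = steps _<ᵇ_ (inverse π)
  length-p : ∀ w → length w ≡ n → suc (length (steps _<ᵇ_ w)) ≡ n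
  length-p []      eq = contradiction eq (ℕ.<⇒≢ 0<n)
  length-p (a ∷ w) eq = trans (cong suc (length-steps _<ᵇ_ a w)) eq

-- After the exchange of sums each word meets only its own standardization, which is a permutation.
-- `F` sees only the steps, and standardization preserves them.
∑-perms-standardize : ∀ n l (F : List Bool → ℚ) → 0 < n →
  ∑ (perms n) (λ π → F (steps _<ᵇ_ π) ℚ.* labelings l true (steps _<ᵇ_ (inverse π))) ≡
  ∑ (words n l) (λ u → F (steps superAscent u))
∑-perms-standardize n l F 0<n = begin
  ∑ (perms n) (λ π → F (steps _<ᵇ_ π) ℚ.* labelings l true (steps _<ᵇ_ (inverse π)))
    ≡⟨ ∑-perms n _ ⟩
  ∑ (words n n) (λ π → ⟦ distinct π ⟧ ℚ.* (F (steps _<ᵇ_ π) ℚ.* labelings l true (steps _<ᵇ_ (inverse π))))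
    ≡⟨ ∑-cong-All (words-are-words n n) expand ⟩
  ∑ (words n n) (λ π → ∑ (words n l) (λ u → ⟦ π ≟ᵇ std u ⟧ ℚ.* (⟦ distinct π ⟧ ℚ.* F (steps _<ᵇ_ π))))
    ≡⟨ ∑-swap (words n n) (words n l) _ ⟩
  ∑ (words n l) (λ u → ∑ (words n n) (λ π → ⟦ π ≟ᵇ std u ⟧ ℚ.* (⟦ distinct π ⟧ ℚ.* F (steps _<ᵇ_ π))))
    ≡⟨ ∑-cong-All (words-are-words n l) collapse ⟩
  ∑ (words n l) (λ u → F (steps superAscent u))
    ∎
  where
  open ≡.≡-Reasoning
  std : List ℕ → List ℕ
  std = Standardization.std n

  expand : ∀ π → IsWord n n π →
    ⟦ distinct π ⟧ ℚ.* (F (steps _<ᵇ_ π) ℚ.* labelings l true (steps _<ᵇ_ (inverse π))) ≡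
    ∑ (words n l) (λ u → ⟦ π ≟ᵇ std u ⟧ ℚ.* (⟦ distinct π ⟧ ℚ.* F (steps _<ᵇ_ π)))
  expand π word = begin
    ⟦ distinct π ⟧ ℚ.* (F (steps _<ᵇ_ π) ℚ.* labelings l true (steps _<ᵇ_ (inverse π)))   ≡⟨ counted (distinct π) refl ⟩
    ⟦ distinct π ⟧ ℚ.* (F (steps _<ᵇ_ π) ℚ.* S)                                           ≡⟨ ℚ.*-assoc ⟦ distinct π ⟧ (F (steps _<ᵇ_ π)) S ⟨
    ⟦ distinct π ⟧ ℚ.* F (steps _<ᵇ_ π) ℚ.* S                                             ≡⟨ ℚ.*-comm _ S ⟩
    S ℚ.* (⟦ distinct π ⟧ ℚ.* F (steps _<ᵇ_ π))                                           ≡⟨ ∑-* (words n l) _ _ ⟩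
    ∑ (words n l) (λ u → ⟦ π ≟ᵇ std u ⟧ ℚ.* (⟦ distinct π ⟧ ℚ.* F (steps _<ᵇ_ π)))        ∎
    where
    S = ∑ (words n l) (λ u → ⟦ π ≟ᵇ std u ⟧)
    counted : ∀ b → distinct π ≡ b → ⟦ b ⟧ ℚ.* (F (steps _<ᵇ_ π) ℚ.* labelings l true (steps _<ᵇ_ (inverse π))) ≡ ⟦ b ⟧ ℚ.* (F (steps _<ᵇ_ π) ℚ.* S)
    counted true  d = cong (λ y → 1ℚ ℚ.* (F (steps _<ᵇ_ π) ℚ.* y)) (labelings-inverse l 0<n word d)
    counted false d = trans (ℚ.*-zeroˡ (F (steps _<ᵇ_ π) ℚ.* labelings l true (steps _<ᵇ_ (inverse π)))) (sym (ℚ.*-zeroˡ (F (steps _<ᵇ_ π) ℚ.* S)))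

  collapse : ∀ u → IsWord l n u →
    ∑ (words n n) (λ π → ⟦ π ≟ᵇ std u ⟧ ℚ.* (⟦ distinct π ⟧ ℚ.* F (steps _<ᵇ_ π))) ≡ F (steps superAscent u)
  collapse u word = begin
    ∑ (words n n) (λ π → ⟦ π ≟ᵇ std u ⟧ ℚ.* (⟦ distinct π ⟧ ℚ.* F (steps _<ᵇ_ π)))  ≡⟨ ∑-words-δ std-word (λ π → ⟦ distinct π ⟧ ℚ.* F (steps _<ᵇ_ π)) ⟩
    ⟦ distinct (std u) ⟧ ℚ.* F (steps _<ᵇ_ (std u))                                 ≡⟨ cong (λ b → ⟦ b ⟧ ℚ.* F (steps _<ᵇ_ (std u))) std-distinct ⟩
    1ℚ ℚ.* F (steps _<ᵇ_ (std u))                                                   ≡⟨ ℚ.*-identityˡ _ ⟩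
    F (steps _<ᵇ_ (std u))                                                          ≡⟨ cong F (steps-std word) ⟩
    F (steps superAscent u)                                                         ∎
    where open Standardization n u using (std-word; std-distinct)

-- Coefficients of the left-hand side

perms-are-perms : ∀ n → All (λ π → IsWord n n π × distinct π ≡ true) (perms n)
perms-are-perms n = All.zip (All.filter⁺ P? (words-are-words n n) , All.all-filter P? (words n n))
  where P? = λ w → distinct w Bool.≟ true

P-∑ : ∀ n u v → P n u v ≡ 𝕊∑.∑ (perms n) (λ π → (u ^^ udr π) ⊗ (v ^^ iudr π))
P-∑ n u v = go (perms n)
  where
  go : ∀ πs → foldr (λ π acc → (u ^^ udr π) ⊗ (v ^^ iudr π) ⊕ acc) (const 0ℚ) πs ≡ 𝕊∑.∑ πs (λ π → (u ^^ udr π) ⊗ (v ^^ iudr π))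
  go []       = refl
  go (π ∷ πs) = cong ((u ^^ udr π) ⊗ (v ^^ iudr π) ⊕_) (go πs)

private
  module S = LabelingSeries {sV} refl inS
  module T = LabelingSeries {tV} refl inT

  U V K : Series
  U = two ⊗ sV ⊗ inv1+s²
  V = two ⊗ tV ⊗ inv1+t²
  K = const (+ 1 ℚ./ 4) ⊗ (inv1-s ^^ 2) ⊗ (inv1-t ^^ 2)

  F : ℕ → Series
  F n = ((one ⊕ sV ^^ 2) ^^ n) ⊗ ((one ⊕ tV ^^ 2) ^^ n)
        ⊗ (inv1-s² ^^ (n ∸ 1)) ⊗ (inv1-t² ^^ (n ∸ 1))
        ⊗ P n U V
        ⊗ (xV ^^ n)

  L : List ℕ → ℕ → ℚ
  L w k = labelings k true (steps _<ᵇ_ w)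

udr-steps : ∀ m w → length w ≡ suc m → AdjacentDistinct w →
            udr w ≡ suc (turns true (steps _<ᵇ_ w)) × length (steps _<ᵇ_ w) ≡ m
udr-steps m (a ∷ w) len ad = udr-turns a w ad , trans (length-steps _<ᵇ_ a w) (ℕ.suc-injective len)

module UdrSeries {z : Series} (z₀ : z 0 0 0 ≡ 0ℚ) (Z : SeriesIn z) where
  open SeriesIn Z using (embed)

  closedForm : ℕ → ℕ → Series
  closedForm m t = half ⊗ (geom z ^^ 2) ⊗ ((one ⊕ z ^^ 2) ^^ suc m) ⊗ (geom (z ^^ 2) ^^ m) ⊗ ((two ⊗ z ⊗ geom (⊖ (z ^^ 2))) ^^ t)

  udr-series : ∀ m w → length w ≡ suc m → AdjacentDistinct w → closedForm m (udr w) ≈ˢ embed (L w)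
  udr-series m w len ad = let eq , eq′ = udr-steps m w len ad in 𝕊.sym (𝕊.trans
    (LabelingSeries.labelings-series z₀ Z true (steps _<ᵇ_ w))
    (𝕊.reflexive (trans (powers (geom z) (one ⊕ z ^^ 2) (geom (z ^^ 2)) (two ⊗ z ⊗ geom (⊖ (z ^^ 2))) (length (steps _<ᵇ_ w)) (turns true (steps _<ᵇ_ w)))
      (cong₂ closedForm eq′ (sym eq)))))
    where
    powers : ∀ i w j v m t →
      half ⊗ i ^ 2 ⊗ w ^ suc m ⊗ j ^ m ⊗ v ^ suc t ≡ half ⊗ (i ^^ 2) ⊗ (w ^^ suc m) ⊗ (j ^^ m) ⊗ (v ^^ suc t)
    powers i w j v m t rewrite ^^≡^ w m | ^^≡^ j m | ^^≡^ v t = refl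

private
  -- The quarter is shared out as one half for each variable. Every permutation then contributes the
  -- cutting series of π in s times that of its inverse in t.
  K⊗F : ∀ m → K ⊗ F (suc m) ≈ˢ xV ^^ suc m ⊗ 𝕊∑.∑ (perms (suc m)) (λ π → inˢ (L π) ⊗ inᵗ (L (inverse π)))
  K⊗F m = begin
    K ⊗ F n                                                              ≈⟨ pull-out 𝕊 K a b c d (P n U V) (xV ^^ n) ⟩
    xV ^^ n ⊗ (K ⊗ a ⊗ b ⊗ c ⊗ d ⊗ P n U V)                              ≡⟨ cong (λ p → xV ^^ n ⊗ (K ⊗ a ⊗ b ⊗ c ⊗ d ⊗ p)) (P-∑ n U V) ⟩
    xV ^^ n ⊗ (K ⊗ a ⊗ b ⊗ c ⊗ d ⊗ 𝕊∑.∑ (perms n) f)                     ≈⟨ 𝕊.*-congˡ {xV ^^ n} (𝕊∑.*-∑ (perms n) (K ⊗ a ⊗ b ⊗ c ⊗ d) f) ⟩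
    xV ^^ n ⊗ 𝕊∑.∑ (perms n) (λ π → K ⊗ a ⊗ b ⊗ c ⊗ d ⊗ f π)             ≈⟨ 𝕊.*-congˡ {xV ^^ n} (𝕊∑.∑-cong-All (perms-are-perms n) term) ⟩
    xV ^^ n ⊗ 𝕊∑.∑ (perms n) (λ π → inˢ (L π) ⊗ inᵗ (L (inverse π)))     ∎
    where
    open import Relation.Binary.Reasoning.Setoid 𝕊.setoid
    n = suc m
    a b c d : Series
    a = (one ⊕ sV ^^ 2) ^^ n
    b = (one ⊕ tV ^^ 2) ^^ n
    c = inv1-s² ^^ m
    d = inv1-t² ^^ m
    f : List ℕ → Series
    f π = (U ^^ udr π) ⊗ (V ^^ iudr π)

    term : ∀ π → IsWord n n π × distinct π ≡ true → K ⊗ a ⊗ b ⊗ c ⊗ d ⊗ f π ≈ˢ inˢ (L π) ⊗ inᵗ (L (inverse π))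
    term π (word , π-distinct) = 𝕊.trans
      (separate 𝕊 half (inv1-s ^^ 2) (inv1-t ^^ 2) a b c d (U ^^ udr π) (V ^^ iudr π) {const (+ 1 ℚ./ 4)} quarter≈)
      (⊗-cong (UdrSeries.udr-series {sV} refl inS m π (word-length word) adjacent-distinct)
              (UdrSeries.udr-series {tV} refl inT m (inverse π) length-inverse inverse-adjacent-distinct))
      where open Permutation word π-distinct

  K⊗F-coeff : ∀ m a b c → (K ⊗ F (suc m)) a b c ≡
    (if suc m ≤ᵇ c then ∑ (perms (suc m)) (λ π → ⟦ c ∸ suc m == 0 ⟧ ℚ.* (L π a ℚ.* L (inverse π) b)) else 0ℚ)
  K⊗F-coeff m a b c = trans (K⊗F m a b c) (trans (xV^-⊗ (suc m) (𝕊∑.∑ (perms (suc m)) f) a b c) (cong (λ y → if suc m ≤ᵇ c then y else 0ℚ)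
    (trans (∑-coeff (perms (suc m)) f a b (c ∸ suc m)) (∑-cong (perms (suc m)) (λ π → inˢ-⊗-inᵗ (L π) (L (inverse π)) a b (c ∸ suc m))))))
    where
    f : List ℕ → Series
    f π = inˢ (L π) ⊗ inᵗ (L (inverse π))

  F-vanishes : ∀ n a b c → c < n → F n a b c ≡ 0ℚ
  F-vanishes n a b c c<n = trans (𝕊.*-comm Y (xV ^^ n) a b c)
    (trans (xV^-⊗ n Y a b c) (cong (λ e → if e then Y a b (c ∸ n) else 0ℚ) (¬T⇒≡ {n ≤ᵇ c} (λ t → ℕ.<⇒≱ c<n (ℕ.≤ᵇ⇒≤ n c t)))))
    where Y = ((one ⊕ sV ^^ 2) ^^ n) ⊗ ((one ⊕ tV ^^ 2) ^^ n) ⊗ (inv1-s² ^^ (n ∸ 1)) ⊗ (inv1-t² ^^ (n ∸ 1)) ⊗ P n U V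

  F₁ : ℕ → Series
  F₁ n a b c = if n == 0 then 0ℚ else F n a b c

  -- `sumX₁` stops at the x-degree of the coefficient that is read. As xⁿ divides `F n`, the bound c
  -- can be used for all coefficients entering the product.
  K⊗sumX₁ : ∀ a b c → (K ⊗ sumX₁ F) a b c ≡ sumTo c (λ n → (K ⊗ F₁ n) a b c)
  K⊗sumX₁ a b c = trans (⊗-local K {sumX₁ F} {λ a b c′ → sumTo c (λ n → F₁ n a b c′)} a b c truncate) (⊗-sumTo K c F₁ a b c)
    where
    truncate : ∀ a′ b′ c′ → a′ ≤ a → b′ ≤ b → c′ ≤ c → sumX₁ F a′ b′ c′ ≡ sumTo c (λ n → F₁ n a′ b′ c′)
    truncate a′ b′ c′ _ _ c′≤c = sumTo-extend c′≤c λ { (suc n) c′<n → F-vanishes (suc n) a′ b′ c′ c′<n }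

sumTo-last : ∀ n f → (∀ i → i < n → f i ≡ 0ℚ) → sumTo n f ≡ f n
sumTo-last zero    f p = refl
sumTo-last (suc n) f p = trans (cong (ℚ._+ f (suc n)) (sumTo-zero n (λ i i≤n → p i (s≤s i≤n)))) (ℚ.+-identityˡ (f (suc n)))

private
  F₁-zero : ∀ a b c → (K ⊗ F₁ 0) a b c ≡ 0ℚ
  F₁-zero a b c = trans (𝕊.*-congˡ {K} {F₁ 0} {const 0ℚ} (λ a b c → sym (const0 a b c)) a b c) (trans (𝕊.zeroʳ K a b c) (const0 a b c))

  -- Apart from the factor xⁿ the product involves only s and t, so the coefficient of x^c comes
  -- from n = c alone.
  earlier-vanish : ∀ a b c n → n < c → (K ⊗ F₁ n) a b c ≡ 0ℚ
  earlier-vanish a b c zero    _   = F₁-zero a b c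
  earlier-vanish a b c (suc m) m<c = trans (K⊗F-coeff m a b c) (vanish (suc m ≤ᵇ c))
    where
    vanish : ∀ e → (if e then ∑ (perms (suc m)) (λ π → ⟦ c ∸ suc m == 0 ⟧ ℚ.* (L π a ℚ.* L (inverse π) b)) else 0ℚ) ≡ 0ℚ
    vanish false = refl
    vanish true  = trans (∑-cong (perms (suc m)) zero-term) (∑-zero (perms (suc m)))
      where
      zero-term : ∀ π → ⟦ c ∸ suc m == 0 ⟧ ℚ.* (L π a ℚ.* L (inverse π) b) ≡ 0ℚ
      zero-term π rewrite ≢⇒== (ℕ.m>n⇒m∸n≢0 m<c) = ℚ.*-zeroˡ (L π a ℚ.* L (inverse π) b)

  last-coeff : ∀ a b m → (K ⊗ F₁ (suc m)) a b (suc m) ≡ totalCuttings a b (suc m)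
  last-coeff a b m = begin
    (K ⊗ F n) a b n                                                                                               ≡⟨ K⊗F-coeff m a b n ⟩
    (if n ≤ᵇ n then ∑ (perms n) (λ π → ⟦ n ∸ n == 0 ⟧ ℚ.* (L π a ℚ.* L (inverse π) b)) else 0ℚ)                   ≡⟨ cong (λ e → if e then ∑ (perms n) (λ π → ⟦ n ∸ n == 0 ⟧ ℚ.* (L π a ℚ.* L (inverse π) b)) else 0ℚ) (T⇒≡ (ℕ.≤⇒≤ᵇ (ℕ.≤-refl {n}))) ⟩
    ∑ (perms n) (λ π → ⟦ n ∸ n == 0 ⟧ ℚ.* (L π a ℚ.* L (inverse π) b))                                            ≡⟨ ∑-cong (perms n) (λ π → trans (cong (λ k → ⟦ k == 0 ⟧ ℚ.* (L π a ℚ.* L (inverse π) b)) (ℕ.n∸n≡0 n)) (ℚ.*-identityˡ (L π a ℚ.* L (inverse π) b))) ⟩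
    ∑ (perms n) (λ π → L π a ℚ.* L (inverse π) b)                                                                 ≡⟨ ∑-perms-standardize n b (labelings a true) (s≤s z≤n) ⟩
    ∑ (words n b) (λ u → labelings a true (steps superAscent u))                                                  ≡⟨ ∑-cong-All (words-are-words n b) nonempty ⟩
    totalCuttings a b n                                                                                           ∎
    where
    open ≡.≡-Reasoning
    n = suc m
    nonempty : ∀ u → IsWord b n u → labelings a true (steps superAscent u) ≡ cuttings a true u
    nonempty _ (_ ∷ _) = refl

  inv1-s⊗inv1-t : ∀ a b c → (inv1-s ⊗ inv1-t) a b c ≡ ⟦ c == 0 ⟧ ℚ.* (1ℚ ℚ.* 1ℚ)
  inv1-s⊗inv1-t a b c = trans (⊗-cong (𝕊.sym S.embed-ones) (𝕊.sym T.embed-ones) a b c) (inˢ-⊗-inᵗ (λ _ → 1ℚ) (λ _ → 1ℚ) a b c)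

LHS-coeff : ∀ a b c → LHS a b c ≡ totalCuttings a b c
LHS-coeff a b c = trans (cong₂ ℚ._+_ (inv1-s⊗inv1-t a b c)
    (trans (K⊗sumX₁ a b c) (sumTo-last c _ (earlier-vanish a b c)))) (by-degree c)
  where
  by-degree : ∀ c → ⟦ c == 0 ⟧ ℚ.* (1ℚ ℚ.* 1ℚ) ℚ.+ (K ⊗ F₁ c) a b c ≡ totalCuttings a b c
  -- In x-degree zero only the first summand is left: the empty word has exactly one cutting into a
  -- pieces, including a = 0.
  by-degree zero    = cong (⟦ true ⟧ ℚ.* (1ℚ ℚ.* 1ℚ) ℚ.+_) (F₁-zero a b 0)
  by-degree (suc m) = trans (ℚ.+-identityˡ ((K ⊗ F₁ (suc m)) a b (suc m))) (last-coeff a b m)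

theorem5p1 : ∀ (a b c : ℕ) → LHS a b c ≡ RHS a b c
theorem5p1 a b c = trans (LHS-coeff a b c) (sym (RHS-coeff a b c))
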